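{- Let $c_1,\dots,c_{n-2}$ and $k$ be positive integers, and put $\mathbf{a}=(1^{(n-2)},2)$ (that is, $n-2$ ones followed by a $2$) and $\mathbf{c}=(c_1,\dots,c_{n-2},1)$. Let $$\Delta_{k,\mathbf{a},\mathbf{c}}=\Big\{x\in\mathbb{R}^n_{\ge 0} : \sum_{i=1}^n x_i=k,\ x_i\le c_i \text{ for } 1\le i\le n-2,\ x_{n-1}+x_n\le 1\Big\}.$$ The coefficient of $t^m$ in $(n-1)!\,\mathrm{ehr}(\Delta_{k,\mathbf{a},\mathbf{c}},t)$ can be described as follows, in terms of sets $S_1,S_2,S_3,S_4$ of cycle-ordered, weighted permutations of $[n]$. - $S_1$: if $k<n-1$ or $m+1>1$, let $S_1$ be the set of $(\mathbf{a},\mathbf{c})$-compatible cycle-ordered, weighted permutations of type $(n,m+1,k)$. Otherwise, if $k=n-1$ and $m+1=1$, let $S_1$ be the set of cycle-ordered, weighted permutations of type $(n,1,n-1)$ (note that these cycle-ordered, weighted permutations are not $(\mathbf{a},\mathbf{c})$-compatible). - $S_2$ is the set of cycle-ordered, weighted permutations $(\sigma,p,w)$ of type $(n,m+1,k)$ such that: the cycles of $\sigma$ not containing $n-1$ are properly $(\mathbf{a},\mathbf{c})$-weighted; $n-1$ and $n$ are in different cycles; the cycle containing $n-1$ is improperly $(\mathbf{a},\mathbf{c})$-weighted; and the cycle $\mathfrak{c}$ containing $n$ satisfies $w(\mathfrak{c})=\sum_{i\in\mathfrak{c},\,i\ne n}c_i$. - $S_3$ is the set of cycle-ordered, weighted permutations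 $(\sigma,p,w)$ of type $(n,m,k)$ such that: the cycles not containing $n-1$ or $n$ are properly $(\mathbf{a},\mathbf{c})$-weighted; $n-1$ and $n$ are in distinct cycles; the cycle containing $n-1$ is improperly $(\mathbf{a},\mathbf{c})$-weighted; and the cycle $\mathfrak{c}$ containing $n$ satisfies $w(\mathfrak{c})<\sum_{i\in\mathfrak{c},\,i\ne n}c_i$. - $S_4$: if $m>1$, let $S_4$ be the set of cycle-ordered, weighted permutations $(\sigma,p,w)$ of type $(n,m,k)$ such that $n-1$ and $n$ are in the same cycle, which is improperly $(\mathbf{a},\mathbf{c})$-weighted, and the remaining cycles are properly $(\mathbf{a},\mathbf{c})$-weighted. Otherwise, if $m=1$, let $S_4=\emptyset$. Then $$[t^m]\,(n-1)!\,\mathrm{ehr}(\Delta_{k,\mathbf{a},\mathbf{c}},t)=|S_1|+|S_2|-|S_3|-|S_4|=|S_1\cup S_2|-|S_3\cup S_4|.$$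
   Context: For a polytope $P\subset\mathbb{R}^n$ with integral vertices, $\mathrm{ehr}(P,t)$ is the (Ehrhart) polynomial in $t$ with $\mathrm{ehr}(P,t)=\#(tP\cap\mathbb{Z}^n)$ for all positive integers $t$; $[t^m]$ denotes the coefficient of $t^m$. For a permutation $\sigma$, $C(\sigma)$ denotes the set of cycles in its cycle decomposition (fixed points count as cycles of length 1). For a permutation $p=[p_1,\dots,p_r]$ of $[r]=\{1,\dots,r\}$ in one-line notation, $\mathrm{Des}(p)=\{1\le i\le r-1 : p_i>p_{i+1}\}$ and $\mathrm{des}(p)=|\mathrm{Des}(p)|$. A cycle-ordered, weighted permutation of $[n]$ is a triple $(\sigma,p,w)$ where $\sigma$ is a permutation of $[n]$; $p$ is a permutation of $[r]$ with $p(r)=1$, where $r=|C(\sigma)|$; and $w:C(\sigma)\to\mathbb{N}_0=\{0,1,2,\dots\}$ is a function. The value $w(\mathfrak{c})$ is the weight of the cycle $\mathfrak{c}$, and the total weight is $w(\sigma)=\sum_{\mathfrak{c}\in C(\sigma)}w(\mathfrak{c})$. The triple $(\sigma,p,w)$ is of type $(n,r,k)$ if $|C(\sigma)|=r$ and $k=w(\sigma)+\mathrm{des}(p)$. There are none of type $(n,0,k)$, so for $m=0$ the sets $S_3$ and $S_4$ are empty. For $\mathbf{a}=(1^{(n-2)},2)$ and $\mathbf{c}=(c_1,\dots,c_{n-2},1)$, a cycle $\mathfrak{c}\in C(\sigma)$ of $(\sigma,p,w)$ is properly $(\mathbf{a},\mathbf{c})$-weighted if: (1) when neither $n-1$ nor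 $n$ is in $\mathfrak{c}$, $w(\mathfrak{c})<\sum_{i\in\mathfrak{c}}c_i$; (2) when $n-1$ or $n$ (or both) is in $\mathfrak{c}$, $w(\mathfrak{c})<1+\sum_{i\in\mathfrak{c},\,i\le n-2}c_i$. Otherwise the cycle is improperly $(\mathbf{a},\mathbf{c})$-weighted. The triple $(\sigma,p,w)$ is $(\mathbf{a},\mathbf{c})$-compatible if each cycle of $\sigma$ is properly $(\mathbf{a},\mathbf{c})$-weighted. In $S_2$ and $S_3$, the sum $\sum_{i\in\mathfrak{c},\,i\ne n}c_i$ is over a cycle not containing $n-1$, so it only involves $c_1,\dots,c_{n-2}$; an empty sum is $0$.
   Formalization: The polytope Δ is assumed nonempty (for n=2, k=2, m=1 it is empty, the coefficient is 0, but |S₂|=1 and the other sets are empty), and the case m=0, k>n−1, for which S₁ is not defined, is excluded. -}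

module Defs where

open import Level using (0ℓ)
open import Data.Bool using (if_then_else_)
import Data.Bool.Properties as Bool
open import Data.Nat using (ℕ; zero; suc; _+_; _<_; _>_)
open import Data.Integer as ℤ using (ℤ; +_)
open import Data.Rational as ℚ using (ℚ; 0ℚ; 1ℚ; _/_)
open import Data.Fin using (Fin; zero; suc; toℕ; _↑ˡ_; _↑ʳ_)
import Data.Fin as Fin
import Data.Fin.Properties as Fin
open import Data.Fin.Subset using (Subset; _∈_; _∉_)
open import Data.List as List using (List; []; _∷_; length)
import Data.List.Membership.Propositional as List
open import Data.List.Relation.Unary.Unique.Propositional using (Unique)
open import Data.Vec as Vec using (Vec; []; _∷_; lookup; tabulate)
open import Data.Vec.Properties using (≡-dec)
open import Data.Product using (_×_; ∃; ∃-syntax)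
open import Data.Sum using (_⊎_)
open import Function using (_⇔_; Bijective)
import Function.Endo.Propositional as Endo
open import Relation.Nullary using (¬_; does)
open import Relation.Unary using (Pred)
open import Relation.Binary.PropositionalEquality using (_≡_; _≢_)

_HasCardinality_ : {A : Set} → Pred A 0ℓ → ℕ → Set
P HasCardinality N =
  ∃[ xs ] Unique xs × (∀ x → (x List.∈ xs) ⇔ P x) × length xs ≡ N

fromℤ : ℤ → ℚ
fromℤ z = z / 1

fromℕ : ℕ → ℚ
fromℕ a = fromℤ (+ a)

-- Univariate polynomials over ℚ as coefficient lists, constant term first.
-- Trailing zeros are allowed, so a polynomial has many representations.
Polynomial : Set
Polynomial = List ℚ

⟦_⟧ : Polynomial → ℚ → ℚ
⟦ f ⟧ t = List.foldr (λ a b → a ℚ.+ t ℚ.* b) 0ℚ f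

[t^_] : ℕ → Polynomial → ℚ
[t^ _     ] []      = 0ℚ
[t^ zero  ] (a ∷ _) = a
[t^ suc m ] (_ ∷ f) = [t^ m ] f

infixr 7 _·_
_·_ : ℕ → Polynomial → Polynomial
a · f = List.map (fromℕ a ℚ.*_) f

-- Regions of ℝⁿ are given by their rational points.  This loses nothing when
-- counting lattice points of integer dilates: for integers z and t > 0 the
-- point z / t is rational.
Region : ℕ → Set₁
Region n = Pred (Vec ℚ n) 0ℓ

dilate : ∀ {n} → ℕ → Region n → Region n
dilate t P y = ∃[ x ] P x × y ≡ Vec.map (fromℕ t ℚ.*_) x

latticePoints : ∀ {n} → Region n → Pred (Vec ℤ n) 0ℓ
latticePoints P z = P (Vec.map fromℤ z)

IsEhrhartPolynomial : ∀ {n} → Region n → Polynomial → Set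
IsEhrhartPolynomial P f =
  ∀ t → 0 < t →
  ∃[ N ] (latticePoints (dilate t P) HasCardinality N) × ⟦ f ⟧ (fromℕ t) ≡ fromℕ N

-- One-line notation.
IsPermutation : ∀ {n} → Vec (Fin n) n → Set
IsPermutation σ = Bijective _≡_ _≡_ (lookup σ)

-- The cycle { σᵉ(i) : e ≥ 0 } through i, as a set; it has at most n elements,
-- so the exponents e < n suffice.
cycleOf : ∀ {n} → Vec (Fin n) n → Fin n → Subset n
cycleOf {n} σ i =
  tabulate λ j → does (Fin.any? λ (e : Fin n) → Endo._^_ (Fin n) (lookup σ) (toℕ e) i Fin.≟ j)

-- C(σ), each cycle listed once.
cycles : ∀ {n} → Vec (Fin n) n → List (Subset n)
cycles {n} σ =
  List.deduplicate (≡-dec Bool._≟_) (List.map (cycleOf σ) (List.allFin n))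

∣C_∣ : ∀ {n} → Vec (Fin n) n → ℕ
∣C σ ∣ = length (cycles σ)

des : ∀ {r l} → Vec (Fin r) l → ℕ
des []           = 0
des (_ ∷ [])     = 0
des (x ∷ y ∷ zs) = (if does (y Fin.<? x) then 1 else 0) + des (y ∷ zs)

-- The data of a cycle-ordered, weighted permutation, with the conditions on
-- it kept separate so that ≡ compares data only.  A cycle is named by its
-- position in cycles σ, so w is a function C(σ) → ℕ.
record Triple (n : ℕ) : Set where
  constructor ⟨_,_,_⟩
  field
    σ : Vec (Fin n) n
    p : Vec (Fin ∣C σ ∣) ∣C σ ∣
    w : Vec ℕ ∣C σ ∣

  Cycle : Set
  Cycle = Fin ∣C σ ∣

  elements : Cycle → Subset n
  elements = List.lookup (cycles σ)

  weight : Cycle → ℕ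
  weight = lookup w

  totalWeight : ℕ
  totalWeight = Vec.sum w

-- The last condition is p(r) = 1; entries and positions are counted from 0
-- here.  It fails when r = 0.
IsCycleOrderedWeighted : ∀ {n} → Pred (Triple n) 0ℓ
IsCycleOrderedWeighted T =
  IsPermutation σ × IsPermutation p ×
  (∃[ i ] suc (toℕ i) ≡ ∣C σ ∣ × toℕ (lookup p i) ≡ 0)
  where open Triple T

OfType : ∀ {n} → ℕ → ℕ → Pred (Triple n) 0ℓ
OfType r k T =
  IsCycleOrderedWeighted T × ∣C σ ∣ ≡ r × k ≡ totalWeight + des p
  where open Triple T

-- From here on n = d + 2, c lists c₁, …, c_{n-2}, and a = (1^(n-2), 2).
old : ∀ {d} → Fin d → Fin (d + 2)
old i = i ↑ˡ 2

penultimate : ∀ {d} → Fin (d + 2)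
penultimate {d} = d ↑ʳ zero

ultimate : ∀ {d} → Fin (d + 2)
ultimate {d} = d ↑ʳ suc zero

Δ : ∀ {d} → Vec ℕ d → ℕ → Region (d + 2)
Δ {d} c k x =
  (∀ i → 0ℚ ℚ.≤ lookup x i) ×
  Vec.foldr′ ℚ._+_ 0ℚ x ≡ fromℕ k ×
  (∀ (i : Fin d) → lookup x (old i) ℚ.≤ fromℕ (lookup c i)) ×
  lookup x penultimate ℚ.+ lookup x ultimate ℚ.≤ 1ℚ

-- The sum of cᵢ over i ∈ s with i ≤ n-2.
sumOver : ∀ {d} → Vec ℕ d → Subset (d + 2) → ℕ
sumOver c s = Vec.sum (tabulate λ i → if lookup s (old i) then lookup c i else 0)

module _ {d : ℕ} (c : Vec ℕ d) (T : Triple (d + 2)) where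
  open Triple T

  Proper : Cycle → Set
  Proper 𝔠 =
    (penultimate ∉ elements 𝔠 × ultimate ∉ elements 𝔠 →
       weight 𝔠 < sumOver c (elements 𝔠)) ×
    (penultimate ∈ elements 𝔠 ⊎ ultimate ∈ elements 𝔠 →
       weight 𝔠 < 1 + sumOver c (elements 𝔠))

  Improper : Cycle → Set
  Improper 𝔠 = ¬ Proper 𝔠

  Compatible : Set
  Compatible = ∀ 𝔠 → Proper 𝔠

  InDifferentCycles : Set
  InDifferentCycles = ∀ 𝔠 → ¬ (penultimate ∈ elements 𝔠 × ultimate ∈ elements 𝔠)

-- The two cases in the definition of S₁.  They do not cover k > n-1, m = 0.
Regular : (d k m : ℕ) → Set
Regular d k m = k < d + 1 ⊎ m + 1 > 1

Special : (d k m : ℕ) → Set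
Special d k m = k ≡ d + 1 × m + 1 ≡ 1

module _ {d : ℕ} (c : Vec ℕ d) (k m : ℕ) where

  S₁ : Pred (Triple (d + 2)) 0ℓ
  S₁ T =
    (Regular d k m × OfType (m + 1) k T × Compatible c T) ⊎
    (Special d k m × OfType 1 (d + 1) T)

  S₂ : Pred (Triple (d + 2)) 0ℓ
  S₂ T =
    OfType (m + 1) k T ×
    (∀ 𝔠 → penultimate ∉ elements 𝔠 → Proper c T 𝔠) ×
    InDifferentCycles c T ×
    (∀ 𝔠 → penultimate ∈ elements 𝔠 → Improper c T 𝔠) ×
    (∀ 𝔠 → ultimate ∈ elements 𝔠 → weight 𝔠 ≡ sumOver c (elements 𝔠))
    where open Triple T

  S₃ : Pred (Triple (d + 2)) 0ℓ
  S₃ T =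
    OfType m k T ×
    (∀ 𝔠 → penultimate ∉ elements 𝔠 → ultimate ∉ elements 𝔠 → Proper c T 𝔠) ×
    InDifferentCycles c T ×
    (∀ 𝔠 → penultimate ∈ elements 𝔠 → Improper c T 𝔠) ×
    (∀ 𝔠 → ultimate ∈ elements 𝔠 → weight 𝔠 < sumOver c (elements 𝔠))
    where open Triple T

  S₄ : Pred (Triple (d + 2)) 0ℓ
  S₄ T =
    m > 1 ×
    OfType m k T ×
    (∃[ 𝔠 ] penultimate ∈ elements 𝔠 × ultimate ∈ elements 𝔠 × Improper c T 𝔠 ×
       (∀ 𝔡 → 𝔡 ≢ 𝔠 → Proper c T 𝔡))
    where open Triple T

module Submission where

-- Both sides are expanded over the subsets I of [n]. For the dilate by t,
-- inclusion–exclusion on the bounds xᵢ ≤ t cᵢ, together with the factor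
-- (1 - (t+2) zᵗ⁺¹ + (t+1) zᵗ⁺²) / (1 - z)² for the last two coordinates, gives
-- one term per I, a multiple of ∏ (t (k - c_I) - |I| + j) over 0 < j < n. For a
-- permutation σ with r cycles, the ways to order and weight them are counted by
-- ∏ (1 - x^c_𝔠) Σ jʳ⁻¹ xʲ, with a factor (1 - x^c_𝔠) for each properly weighted
-- cycle, by Worpitzky's identity. Deleting the smallest element from its cycle
-- gives a recursion for the sum over σ, which is solved by the same multiple of
-- the same product. The two terms of I differ only in that the first is dropped
-- where its exponent of z exceeds t k; the product vanishes there, unless I = [n]
-- and k = 1 + Σ cᵢ, and this is what the exceptions in S₁ (m = 0) and S₄ (m = 1)
-- compensate. A polynomial is determined by its values at the positive integers.

-- The recursion leaves the family in which it starts: inserting 0 into the cycle of j adds its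
-- bound to that of j, and j may be n - 1 or n. So the induction runs over vectors `c` of full
-- length n, although the theorem has 0 in the last two places (`padded`), and over a number `r` of
-- cycles already split off. At the bottom only n - 1 and n are left, and only there do the four
-- sets differ, since on cycles that avoid both elements all four rules agree. If n - 1 and n lie in
-- different cycles, the rule of S₁ applies a bound 1 to each of them and produces a product term,
-- whereas the polytope has one bound 1 for both. S₂ removes this term; S₃ and S₄, which have one
-- cycle less and hence a factor t, supply the multiples of t. The counts enter as coefficients of a
-- polynomial in t, evaluated by `horner` with k fixed.

open import Data.Bool using (Bool; true; false; not; if_then_else_)
open import Data.Fin using (Fin; zero; suc; toℕ)
open import Data.Fin.Subset using (Subset)
open import Data.Integer.Tactic.RingSolver using (solve-∀)
open import Data.List as List using (List; []; _∷_; length)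
open import Data.List.Relation.Unary.AllPairs using ([]; _∷_)
open import Data.List.Relation.Unary.Any using (here; there)
open import Data.List.Relation.Unary.Unique.Propositional using (Unique)
open import Data.Nat as ℕ using (ℕ; zero; suc; z≤n; s≤s)
import Data.Nat.Properties as ℕ
open import Data.Product using (Σ; ∃-syntax; _×_; _,_; proj₁; proj₂; uncurry)
open import Data.Sum using (_⊎_; inj₁; inj₂)
open import Data.Vec as Vec using (Vec; []; _∷_)
open import Function using (_∘_; _⇔_; mk⇔; Injective; Equivalence)
open import Relation.Nullary using (¬_; Dec; does; yes; no; contradiction)
open import Relation.Binary.PropositionalEquality

-- Finite cardinalities, duplicate-free enumerations and finite sums

module Sums where

  open import Defs using (_HasCardinality_)
  open import Data.Integer using (ℤ; 0ℤ; 1ℤ; _+_; _*_) renaming (+_ to pos)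
  open import Data.Integer.Properties using (+-identityˡ; +-assoc; pos-+; *-zeroʳ; *-distribˡ-+)
  open import Data.List using (_++_; map; tabulate)
  open import Data.List.Membership.Propositional using (_∈_)
  open import Data.List.Membership.Propositional.Properties using (∈-++⁺ˡ; ∈-++⁺ʳ; ∈-++⁻; ∈-map⁺; ∈-map⁻)
  open import Data.List.Membership.Propositional.Properties.WithK using (unique∧set⇒bag)
  open import Data.List.Relation.Binary.BagAndSetEquality using (∼bag⇒↭)
  open import Data.List.Relation.Binary.Permutation.Propositional using (_↭_)
  open import Data.List.Relation.Binary.Permutation.Propositional.Properties using (↭-length)
  open import Data.List.Relation.Unary.All using (lookup)
  open import Data.List.Relation.Unary.Unique.Propositional.Properties using (++⁺; map⁺)
  open import Relation.Unary using (Pred)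
  open import Level using (0ℓ)

  private variable
    A C : Set

  -- Membership in a duplicate-free list has at most one proof, so equal sets are equal bags. This
  -- compares lists of cycles without computing the order in which deduplication leaves them.
  unique-↭ : {xs ys : List A} → Unique xs → Unique ys → (∀ x → x ∈ xs ⇔ x ∈ ys) → xs ↭ ys
  unique-↭ u v e = ∼bag⇒↭ (unique∧set⇒bag u v (λ {x} → e x))

  cardinality-unique : {P : Pred A 0ℓ} {M N : ℕ} → P HasCardinality M → P HasCardinality N → M ≡ N
  cardinality-unique (xs , u , e , refl) (ys , v , f , refl) =
    ↭-length (unique-↭ u v λ x → mk⇔ (from (f x) ∘ to (e x)) (from (e x) ∘ to (f x)))
    where open Equivalence

  cardinality-cong : {P Q : Pred A 0ℓ} {N : ℕ} → (∀ x → P x ⇔ Q x) → P HasCardinality N → Q HasCardinality N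
  cardinality-cong h (xs , u , e , l) =
    xs , u , (λ x → mk⇔ (to (h x) ∘ to (e x)) (from (e x) ∘ from (h x))) , l
    where open Equivalence

  module _ {A C : Set} {B : A → Set} where
    -- The type of the second component depends on the first because p and w have as many entries as
    -- σ has cycles.
    bind : (xs : List A) (ys : ∀ a → List (B a)) (f : ∀ a → B a → C) → List C
    bind []       ys f = []
    bind (x ∷ xs) ys f = map (f x) (ys x) ++ bind xs ys f

    ∈-bind⁺ : ∀ {xs} {ys : ∀ a → List (B a)} (f : ∀ a → B a → C) {a b} → a ∈ xs → b ∈ ys a → f a b ∈ bind xs ys f
    ∈-bind⁺ {xs = x ∷ xs} f (here refl) q = ∈-++⁺ˡ (∈-map⁺ (f x) q)
    ∈-bind⁺ {xs = x ∷ xs} {ys} f (there p) q = ∈-++⁺ʳ (map (f x) (ys x)) (∈-bind⁺ f p q)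

    ∈-bind⁻ : ∀ xs (ys : ∀ a → List (B a)) (f : ∀ a → B a → C) {c} → c ∈ bind xs ys f →
              ∃[ a ] ∃[ b ] a ∈ xs × b ∈ ys a × c ≡ f a b
    ∈-bind⁻ (x ∷ xs) ys f m with ∈-++⁻ (map (f x) (ys x)) m
    ... | inj₁ l = let b , q , e = ∈-map⁻ (f x) l in x , b , here refl , q , e
    ... | inj₂ r = let a , b , p , q , e = ∈-bind⁻ xs ys f r in a , b , there p , q , e

    bind-unique : ∀ {xs} {ys : ∀ a → List (B a)} (f : ∀ a → B a → C) →
                  (∀ {a a′ b b′} → f a b ≡ f a′ b′ → _≡_ {A = Σ A B} (a , b) (a′ , b′)) →
                  Unique xs → (∀ a → Unique (ys a)) → Unique (bind xs ys f)
    bind-unique f inj []       u = []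
    bind-unique {xs = x ∷ xs} {ys} f inj (n ∷ v) u =
      ++⁺ (map⁺ (λ e → cancel (inj e)) (u x)) (bind-unique f inj v u) disjoint
      where
      cancel : ∀ {a b b′} → _≡_ {A = Σ A B} (a , b) (a , b′) → b ≡ b′
      cancel refl = refl
      disjoint : ∀ {c} → c ∈ map (f x) (ys x) × c ∈ bind xs ys f → _
      disjoint (l , r) with ∈-map⁻ (f x) l | ∈-bind⁻ xs ys f r
      ... | b , _ , e | a , b′ , p , _ , e′ with refl ← inj (trans (sym e) e′) = lookup n p refl

  ∑ : List A → (A → ℤ) → ℤ
  ∑ []       f = 0ℤ
  ∑ (x ∷ xs) f = f x + ∑ xs f

  ∑-cong : ∀ (xs : List A) {f g : A → ℤ} → (∀ x → f x ≡ g x) → ∑ xs f ≡ ∑ xs g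
  ∑-cong []       h = refl
  ∑-cong (x ∷ xs) h = cong₂ _+_ (h x) (∑-cong xs h)

  ∑-zero : ∀ (xs : List A) → ∑ xs (λ _ → 0ℤ) ≡ 0ℤ
  ∑-zero []       = refl
  ∑-zero (x ∷ xs) = trans (+-identityˡ _) (∑-zero xs)

  ∑-+ : ∀ (xs : List A) (f g : A → ℤ) → ∑ xs (λ x → f x + g x) ≡ ∑ xs f + ∑ xs g
  ∑-+ []       f g = refl
  ∑-+ (x ∷ xs) f g rewrite ∑-+ xs f g = interchange (f x) (g x) (∑ xs f) (∑ xs g)
    where
    interchange : ∀ a b c d → (a + b) + (c + d) ≡ (a + c) + (b + d)
    interchange = solve-∀

  ∑-* : ∀ a (xs : List A) (f : A → ℤ) → ∑ xs (λ x → a * f x) ≡ a * ∑ xs f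
  ∑-* a []       f = sym (*-zeroʳ a)
  ∑-* a (x ∷ xs) f rewrite ∑-* a xs f = sym (*-distribˡ-+ a (f x) (∑ xs f))

  ∑-++ : ∀ (xs ys : List A) (f : A → ℤ) → ∑ (xs ++ ys) f ≡ ∑ xs f + ∑ ys f
  ∑-++ []       ys f = sym (+-identityˡ _)
  ∑-++ (x ∷ xs) ys f = trans (cong (f x +_) (∑-++ xs ys f)) (sym (+-assoc (f x) _ _))

  ∑-map : ∀ (g : A → C) xs (f : C → ℤ) → ∑ (map g xs) f ≡ ∑ xs (f ∘ g)
  ∑-map g []       f = refl
  ∑-map g (x ∷ xs) f = cong (f (g x) +_) (∑-map g xs f)

  ∑-bind : ∀ {B : A → Set} (xs : List A) (ys : ∀ a → List (B a)) (g : ∀ a → B a → C) (f : C → ℤ) →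
           ∑ (bind xs ys g) f ≡ ∑ xs (λ a → ∑ (ys a) (f ∘ g a))
  ∑-bind []       ys g f = refl
  ∑-bind (x ∷ xs) ys g f =
    trans (∑-++ (map (g x) (ys x)) _ f) (cong₂ _+_ (∑-map (g x) (ys x) f) (∑-bind xs ys g f))

  length-∑ : ∀ (xs : List A) → pos (length xs) ≡ ∑ xs (λ _ → 1ℤ)
  length-∑ []       = refl
  length-∑ (x ∷ xs) = trans (pos-+ 1 _) (cong (1ℤ +_) (length-∑ xs))

  length-bind : ∀ {B : A → Set} (xs : List A) (ys : ∀ a → List (B a)) (g : ∀ a → B a → C) →
                pos (length (bind xs ys g)) ≡ ∑ xs (λ a → pos (length (ys a)))
  length-bind xs ys g =
    trans (length-∑ (bind xs ys g))
          (trans (∑-bind xs ys g _) (∑-cong xs λ a → sym (length-∑ (ys a))))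

  ∑Fin : ∀ {n} → (Fin n → ℤ) → ℤ
  ∑Fin {zero}  f = 0ℤ
  ∑Fin {suc n} f = f zero + ∑Fin (f ∘ suc)

  ∑-tabulate : ∀ {n} (g : Fin n → A) (f : A → ℤ) → ∑ (tabulate g) f ≡ ∑Fin (f ∘ g)
  ∑-tabulate {n = zero}  g f = refl
  ∑-tabulate {n = suc n} g f = cong (f (g zero) +_) (∑-tabulate (g ∘ suc) f)

  ∑-cong-∈ : ∀ (xs : List A) {f g : A → ℤ} → (∀ x → x ∈ xs → f x ≡ g x) → ∑ xs f ≡ ∑ xs g
  ∑-cong-∈ []       h = refl
  ∑-cong-∈ (x ∷ xs) h = cong₂ _+_ (h x (here refl)) (∑-cong-∈ xs λ y m → h y (there m))

  ∑Fin-cong : ∀ {n} {f g : Fin n → ℤ} → (∀ i → f i ≡ g i) → ∑Fin f ≡ ∑Fin g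
  ∑Fin-cong {zero}  h = refl
  ∑Fin-cong {suc n} h = cong₂ _+_ (h zero) (∑Fin-cong (h ∘ suc))

  ∑Fin-* : ∀ {n} a (f : Fin n → ℤ) → ∑Fin (λ i → a * f i) ≡ a * ∑Fin f
  ∑Fin-* {zero}  a f = sym (*-zeroʳ a)
  ∑Fin-* {suc n} a f = trans (cong (a * f zero +_) (∑Fin-* a (f ∘ suc))) (sym (*-distribˡ-+ a (f zero) _))

  ∑Fin-+ : ∀ {n} (f g : Fin n → ℤ) → ∑Fin (λ i → f i + g i) ≡ ∑Fin f + ∑Fin g
  ∑Fin-+ {zero}  f g = refl
  ∑Fin-+ {suc n} f g rewrite ∑Fin-+ (f ∘ suc) (g ∘ suc) =
    interchange (f zero) (g zero) (∑Fin (f ∘ suc)) (∑Fin (g ∘ suc))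
    where
    interchange : ∀ a b c d → (a + b) + (c + d) ≡ (a + c) + (b + d)
    interchange = solve-∀

  ∑Fin-zero : ∀ n → ∑Fin {n} (λ _ → 0ℤ) ≡ 0ℤ
  ∑Fin-zero zero    = refl
  ∑Fin-zero (suc n) = trans (+-identityˡ _) (∑Fin-zero n)

  ∑Fin-∑ : ∀ {A : Set} {n} (xs : List A) (f : Fin n → A → ℤ) →
           ∑Fin (λ i → ∑ xs (f i)) ≡ ∑ xs (λ x → ∑Fin (λ i → f i x))
  ∑Fin-∑ {n = zero}  xs f = sym (∑-zero xs)
  ∑Fin-∑ {n = suc n} xs f = trans (cong (∑ xs (f zero) +_) (∑Fin-∑ xs (f ∘ suc))) (sym (∑-+ xs (f zero) _))

  -- Nested in the same way as `⟦_⟧`, so that the two agree by induction (`⟦applyUpTo⟧`).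
  horner : ℤ → ℕ → (ℕ → ℤ) → ℤ
  horner t zero    f = 0ℤ
  horner t (suc B) f = f 0 + t * horner t B (f ∘ suc)

  horner-cong : ∀ t B {f g} → (∀ m → f m ≡ g m) → horner t B f ≡ horner t B g
  horner-cong t zero    h = refl
  horner-cong t (suc B) h = cong₂ (λ x y → x + t * y) (h 0) (horner-cong t B (h ∘ suc))

  horner-zero : ∀ t B → horner t B (λ _ → 0ℤ) ≡ 0ℤ
  horner-zero t zero    = refl
  horner-zero t (suc B) = trans (+-identityˡ _) (trans (cong (t *_) (horner-zero t B)) (*-zeroʳ t))

  horner-∑ : ∀ t B (xs : List A) (f : A → ℕ → ℤ) → horner t B (λ m → ∑ xs (λ x → f x m)) ≡ ∑ xs (λ x → horner t B (f x))
  horner-∑ t zero    xs f = sym (∑-zero xs)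
  horner-∑ t (suc B) xs f = begin
    ∑ xs (λ x → f x 0) + t * horner t B (λ m → ∑ xs (λ x → f x (suc m)))
      ≡⟨ cong (λ y → ∑ xs (λ x → f x 0) + t * y) (horner-∑ t B xs (λ x → f x ∘ suc)) ⟩
    ∑ xs (λ x → f x 0) + t * ∑ xs (λ x → horner t B (f x ∘ suc))
      ≡⟨ cong (∑ xs (λ x → f x 0) +_) (∑-* t xs (λ x → horner t B (f x ∘ suc))) ⟨
    ∑ xs (λ x → f x 0) + ∑ xs (λ x → t * horner t B (f x ∘ suc))
      ≡⟨ ∑-+ xs (λ x → f x 0) (λ x → t * horner t B (f x ∘ suc)) ⟨
    ∑ xs (λ x → horner t (suc B) (f x)) ∎
    where open ≡-Reasoning

-- Power series as coefficient sequences, and operators for weight constraints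

module Series where

  open Sums
  open import Data.Nat using (_<ᵇ_; _≡ᵇ_)
  open import Data.Integer using (ℤ; 0ℤ; 1ℤ; -1ℤ; _+_; _*_; _-_)
  open import Data.Integer.Properties using (+-identityˡ; +-identityʳ; +-inverseʳ; *-zeroʳ; *-distribˡ-+)
  open import Data.List.Relation.Binary.Permutation.Propositional as ↭ using (_↭_)
  open ≡-Reasoning

  -- A formal power series, as its sequence of coefficients.
  Series : Set
  Series = ℕ → ℤ

  -- Multiplication by xᵇ.
  sh : ℕ → Series → Series
  sh zero    f K       = f K
  sh (suc b) f zero    = 0ℤ
  sh (suc b) f (suc K) = sh b f K

  -- Multiplication by 1/(1 - x).
  S : Series → Series
  S f zero    = f zero
  S f (suc K) = f (suc K) + S f K

  S-step : ∀ f K → S f K ≡ f K + sh 1 (S f) K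
  S-step f zero    = sym (+-identityʳ _)
  S-step f (suc K) = refl

  sh-sh : ∀ a b f → sh a (sh b f) ≗ sh (a ℕ.+ b) f
  sh-sh zero    b f K       = refl
  sh-sh (suc a) b f zero    = refl
  sh-sh (suc a) b f (suc K) = sh-sh a b f K

  sh-+ : ∀ b f K → sh b f (b ℕ.+ K) ≡ f K
  sh-+ zero    f K = refl
  sh-+ (suc b) f K = sh-+ b f K

  sh-< : ∀ {b K} f → K ℕ.< b → sh b f K ≡ 0ℤ
  sh-< {suc b} {zero}  f _       = refl
  sh-< {suc b} {suc K} f (s≤s h) = sh-< f h

  -- Linear and commuting with multiplication by x. This is enough to commute with every `op`, so
  -- factors can be rearranged although two series are never multiplied.
  record IsOperator (T : Series → Series) : Set where
    field
      cong-≗ : ∀ {f g} → f ≗ g → T f ≗ T g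
      plus   : ∀ f g → T (λ K → f K + g K) ≗ λ K → T f K + T g K
      scale  : ∀ a f → T (λ K → a * f K) ≗ λ K → a * T f K
      shift  : ∀ b f → T (sh b f) ≗ sh b (T f)

    zero-≗ : T (λ _ → 0ℤ) ≗ λ _ → 0ℤ
    zero-≗ K = scale 0ℤ (λ _ → 0ℤ) K

    minus : ∀ f g → T (λ K → f K - g K) ≗ λ K → T f K - T g K
    minus f g K = begin
      T (λ K → f K - g K) K           ≡⟨ cong-≗ (λ K → aux (f K) (g K)) K ⟩
      T (λ K → f K + -1ℤ * g K) K     ≡⟨ plus f _ K ⟩
      T f K + T (λ K → -1ℤ * g K) K   ≡⟨ cong (T f K +_) (scale -1ℤ g K) ⟩
      T f K + -1ℤ * T g K             ≡⟨ aux (T f K) (T g K) ⟨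
      T f K - T g K                   ∎
      where
      aux : ∀ x y → x - y ≡ x + -1ℤ * y
      aux = solve-∀

    ∑-comm : ∀ {A : Set} (xs : List A) (f : A → Series) →
             T (λ K → ∑ xs (λ x → f x K)) ≗ λ K → ∑ xs (λ x → T (f x) K)
    ∑-comm []       f K = zero-≗ K
    ∑-comm (x ∷ xs) f K = trans (plus (f x) _ K) (cong (T (f x) K +_) (∑-comm xs f K))

  open IsOperator

  ∑Fin-comm : ∀ {T} → IsOperator T → ∀ {n} (f : Fin n → Series) →
              T (λ K → ∑Fin (λ i → f i K)) ≗ λ K → ∑Fin (λ i → T (f i) K)
  ∑Fin-comm O {zero}  f K = zero-≗ O K
  ∑Fin-comm {T} O {suc n} f K = trans (plus O (f zero) _ K) (cong (T (f zero) K +_) (∑Fin-comm O (f ∘ suc) K))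

  -congʳ : ∀ x {y z} → y ≡ z → x - y ≡ x - z
  -congʳ x = cong (x -_)

  sh-plus : ∀ b f g → sh b (λ K → f K + g K) ≗ λ K → sh b f K + sh b g K
  sh-plus zero    f g K       = refl
  sh-plus (suc b) f g zero    = refl
  sh-plus (suc b) f g (suc K) = sh-plus b f g K

  sh-scale : ∀ b a f → sh b (λ K → a * f K) ≗ λ K → a * sh b f K
  sh-scale zero    a f K       = refl
  sh-scale (suc b) a f zero    = sym (*-zeroʳ a)
  sh-scale (suc b) a f (suc K) = sh-scale b a f K

  sh-cong : ∀ b {f g} → f ≗ g → sh b f ≗ sh b g
  sh-cong zero    h K       = h K
  sh-cong (suc b) h zero    = refl
  sh-cong (suc b) h (suc K) = sh-cong b h K

  sh-comm : ∀ a b f → sh a (sh b f) ≗ sh b (sh a f)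
  sh-comm a b f K = begin
    sh a (sh b f) K   ≡⟨ sh-sh a b f K ⟩
    sh (a ℕ.+ b) f K  ≡⟨ cong (λ n → sh n f K) (ℕ.+-comm a b) ⟩
    sh (b ℕ.+ a) f K  ≡⟨ sh-sh b a f K ⟨
    sh b (sh a f) K   ∎

  sh-isOperator : ∀ b → IsOperator (sh b)
  sh-isOperator b = record
    { cong-≗ = sh-cong b ; plus = sh-plus b ; scale = sh-scale b ; shift = sh-comm b }

  S-cong : ∀ {f g} → f ≗ g → S f ≗ S g
  S-cong h zero    = h zero
  S-cong h (suc K) = cong₂ _+_ (h (suc K)) (S-cong h K)

  S-plus : ∀ f g → S (λ K → f K + g K) ≗ λ K → S f K + S g K
  S-plus f g zero    = refl
  S-plus f g (suc K) = trans (cong (f (suc K) + g (suc K) +_) (S-plus f g K)) (aux (f (suc K)) (g (suc K)) (S f K) (S g K))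
    where
    aux : ∀ a b c d → (a + b) + (c + d) ≡ (a + c) + (b + d)
    aux = solve-∀

  S-scale : ∀ a f → S (λ K → a * f K) ≗ λ K → a * S f K
  S-scale a f zero    = refl
  S-scale a f (suc K) = trans (cong (a * f (suc K) +_) (S-scale a f K)) (sym (*-distribˡ-+ a (f (suc K)) _))

  S-shift : ∀ b f → S (sh b f) ≗ sh b (S f)
  S-shift zero    f K       = refl
  S-shift (suc b) f zero    = refl
  S-shift (suc b) f (suc K) = trans (step K) (S-shift b f K)
    where
    step : ∀ K → S (sh (suc b) f) (suc K) ≡ S (sh b f) K
    step zero    = +-identityʳ _
    step (suc K) = cong (sh b f (suc K) +_) (step K)

  S-isOperator : IsOperator S
  S-isOperator = record { cong-≗ = S-cong ; plus = S-plus ; scale = S-scale ; shift = S-shift }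

  -- The three kinds of conditions on the weight w of one cycle that occur in S₁ to S₄: w < b, w ≥ b
  -- and w = b. As data they can be read both as a test (`sem`) and as a generating function (`op`).
  data Con : Set where
    lt ge eq : ℕ → Con

  sem : Con → ℕ → Bool
  sem (lt b) w = w <ᵇ b
  sem (ge b) w = not (w <ᵇ b)
  sem (eq b) w = w ≡ᵇ b

  -- Multiplication by (1 - x) times the generating function of the weights
  -- that satisfy the constraint.
  op : Con → Series → Series
  op (lt b) f K = f K - sh b f K
  op (ge b) f K = sh b f K
  op (eq b) f K = sh b f K - sh (suc b) f K

  op-comm : ∀ {T} → IsOperator T → ∀ c f → T (op c f) ≗ op c (T f)
  op-comm {T} O (lt b) f K = trans (minus O f (sh b f) K) (-congʳ (T f K) (shift O b f K))
  op-comm O (ge b) f K = shift O b f K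
  op-comm O (eq b) f K = trans (minus O (sh b f) _ K) (cong₂ _-_ (shift O b f K) (shift O (suc b) f K))

  op-isOperator : ∀ c → IsOperator (op c)
  op-isOperator c = record { cong-≗ = op-cong c ; plus = op-plus c ; scale = op-scale c ; shift = λ b f K → sym (op-comm (sh-isOperator b) c f K) }
    where
    op-cong : ∀ c {f g} → f ≗ g → op c f ≗ op c g
    op-cong (lt b) h K = cong₂ _-_ (h K) (sh-cong b h K)
    op-cong (ge b) h K = sh-cong b h K
    op-cong (eq b) h K = cong₂ _-_ (sh-cong b h K) (sh-cong (suc b) h K)

    interchange : ∀ a b c d → (a + b) - (c + d) ≡ (a - c) + (b - d)
    interchange = solve-∀

    op-plus : ∀ c f g → op c (λ K → f K + g K) ≗ λ K → op c f K + op c g K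
    op-plus (lt b) f g K = trans (-congʳ (f K + g K) (sh-plus b f g K)) (interchange (f K) (g K) (sh b f K) (sh b g K))
    op-plus (ge b) f g K = sh-plus b f g K
    op-plus (eq b) f g K =
      trans (cong₂ _-_ (sh-plus b f g K) (sh-plus (suc b) f g K)) (interchange (sh b f K) (sh b g K) (sh (suc b) f K) (sh (suc b) g K))

    distrib : ∀ a x y → a * x - a * y ≡ a * (x - y)
    distrib = solve-∀

    op-scale : ∀ c a f → op c (λ K → a * f K) ≗ λ K → a * op c f K
    op-scale (lt b) a f K = trans (-congʳ (a * f K) (sh-scale b a f K)) (distrib a (f K) (sh b f K))
    op-scale (ge b) a f K = sh-scale b a f K
    op-scale (eq b) a f K =
      trans (cong₂ _-_ (sh-scale b a f K) (sh-scale (suc b) a f K)) (distrib a (sh b f K) (sh (suc b) f K))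

  ops : List Con → Series → Series
  ops []       f = f
  ops (c ∷ cs) f = op c (ops cs f)

  ops-isOperator : ∀ cs → IsOperator (ops cs)
  ops-isOperator []       = record { cong-≗ = λ h → h ; plus = λ _ _ _ → refl ; scale = λ _ _ _ → refl ; shift = λ _ _ _ → refl }
  ops-isOperator (c ∷ cs) = record
    { cong-≗ = λ h → cong-≗ O (cong-≗ Os h)
    ; plus   = λ f g K → trans (cong-≗ O (plus Os f g) K) (plus O _ _ K)
    ; scale  = λ a f K → trans (cong-≗ O (scale Os a f) K) (scale O a _ K)
    ; shift  = λ b f K → trans (cong-≗ O (shift Os b f) K) (shift O b _ K)
    }
    where
    O  = op-isOperator c
    Os = ops-isOperator cs

  ops-comm : ∀ {T} → IsOperator T → ∀ cs f → T (ops cs f) ≗ ops cs (T f)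
  ops-comm O []       f K = refl
  ops-comm O (c ∷ cs) f K =
    trans (op-comm O c (ops cs f) K) (cong-≗ (op-isOperator c) (ops-comm O cs f) K)

  -- The operators commute, so the order in which the cycles are listed does not matter.
  ops-↭ : ∀ {cs ds} → cs ↭ ds → ∀ f → ops cs f ≗ ops ds f
  ops-↭ ↭.refl         f K = refl
  ops-↭ (↭.prep c p)   f K = cong-≗ (op-isOperator c) (ops-↭ p f) K
  ops-↭ {_ ∷ _ ∷ cs} {_ ∷ _ ∷ ds} (↭.swap c d p) f K = trans
    (op-comm (op-isOperator c) d (ops cs f) K)
    (cong-≗ (op-isOperator d) (cong-≗ (op-isOperator c) (ops-↭ p f)) K)
  ops-↭ (↭.trans p q)  f K = trans (ops-↭ p f K) (ops-↭ q f K)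

  -- Multiplication by the generating function of the set { w : a w ≡ true }.
  conv : (ℕ → Bool) → Series → Series
  conv a f zero    = if a 0 then f 0 else 0ℤ
  conv a f (suc K) = (if a 0 then f (suc K) else 0ℤ) + conv (a ∘ suc) f K

  conv-cong : ∀ a {f g} → f ≗ g → conv a f ≗ conv a g
  conv-cong a h zero    = cong (λ x → if a 0 then x else 0ℤ) (h 0)
  conv-cong a h (suc K) = cong₂ _+_ (cong (λ x → if a 0 then x else 0ℤ) (h (suc K))) (conv-cong (a ∘ suc) h K)

  conv-false : ∀ f → conv (λ _ → false) f ≗ λ _ → 0ℤ
  conv-false f zero    = refl
  conv-false f (suc K) = trans (+-identityˡ _) (conv-false f K)

  -- Splitting off the weight 0 turns bound b + 1 into bound b while the coefficient index drops by
  -- one, so both sides obey one recursion. `S` supplies the factor 1/(1 - x) that is left out of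
  -- `op`.
  conv-sem : ∀ c f → conv (sem c) f ≗ op c (S f)
  conv-sem (lt zero)    f K       = trans (conv-false f K) (sym (+-inverseʳ (S f K)))
  conv-sem (lt (suc b)) f zero    = sym (+-identityʳ _)
  conv-sem (lt (suc b)) f (suc K) = trans (cong (f (suc K) +_) (conv-sem (lt b) f K)) (assoc (f (suc K)) (S f K) (sh b (S f) K))
    where
    assoc : ∀ x y z → x + (y - z) ≡ (x + y) - z
    assoc = solve-∀
  conv-sem (ge zero)    f zero    = refl
  conv-sem (ge zero)    f (suc K) = cong (f (suc K) +_) (conv-sem (ge zero) f K)
  conv-sem (ge (suc b)) f zero    = refl
  conv-sem (ge (suc b)) f (suc K) = trans (+-identityˡ _) (conv-sem (ge b) f K)
  conv-sem (eq zero)    f zero    = sym (+-identityʳ _)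
  conv-sem (eq zero)    f (suc K) = trans (cong (f (suc K) +_) (conv-false f K)) (cancel (f (suc K)) (S f K))
    where
    cancel : ∀ x y → x + 0ℤ ≡ (x + y) - y
    cancel = solve-∀
  conv-sem (eq (suc b)) f zero    = refl
  conv-sem (eq (suc b)) f (suc K) = trans (+-identityˡ _) (conv-sem (eq b) f K)

  δ : Series
  δ zero    = 1ℤ
  δ (suc _) = 0ℤ

  -- `Sⁿ n δ` is 1/(1 - x)ⁿ.
  Sⁿ : ℕ → Series → Series
  Sⁿ zero    f = f
  Sⁿ (suc n) f = S (Sⁿ n f)

-- Two recursive enumerations of the permutations

module Permutations where

  open import Defs using (IsPermutation)
  open Sums
  open import Data.Fin using (punchIn; punchOut; _≟_)
  open import Data.Fin.Properties using (punchIn-injective; punchInᵢ≢i; punchIn-punchOut)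
  open import Data.List using (allFin)
  open import Data.List.Membership.Propositional using (_∈_)
  open import Data.List.Membership.Propositional.Properties using (∈-allFin)
  open import Data.List.Relation.Unary.All using ([])
  open import Data.List.Relation.Unary.Unique.Propositional.Properties using (allFin⁺)
  open import Data.Vec using (map; lookup; tabulate)
  open import Data.Vec.Properties using (lookup-map; lookup∘tabulate; tabulate∘lookup; tabulate-cong; ∷-injective)

  record Insertion : Set where
    field
      ins           : ∀ {n} → Fin (suc n) → Fin n → Fin (suc n)
      ins-injective : ∀ {n} (a : Fin (suc n)) {x y} → ins a x ≡ ins a y → x ≡ y
      ins-avoids    : ∀ {n} (a : Fin (suc n)) x → ins a x ≢ a
      ins-hits      : ∀ {n} (a : Fin (suc n)) {y} → y ≢ a → ∃[ x ] ins a x ≡ y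

  -- Any family of injections ins a onto the complement of a gives an enumeration
  -- of the permutations; relabelling suits descents, cycleInsertion suits cycles.
  module Enumeration (I : Insertion) where
    open Insertion I

    extend : ∀ {n} → Fin (suc n) → Vec (Fin n) n → Vec (Fin (suc n)) (suc n)
    extend a v = a ∷ map (ins a) v

    perms : ∀ n → List (Vec (Fin n) n)
    perms zero    = [] ∷ []
    perms (suc n) = bind (allFin (suc n)) (λ _ → perms n) extend

    private
      map-injective : ∀ {n l} (a : Fin (suc n)) (v v′ : Vec (Fin n) l) → map (ins a) v ≡ map (ins a) v′ → v ≡ v′
      map-injective a []      []        e = refl
      map-injective a (x ∷ v) (y ∷ v′) e =
        let e₁ , e₂ = ∷-injective e in cong₂ _∷_ (ins-injective a e₁) (map-injective a v v′ e₂)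

    perms-unique : ∀ n → Unique (perms n)
    perms-unique zero    = [] ∷ []
    perms-unique (suc n) = bind-unique extend inj (allFin⁺ (suc n)) (λ _ → perms-unique n)
      where
      inj : ∀ {a a′} {v v′ : Vec (Fin n) n} → extend a v ≡ extend a′ v′ → (a , v) ≡ (a′ , v′)
      inj {a} {v = v} {v′} e with refl ← proj₁ (∷-injective e) =
        cong (a ,_) (map-injective a v v′ (proj₂ (∷-injective e)))

    extend-isPermutation : ∀ {n} a (v : Vec (Fin n) n) → IsPermutation v → IsPermutation (extend a v)
    extend-isPermutation {n} a v (inj , surj) = inj′ , surj′
      where
      avoids : ∀ i → lookup (map (ins a) v) i ≢ a
      avoids i e = ins-avoids a _ (trans (sym (lookup-map i (ins a) v)) e)
      inj′ : Injective _≡_ _≡_ (lookup (extend a v))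
      inj′ {zero}  {zero}  e = refl
      inj′ {zero}  {suc j} e = contradiction (sym e) (avoids j)
      inj′ {suc i} {zero}  e = contradiction e (avoids i)
      inj′ {suc i} {suc j} e = cong suc (inj (ins-injective a
        (trans (sym (lookup-map i (ins a) v)) (trans e (lookup-map j (ins a) v)))))
      surj′ : ∀ y → ∃[ x ] (∀ {z} → z ≡ x → lookup (extend a v) z ≡ y)
      surj′ y with y ≟ a
      ... | yes e = zero , λ { refl → sym e }
      ... | no ne with x , refl ← ins-hits a ne =
        let i , h = surj x in suc i , λ { refl → trans (lookup-map i (ins a) v) (cong (ins a) (h refl)) }

    ∈-perms⁻ : ∀ {n} {v : Vec (Fin n) n} → v ∈ perms n → IsPermutation v
    ∈-perms⁻ {zero}  (here refl) = (λ { {()} }) , λ ()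
    ∈-perms⁻ {suc n} m with a , u , _ , p , refl ← ∈-bind⁻ (allFin (suc n)) (λ _ → perms n) extend m =
      extend-isPermutation a u (∈-perms⁻ p)

    -- No entry of the tail equals the head a, so each can be pulled back along `ins a`.
    ∈-perms⁺ : ∀ {n} {v : Vec (Fin n) n} → IsPermutation v → v ∈ perms n
    ∈-perms⁺ {zero}  {[]}    _ = here refl
    ∈-perms⁺ {suc n} {a ∷ q} (inj , surj) =
      subst (_∈ perms (suc n)) (cong (a ∷_) u-eq) (∈-bind⁺ extend (∈-allFin a) (∈-perms⁺ (inj′ , surj′)))
      where
      other : ∀ i → lookup q i ≢ a
      other i e with () ← inj {suc i} {zero} e
      u : Vec (Fin n) n
      u = tabulate (λ i → proj₁ (ins-hits a (other i)))
      ins-u : ∀ i → ins a (lookup u i) ≡ lookup q i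
      ins-u i = trans (cong (ins a) (lookup∘tabulate _ i)) (proj₂ (ins-hits a (other i)))
      u-eq : map (ins a) u ≡ q
      u-eq = begin
        map (ins a) u                          ≡⟨ tabulate∘lookup _ ⟨
        tabulate (lookup (map (ins a) u))      ≡⟨ tabulate-cong (λ i → trans (lookup-map i (ins a) u) (ins-u i)) ⟩
        tabulate (lookup q)                    ≡⟨ tabulate∘lookup q ⟩
        q                                      ∎
        where open ≡-Reasoning
      inj′ : Injective _≡_ _≡_ (lookup u)
      inj′ {i} {j} e with refl ← inj {suc i} {suc j} (trans (sym (ins-u i)) (trans (cong (ins a) e) (ins-u j))) = refl
      surj′ : ∀ y → ∃[ x ] (∀ {z} → z ≡ x → lookup u z ≡ y)
      surj′ y with surj (ins a y)
      ... | zero  , h = contradiction (sym (h refl)) (ins-avoids a y)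
      ... | suc i , h = i , λ { refl → ins-injective a (trans (ins-u i) (h refl)) }

    ∑-perms : ∀ n f → ∑ (perms (suc n)) f ≡ ∑Fin {suc n} (λ a → ∑ (perms n) (f ∘ extend a))
    ∑-perms n f = trans (∑-bind (allFin (suc n)) (λ _ → perms n) extend f) (∑-tabulate (λ i → i) (λ a → ∑ (perms n) (f ∘ extend a)))

  relabelling : Insertion
  relabelling = record
    { ins           = punchIn
    ; ins-injective = λ a → punchIn-injective a _ _
    ; ins-avoids    = λ a x → punchInᵢ≢i a x
    ; ins-hits      = λ a ne → punchOut (ne ∘ sym) , punchIn-punchOut (ne ∘ sym)
    }

  -- Inserts 0 into the cycle decomposition of a permutation of { 1, …, n },
  -- just before a, or as a fixed point if a = 0.
  cut : ∀ {n} → Fin (suc n) → Fin n → Fin (suc n)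
  cut zero    y = suc y
  cut (suc j) y with y ≟ j
  ... | yes _ = zero
  ... | no  _ = suc y

  cut-≡ : ∀ {n} (j : Fin n) → cut (suc j) j ≡ zero
  cut-≡ j with j ≟ j
  ... | yes _ = refl
  ... | no ne = contradiction refl ne

  cut-≢ : ∀ {n} {j y : Fin n} → y ≢ j → cut (suc j) y ≡ suc y
  cut-≢ {j = j} {y} ne with y ≟ j
  ... | yes e = contradiction e ne
  ... | no _  = refl

  cycleInsertion : Insertion
  cycleInsertion = record
    { ins = cut ; ins-injective = injective ; ins-avoids = avoids ; ins-hits = hits }
    where
    injective : ∀ {n} (a : Fin (suc n)) {x y} → cut a x ≡ cut a y → x ≡ y
    injective zero    refl = refl
    injective (suc j) {x} {y} e with x ≟ j | y ≟ j
    ... | yes p | yes q = trans p (sym q)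
    ... | no _  | no _ with refl ← e = refl
    avoids : ∀ {n} (a : Fin (suc n)) x → cut a x ≢ a
    avoids (suc j) x e with x ≟ j
    avoids (suc j) x refl | no ne = ne refl
    hits : ∀ {n} (a : Fin (suc n)) {y} → y ≢ a → ∃[ x ] cut a x ≡ y
    hits zero    {zero}  ne = contradiction refl ne
    hits zero    {suc y} ne = y , refl
    hits (suc j) {zero}  ne = j , cut-≡ j
    hits (suc j) {suc y} ne = y , cut-≢ (ne ∘ cong suc)

-- Worpitzky's identity, refined by the first letter

module Descents where

  open import Defs using (des)
  open Sums
  open Series
  open Permutations
  open import Data.Nat using (_∸_; _<ᵇ_; _≡ᵇ_; pred)
  open import Data.Integer using (ℤ; 0ℤ; 1ℤ; _+_; _*_; _^_; _-_) renaming (+_ to pos)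
  open import Data.Integer.Properties using (+-comm; +-identityʳ; +-identityˡ; *-zeroʳ; *-zeroˡ; *-identityˡ; *-assoc; pos-+)
  open import Data.Fin using (punchIn)
  open import Data.Vec using (map)

  open IsOperator
  open Enumeration relabelling
  open ≡-Reasoning

  bit : Bool → ℕ
  bit b = if b then 1 else 0

  lastZero : ∀ {r l} → Vec (Fin r) l → Bool
  lastZero []          = false
  lastZero (x ∷ [])    = toℕ x ≡ᵇ 0
  lastZero (x ∷ y ∷ v) = lastZero (y ∷ v)

  lastZero-punchIn : ∀ {r l} (a : Fin r) (v : Vec (Fin r) l) → lastZero (map (punchIn (suc a)) v) ≡ lastZero v
  lastZero-punchIn a []           = refl
  lastZero-punchIn a (zero ∷ [])  = refl
  lastZero-punchIn a (suc x ∷ []) = refl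
  lastZero-punchIn a (x ∷ y ∷ v)  = lastZero-punchIn a (y ∷ v)

  lastZero-suc : ∀ {r l} (v : Vec (Fin r) l) → lastZero (map (punchIn zero) v) ≡ false
  lastZero-suc []          = refl
  lastZero-suc (x ∷ [])    = refl
  lastZero-suc (x ∷ y ∷ v) = lastZero-suc (y ∷ v)

  punchIn-<ᵇ : ∀ {r} (a : Fin (suc r)) x y → (toℕ (punchIn a x) <ᵇ toℕ (punchIn a y)) ≡ (toℕ x <ᵇ toℕ y)
  punchIn-<ᵇ zero    x       y       = refl
  punchIn-<ᵇ (suc a) zero    zero    = refl
  punchIn-<ᵇ (suc a) zero    (suc y) = refl
  punchIn-<ᵇ (suc a) (suc x) zero    = refl
  punchIn-<ᵇ (suc a) (suc x) (suc y) = punchIn-<ᵇ a x y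

  punchIn-<ᵇ-self : ∀ {r} (a : Fin (suc r)) x → (toℕ (punchIn a x) <ᵇ toℕ a) ≡ (toℕ x <ᵇ toℕ a)
  punchIn-<ᵇ-self zero    x       = refl
  punchIn-<ᵇ-self (suc a) zero    = refl
  punchIn-<ᵇ-self (suc a) (suc x) = punchIn-<ᵇ-self a x

  des-punchIn : ∀ {r l} (a : Fin (suc r)) (v : Vec (Fin r) l) → des (map (punchIn a) v) ≡ des v
  des-punchIn a []          = refl
  des-punchIn a (x ∷ [])    = refl
  des-punchIn a (x ∷ y ∷ v) = cong₂ (λ b n → bit b ℕ.+ n) (punchIn-<ᵇ a y x) (des-punchIn a (y ∷ v))

  -- The share of the ordering p in Worpitzky's sum. The series m is a parameter because every
  -- further letter costs another factor 1/(1 - x).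
  term : ∀ {r l} → Series → Vec (Fin r) l → Series
  term m p K = if lastZero p then sh (des p) m K else 0ℤ

  -- A new first letter can only create a descent in front of y; relabelling the rest preserves its
  -- descents and whether it ends with 0.
  term-cons : ∀ {r l} m (a : Fin r) y (u : Vec (Fin r) l) →
              term (S m) (suc a ∷ map (punchIn (suc a)) (y ∷ u)) ≗ sh (bit (toℕ y <ᵇ suc (toℕ a))) (S (term m (y ∷ u)))
  term-cons m a y u K
    rewrite lastZero-punchIn a (y ∷ u) | punchIn-<ᵇ-self (suc a) y | des-punchIn (suc a) (y ∷ u)
    with lastZero (y ∷ u) | toℕ y <ᵇ suc (toℕ a)
  ... | false | b = sym (begin
    sh (bit b) (S (λ _ → 0ℤ)) K   ≡⟨ sh-cong (bit b) (zero-≗ S-isOperator) K ⟩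
    sh (bit b) (λ _ → 0ℤ) K       ≡⟨ zero-≗ (sh-isOperator (bit b)) K ⟩
    0ℤ                            ∎)
  ... | true  | b = begin
    sh (bit b ℕ.+ des (y ∷ u)) (S m) K     ≡⟨ sh-sh (bit b) (des (y ∷ u)) (S m) K ⟨
    sh (bit b) (sh (des (y ∷ u)) (S m)) K  ≡⟨ sh-cong (bit b) (λ K → sym (S-shift (des (y ∷ u)) m K)) K ⟩
    sh (bit b) (S (sh (des (y ∷ u)) m)) K  ∎

  -- The refined Worpitzky coefficients: over the permutations of q + 1 letters whose first letter
  -- exceeds exactly a others, Σ x^des / (1 - x)^(q+1) = Σ ρ q a j x^j.
  ρ : ℕ → ℕ → Series
  ρ q a j = pos j ^ a * pos (suc j) ^ (q ∸ a)

  private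
    ρ-suc : ∀ n (y : Fin n) j → ρ n (suc (toℕ y)) j ≡ pos j * ρ (pred n) (toℕ y) j
    ρ-suc (suc n) y j = *-assoc (pos j) (pos j ^ toℕ y) _

    collect : ∀ x r z s → x * r + (1ℤ * z + x * s) ≡ x * (r + s) + z
    collect = solve-∀
    collect-pow : ∀ x z → x * z + z ≡ (1ℤ + x) * z
    collect-pow = solve-∀

  -- A geometric sum in j and j + 1, which telescopes because (j + 1) - j = 1.
  geometric : ∀ n (a : Fin (suc n)) j →
              ρ n (toℕ a) j + ∑Fin {n} (λ y → if toℕ y <ᵇ toℕ a then ρ (pred n) (toℕ y) j else 0ℤ) ≡ pos (suc j) ^ n
  geometric n zero j = trans (cong₂ _+_ (*-identityˡ (pos (suc j) ^ n)) (∑Fin-zero n)) (+-identityʳ _)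
  geometric (suc n) (suc a) j = begin
    ρ (suc n) (suc (toℕ a)) j + (1ℤ * z ^ n + ∑Fin (λ (y : Fin n) → if toℕ y <ᵇ toℕ a then ρ n (suc (toℕ y)) j else 0ℤ))
      ≡⟨ cong₂ (λ u v → u + (1ℤ * z ^ n + v)) (*-assoc x (x ^ toℕ a) _) (trans (∑Fin-cong pull) (∑Fin-* x g)) ⟩
    x * ρ n (toℕ a) j + (1ℤ * z ^ n + x * ∑Fin g)
      ≡⟨ collect x (ρ n (toℕ a) j) (z ^ n) (∑Fin g) ⟩
    x * (ρ n (toℕ a) j + ∑Fin g) + z ^ n
      ≡⟨ cong (λ s → x * s + z ^ n) (geometric n a j) ⟩
    x * z ^ n + z ^ n
      ≡⟨ collect-pow x (z ^ n) ⟩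
    (1ℤ + x) * z ^ n
      ≡⟨ cong (_* z ^ n) (sym (pos-+ 1 j)) ⟩
    z * z ^ n ∎
    where
    x = pos j
    z = pos (suc j)
    g : Fin n → ℤ
    g y = if toℕ y <ᵇ toℕ a then ρ (pred n) (toℕ y) j else 0ℤ
    pull : ∀ y → (if toℕ y <ᵇ toℕ a then ρ n (suc (toℕ y)) j else 0ℤ) ≡ x * g y
    pull y with toℕ y <ᵇ toℕ a
    ... | true  = ρ-suc n y j
    ... | false = sym (*-zeroʳ x)

  geometric-all : ∀ n j → pos j ^ n + ∑Fin {n} (λ y → ρ (pred n) (toℕ y) j) ≡ pos (suc j) ^ n
  geometric-all zero j = refl
  geometric-all (suc n) j = begin
    x * x ^ n + (1ℤ * z ^ n + ∑Fin (λ (y : Fin n) → ρ n (suc (toℕ y)) j))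
      ≡⟨ cong (λ v → x * x ^ n + (1ℤ * z ^ n + v)) (trans (∑Fin-cong (λ y → ρ-suc n y j)) (∑Fin-* x g)) ⟩
    x * x ^ n + (1ℤ * z ^ n + x * ∑Fin g)
      ≡⟨ collect x (x ^ n) (z ^ n) (∑Fin g) ⟩
    x * (x ^ n + ∑Fin g) + z ^ n
      ≡⟨ cong (λ s → x * s + z ^ n) (geometric-all n j) ⟩
    x * z ^ n + z ^ n
      ≡⟨ collect-pow x (z ^ n) ⟩
    (1ℤ + x) * z ^ n
      ≡⟨ cong (_* z ^ n) (sym (pos-+ 1 j)) ⟩
    z * z ^ n ∎
    where
    x = pos j
    z = pos (suc j)
    g : Fin n → ℤ
    g y = ρ (pred n) (toℕ y) j

  -- All the ρ q y at j add up to (j+1)^(q+1) - j^(q+1), so the partial sums taken by `S` telescope.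
  ∑-S-ρ : ∀ q K → ∑Fin {suc q} (λ y → S (ρ q (toℕ y)) K) ≡ pos (suc K) ^ suc q
  ∑-S-ρ q K = trans (sym (∑Fin-comm S-isOperator {suc q} (λ y → ρ q (toℕ y)) K)) (telescope K)
    where
    R : Series
    R j = ∑Fin {suc q} (λ y → ρ q (toℕ y) j)
    telescope : ∀ K → S R K ≡ pos (suc K) ^ suc q
    telescope zero    = trans (sym (trans (cong (_+ R 0) (*-zeroˡ (0ℤ ^ q))) (+-identityˡ _))) (geometric-all (suc q) 0)
    telescope (suc K) = begin
      R (suc K) + S R K                       ≡⟨ cong (R (suc K) +_) (telescope K) ⟩
      R (suc K) + pos (suc K) ^ suc q         ≡⟨ +-comm (R (suc K)) _ ⟩
      pos (suc K) ^ suc q + R (suc K)         ≡⟨ geometric-all (suc q) (suc K) ⟩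
      pos (suc (suc K)) ^ suc q               ∎

  -- Since x S f = S f - f, the descents y < a subtract the values ρ q y at K from the full sum, and
  -- `geometric` evaluates what remains.
  ρ-recurrence : ∀ q (a : Fin (suc (suc q))) K →
                 ∑Fin {suc q} (λ y → sh (bit (toℕ y <ᵇ toℕ a)) (S (ρ q (toℕ y))) K) ≡ ρ (suc q) (toℕ a) K
  ρ-recurrence q a K = cancel _ _ _ (begin
    ∑Fin {suc q} (λ y → sh (bit (toℕ y <ᵇ toℕ a)) (S (ρ q (toℕ y))) K) + B
      ≡⟨ ∑Fin-+ {suc q} (λ y → sh (bit (toℕ y <ᵇ toℕ a)) (S (ρ q (toℕ y))) K) (λ y → if toℕ y <ᵇ toℕ a then ρ q (toℕ y) K else 0ℤ) ⟨
    ∑Fin {suc q} (λ y → sh (bit (toℕ y <ᵇ toℕ a)) (S (ρ q (toℕ y))) K + (if toℕ y <ᵇ toℕ a then ρ q (toℕ y) K else 0ℤ))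
      ≡⟨ ∑Fin-cong {suc q} restore ⟩
    ∑Fin {suc q} (λ y → S (ρ q (toℕ y)) K)
      ≡⟨ ∑-S-ρ q K ⟩
    pos (suc K) ^ suc q
      ≡⟨ geometric (suc q) a K ⟨
    ρ (suc q) (toℕ a) K + B ∎)
    where
    B = ∑Fin {suc q} (λ y → if toℕ y <ᵇ toℕ a then ρ q (toℕ y) K else 0ℤ)
    restore : ∀ (y : Fin (suc q)) → sh (bit (toℕ y <ᵇ toℕ a)) (S (ρ q (toℕ y))) K + (if toℕ y <ᵇ toℕ a then ρ q (toℕ y) K else 0ℤ) ≡ S (ρ q (toℕ y)) K
    restore y with toℕ y <ᵇ toℕ a
    ... | false = +-identityʳ _
    ... | true  = trans (+-comm (sh 1 (S (ρ q (toℕ y))) K) _) (sym (S-step (ρ q (toℕ y)) K))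
    cancel : ∀ a b c → a + c ≡ b + c → a ≡ b
    cancel a b c h = trans (sym (aux a c)) (trans (cong (_- c) h) (aux b c))
      where
      aux : ∀ a c → (a + c) - c ≡ a
      aux = solve-∀

  -- The final letter 0 always adds a descent and a factor 1/(1 - x) of its own, whence `sh 1` and
  -- `S`. The inductive step removes the first letter and sums over the second, which cannot be 0
  -- because 0 stands last.
  firstLetter : ∀ q (a : Fin (suc q)) →
                (λ K → ∑ (perms (suc q)) (λ v → term (Sⁿ (suc (suc q)) δ) (extend (suc a) v) K)) ≗ sh 1 (S (ρ q (toℕ a)))
  firstLetter zero zero K = base K
    where
    base : ∀ K → sh 1 (S (S δ)) K + 0ℤ ≡ sh 1 (S (ρ 0 0)) K
    base zero    = refl
    base (suc K) = trans (+-identityʳ _) (S-cong ones K)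
      where
      ones : ∀ K → S δ K ≡ 1ℤ * 1ℤ
      ones zero    = refl
      ones (suc K) = trans (+-identityˡ _) (ones K)
  firstLetter (suc q) a K = begin
    ∑ (perms (suc (suc q))) (λ v → term (S m) (extend (suc a) v) K)
      ≡⟨ ∑-perms (suc q) _ ⟩
    ∑ (perms (suc q)) (λ v → term (S m) (extend (suc a) (extend zero v)) K)
      + ∑Fin {suc q} (λ y → ∑ (perms (suc q)) (λ v → term (S m) (extend (suc a) (extend (suc y) v)) K))
      ≡⟨ cong₂ _+_ (trans (∑-cong (perms (suc q)) zeroFirst) (∑-zero (perms (suc q)))) (∑Fin-cong sucFirst) ⟩
    0ℤ + ∑Fin {suc q} (λ y → sh 1 (S (sh (bit (toℕ y <ᵇ toℕ a)) (S (ρ q (toℕ y))))) K)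
      ≡⟨ +-identityˡ _ ⟩
    ∑Fin {suc q} (λ y → sh 1 (S (sh (bit (toℕ y <ᵇ toℕ a)) (S (ρ q (toℕ y))))) K)
      ≡⟨ ∑Fin-comm (sh-isOperator 1) (λ y → S (shifted y)) K ⟨
    sh 1 (λ K → ∑Fin {suc q} (λ y → S (sh (bit (toℕ y <ᵇ toℕ a)) (S (ρ q (toℕ y)))) K)) K
      ≡⟨ sh-cong 1 (λ K → sym (∑Fin-comm S-isOperator shifted K)) K ⟩
    sh 1 (S (λ K → ∑Fin {suc q} (λ y → sh (bit (toℕ y <ᵇ toℕ a)) (S (ρ q (toℕ y))) K))) K
      ≡⟨ sh-cong 1 (S-cong (ρ-recurrence q a)) K ⟩
    sh 1 (S (ρ (suc q) (toℕ a))) K ∎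
    where
    m = Sⁿ (suc (suc q)) δ
    shifted : Fin (suc q) → Series
    shifted y = sh (bit (toℕ y <ᵇ toℕ a)) (S (ρ q (toℕ y)))
    zeroFirst : ∀ v → term (S m) (extend (suc a) (extend zero v)) K ≡ 0ℤ
    zeroFirst v@(_ ∷ _) = cong (λ b → if b then sh (des (extend (suc a) (extend zero v))) (S m) K else 0ℤ)
      (trans (lastZero-punchIn a (extend zero v)) (lastZero-suc v))
    sucFirst : ∀ y → ∑ (perms (suc q)) (λ v → term (S m) (extend (suc a) (extend (suc y) v)) K)
                   ≡ sh 1 (S (sh (bit (toℕ y <ᵇ toℕ a)) (S (ρ q (toℕ y))))) K
    sucFirst y = begin
      ∑ (perms (suc q)) (λ v → term (S m) (extend (suc a) (extend (suc y) v)) K)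
        ≡⟨ ∑-cong (perms (suc q)) (λ v → term-cons m a (suc y) (map (punchIn (suc y)) v) K) ⟩
      ∑ (perms (suc q)) (λ v → sh b (S (term m (extend (suc y) v))) K)
        ≡⟨ ∑-comm (sh-isOperator b) (perms (suc q)) _ K ⟨
      sh b (λ K → ∑ (perms (suc q)) (λ v → S (term m (extend (suc y) v)) K)) K
        ≡⟨ sh-cong b (λ K → sym (∑-comm S-isOperator (perms (suc q)) _ K)) K ⟩
      sh b (S (λ K → ∑ (perms (suc q)) (λ v → term m (extend (suc y) v) K))) K
        ≡⟨ sh-cong b (S-cong (firstLetter q y)) K ⟩
      sh b (S (sh 1 (S (ρ q (toℕ y))))) K
        ≡⟨ sh-cong b (S-shift 1 (S (ρ q (toℕ y)))) K ⟩
      sh b (sh 1 (S (S (ρ q (toℕ y))))) K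
        ≡⟨ sh-comm b 1 (S (S (ρ q (toℕ y)))) K ⟩
      sh 1 (sh b (S (S (ρ q (toℕ y))))) K
        ≡⟨ sh-cong 1 (λ K → sym (S-shift b (S (ρ q (toℕ y))) K)) K ⟩
      sh 1 (S (sh b (S (ρ q (toℕ y))))) K ∎
      where
      b = bit (toℕ y <ᵇ toℕ a)

  -- Splitting by the first letter leaves x times the telescoping sum `∑-S-ρ`. Because the smallest
  -- letter is fixed in the last place, the values are K^r and not the usual (K + 1)^r.
  worpitzky : ∀ r → (λ K → ∑ (perms (suc r)) (λ p → term (Sⁿ (suc r) δ) p K)) ≗ λ K → pos K ^ r
  worpitzky zero K = trans (+-identityʳ _) (ones K)
    where
    ones : ∀ K → S δ K ≡ 1ℤ
    ones zero    = refl
    ones (suc K) = trans (+-identityˡ _) (ones K)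
  worpitzky (suc q) K = begin
    ∑ (perms (suc (suc q))) (λ p → term m p K)
      ≡⟨ ∑-perms (suc q) _ ⟩
    ∑ (perms (suc q)) (λ v → term m (extend zero v) K) + ∑Fin {suc q} (λ a → ∑ (perms (suc q)) (λ v → term m (extend (suc a) v) K))
      ≡⟨ cong₂ _+_ (trans (∑-cong (perms (suc q)) zeroFirst) (∑-zero (perms (suc q)))) (∑Fin-cong (λ a → firstLetter q a K)) ⟩
    0ℤ + ∑Fin {suc q} (λ a → sh 1 (S (ρ q (toℕ a))) K)
      ≡⟨ +-identityˡ _ ⟩
    ∑Fin {suc q} (λ a → sh 1 (S (ρ q (toℕ a))) K)
      ≡⟨ shifted K ⟩
    pos K ^ suc q ∎
    where
    m = Sⁿ (suc (suc q)) δ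
    zeroFirst : ∀ v → term m (extend zero v) K ≡ 0ℤ
    zeroFirst v@(_ ∷ _) = cong (λ b → if b then sh (des (extend zero v)) m K else 0ℤ) (lastZero-suc v)
    shifted : ∀ K → ∑Fin {suc q} (λ a → sh 1 (S (ρ q (toℕ a))) K) ≡ pos K ^ suc q
    shifted zero    = trans (∑Fin-zero (suc q)) (sym (*-zeroˡ (0ℤ ^ q)))
    shifted (suc K) = ∑-S-ρ q K

-- Enumerating the weightings in parallel with the series operators

module Weights where

  open Sums
  open Series
  open import Data.Nat using (_+_)
  open import Data.Integer as ℤ using (ℤ; 0ℤ) renaming (+_ to pos)
  import Data.Integer.Properties as ℤ
  open import Data.List using (_++_; map)
  open import Data.List.Properties using (length-++; length-map)
  open import Data.List.Membership.Propositional using (_∈_)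
  open import Data.List.Membership.Propositional.Properties using (∈-++⁺ˡ; ∈-++⁺ʳ; ∈-++⁻; ∈-map⁺; ∈-map⁻)
  open import Data.List.Relation.Unary.All using ([])
  open import Data.List.Relation.Unary.Unique.Propositional.Properties using (++⁺; map⁺)
  open import Data.Vec using (lookup; toList; sum)
  open import Data.Product using (map₁)
  open ≡-Reasoning

  open IsOperator

  private variable
    B : Set

  -- The lists are built by the recursions of `sh` and, in `pairs`, of `conv`, so that their lengths
  -- are these operators applied to lengths.
  shiftL : ℕ → (ℕ → List B) → ℕ → List B
  shiftL zero    f K       = f K
  shiftL (suc b) f zero    = []
  shiftL (suc b) f (suc K) = shiftL b f K

  ∈-shiftL⁺ : ∀ b {f : ℕ → List B} {y s} → y ∈ f s → y ∈ shiftL b f (b + s)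
  ∈-shiftL⁺ zero    m = m
  ∈-shiftL⁺ (suc b) m = ∈-shiftL⁺ b m

  ∈-shiftL⁻ : ∀ b {f : ℕ → List B} {y} K → y ∈ shiftL b f K → ∃[ s ] K ≡ b + s × y ∈ f s
  ∈-shiftL⁻ zero    K       m = K , refl , m
  ∈-shiftL⁻ (suc b) (suc K) m = let s , e , h = ∈-shiftL⁻ b K m in s , cong suc e , h

  shiftL-unique : ∀ b {f : ℕ → List B} → (∀ s → Unique (f s)) → ∀ K → Unique (shiftL b f K)
  shiftL-unique zero    u K       = u K
  shiftL-unique (suc b) u zero    = []
  shiftL-unique (suc b) u (suc K) = shiftL-unique b u K

  length-shiftL : ∀ b (f : ℕ → List B) → (λ K → pos (length (shiftL b f K))) ≗ sh b (λ s → pos (length (f s)))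
  length-shiftL zero    f K       = refl
  length-shiftL (suc b) f zero    = refl
  length-shiftL (suc b) f (suc K) = length-shiftL b f K

  heads : (ℕ → Bool) → (ℕ → List B) → ℕ → List (ℕ × B)
  heads a f s = if a 0 then map (0 ,_) (f s) else []

  pairs : (ℕ → Bool) → (ℕ → List B) → ℕ → List (ℕ × B)
  pairs a f zero    = heads a f zero
  pairs a f (suc s) = heads a f (suc s) ++ map (map₁ suc) (pairs (a ∘ suc) f s)

  ∈-heads⁻ : ∀ a (f : ℕ → List B) s {w b} → (w , b) ∈ heads a f s → w ≡ 0 × a 0 ≡ true × b ∈ f s
  ∈-heads⁻ a f s m with true ← a 0 with _ , h , refl ← ∈-map⁻ (0 ,_) m = refl , refl , h

  ∈-heads⁺ : ∀ a (f : ℕ → List B) s {b} → a 0 ≡ true → b ∈ f s → (0 , b) ∈ heads a f s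
  ∈-heads⁺ a f s e m rewrite e = ∈-map⁺ (0 ,_) m

  ∈-pairs⁻ : ∀ a (f : ℕ → List B) s {w b} → (w , b) ∈ pairs a f s → ∃[ s′ ] s ≡ w + s′ × a w ≡ true × b ∈ f s′
  ∈-pairs⁻ a f zero    m with refl , e , h ← ∈-heads⁻ a f zero m = 0 , refl , e , h
  ∈-pairs⁻ a f (suc s) m with ∈-++⁻ (heads a f (suc s)) m
  ... | inj₁ l with refl , e , h ← ∈-heads⁻ a f (suc s) l = suc s , refl , e , h
  ... | inj₂ r with (w , b) , h , refl ← ∈-map⁻ (map₁ suc) r =
    let s′ , e , t , h′ = ∈-pairs⁻ (a ∘ suc) f s h in s′ , cong suc e , t , h′

  ∈-pairs⁺ : ∀ a (f : ℕ → List B) w {s b} → a w ≡ true → b ∈ f s → (w , b) ∈ pairs a f (w + s)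
  ∈-pairs⁺ a f zero    {zero}  e h = ∈-heads⁺ a f zero e h
  ∈-pairs⁺ a f zero    {suc s} e h = ∈-++⁺ˡ (∈-heads⁺ a f (suc s) e h)
  ∈-pairs⁺ a f (suc w) {s}     e h = ∈-++⁺ʳ (heads a f (suc (w + s))) (∈-map⁺ (map₁ suc) (∈-pairs⁺ (a ∘ suc) f w e h))

  pairs-unique : ∀ a {f : ℕ → List B} → (∀ s → Unique (f s)) → ∀ s → Unique (pairs a f s)
  pairs-unique a {f} u = go a
    where
    heads-unique : ∀ a s → Unique (heads a f s)
    heads-unique a s with a 0
    ... | true  = map⁺ (λ { refl → refl }) (u s)
    ... | false = []
    go : ∀ a s → Unique (pairs a f s)
    go a zero    = heads-unique a zero
    go a (suc s) = ++⁺ (heads-unique a (suc s)) (map⁺ (λ { refl → refl }) (go (a ∘ suc) s)) disjoint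
      where
      disjoint : ∀ {x} → x ∈ heads a f (suc s) × x ∈ map (map₁ suc) (pairs (a ∘ suc) f s) → _
      disjoint {w , b} (l , r) with refl , _ ← ∈-heads⁻ a f (suc s) l with ∈-map⁻ (map₁ suc) r
      ... | _ , _ , ()

  length-heads : ∀ a (f : ℕ → List B) s → pos (length (heads a f s)) ≡ (if a 0 then pos (length (f s)) else 0ℤ)
  length-heads {B} a f s with a 0
  ... | true  = cong pos (length-map {B = ℕ × B} (0 ,_) (f s))
  ... | false = refl

  length-pairs : ∀ a (f : ℕ → List B) → (λ s → pos (length (pairs a f s))) ≗ conv a (λ s → pos (length (f s)))
  length-pairs a f zero    = length-heads a f zero
  length-pairs a f (suc s) = begin
    pos (length (heads a f (suc s) ++ map (map₁ suc) (pairs (a ∘ suc) f s)))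
      ≡⟨ cong pos (length-++ (heads a f (suc s))) ⟩
    pos (length (heads a f (suc s)) + length (map (map₁ suc) (pairs (a ∘ suc) f s)))
      ≡⟨ ℤ.pos-+ (length (heads a f (suc s))) _ ⟩
    pos (length (heads a f (suc s))) ℤ.+ pos (length (map (map₁ suc) (pairs (a ∘ suc) f s)))
      ≡⟨ cong₂ ℤ._+_ (length-heads a f (suc s)) (trans (cong pos (length-map (map₁ suc) (pairs (a ∘ suc) f s))) (length-pairs (a ∘ suc) f s)) ⟩
    conv a (λ s → pos (length (f s))) (suc s) ∎

  weightings : ∀ {n} → Vec Con n → ℕ → List (Vec ℕ n)
  weightings []       zero    = [] ∷ []
  weightings []       (suc s) = []
  weightings (c ∷ cs) s       = map (uncurry _∷_) (pairs (sem c) (weightings cs) s)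

  weightings-unique : ∀ {n} (cs : Vec Con n) s → Unique (weightings cs s)
  weightings-unique []       zero    = [] ∷ []
  weightings-unique []       (suc s) = []
  weightings-unique (c ∷ cs) s       = map⁺ inj (pairs-unique (sem c) (weightings-unique cs) s)
    where
    inj : ∀ {x y : ℕ × Vec ℕ _} → uncurry _∷_ x ≡ uncurry _∷_ y → x ≡ y
    inj {_ , _} {_ , _} refl = refl

  ∈-weightings⁻ : ∀ {n} (cs : Vec Con n) s {w} → w ∈ weightings cs s →
                  s ≡ sum w × (∀ i → sem (lookup cs i) (lookup w i) ≡ true)
  ∈-weightings⁻ []       zero {[]} m = refl , λ ()
  ∈-weightings⁻ (c ∷ cs) s m with (w , v) , h , refl ← ∈-map⁻ (uncurry _∷_) m
    with s′ , refl , e , h′ ← ∈-pairs⁻ (sem c) (weightings cs) s h with refl , g ← ∈-weightings⁻ cs s′ h′ =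
    refl , λ { zero → e ; (suc i) → g i }

  ∈-weightings⁺ : ∀ {n} (cs : Vec Con n) w → (∀ i → sem (lookup cs i) (lookup w i) ≡ true) → w ∈ weightings cs (sum w)
  ∈-weightings⁺ []       []      h = here refl
  ∈-weightings⁺ (c ∷ cs) (w ∷ v) h =
    ∈-map⁺ (uncurry _∷_) (∈-pairs⁺ (sem c) (weightings cs) w (h zero) (∈-weightings⁺ cs v (h ∘ suc)))

  length-weightings : ∀ {n} (cs : Vec Con n) → (λ s → pos (length (weightings cs s))) ≗ ops (toList cs) (Sⁿ n δ)
  length-weightings []       zero    = refl
  length-weightings []       (suc s) = refl
  length-weightings {suc n} (c ∷ cs) s = begin
    pos (length (map (uncurry _∷_) (pairs (sem c) (weightings cs) s)))
      ≡⟨ cong pos (length-map (uncurry _∷_) (pairs (sem c) (weightings cs) s)) ⟩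
    pos (length (pairs (sem c) (weightings cs) s))
      ≡⟨ length-pairs (sem c) (weightings cs) s ⟩
    conv (sem c) (λ s → pos (length (weightings cs s))) s
      ≡⟨ conv-cong (sem c) (length-weightings cs) s ⟩
    conv (sem c) (ops (toList cs) (Sⁿ n δ)) s
      ≡⟨ conv-sem c (ops (toList cs) (Sⁿ n δ)) s ⟩
    op c (S (ops (toList cs) (Sⁿ n δ))) s
      ≡⟨ cong-≗ (op-isOperator c) (ops-comm S-isOperator (toList cs) (Sⁿ n δ)) s ⟩
    op c (ops (toList cs) (Sⁿ (suc n) δ)) s ∎

-- How the cycles change when 0 is inserted

module Cycles where

  open import Defs
  open Sums using (unique-↭)
  open Permutations
  import Data.Bool.Properties as Bool
  open import Data.Nat using (_+_; _∸_; _≤_)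
  open import Data.Nat.Properties using (+-suc; m+[n∸m]≡n; ≤-refl; ≤-trans; m≤n⇒m<n∨m≡n; m∸n+n≡m; +-cancelˡ-≤; m≤n+m)
  open import Data.Fin using (fromℕ<; _≟_)
  import Data.Fin.Properties as Fin
  open import Data.List using (allFin)
  open import Data.List.Membership.Propositional using (_∈_)
  open import Data.List.Membership.Propositional.Properties using (∈-allFin; ∈-map⁺; ∈-map⁻; ∈-deduplicate⁺; ∈-deduplicate⁻)
  open import Data.List.Relation.Binary.Permutation.Propositional using (_↭_)
  open import Data.List.Relation.Unary.All.Properties using (¬Any⇒All¬)
  open import Data.List.Relation.Unary.Unique.Propositional.Properties using (map⁺)
  open import Data.List.Relation.Unary.Unique.DecPropositional.Properties using (deduplicate-!)
  open import Data.Vec using (lookup; replicate; map)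
  open import Data.Vec.Properties using (≡-dec; lookup-map; lookup∘tabulate; tabulate∘lookup; tabulate-cong; lookup-replicate)
  import Function.Endo.Propositional as Endo

  open Enumeration cycleInsertion

  private
    infixr 8 _^_
    _^_ : ∀ {n} → (Fin n → Fin n) → ℕ → Fin n → Fin n
    _^_ {n} = Endo._^_ (Fin n)

  Reach : ∀ {n} → (Fin n → Fin n) → Fin n → Fin n → Set
  Reach f x y = ∃[ e ] (f ^ e) x ≡ y

  reach-trans : ∀ {n} {f : Fin n → Fin n} {x y z} → Reach f x y → Reach f y z → Reach f x z
  reach-trans {n} {f} {x} (a , refl) (b , refl) = b + a , cong (λ g → g x) (Endo.^-homo (Fin n) f b a)

  module _ {n} {f : Fin n → Fin n} (inj : Injective _≡_ _≡_ f) where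

    private
      cancel : ∀ a {x y} → (f ^ a) x ≡ (f ^ a) y → x ≡ y
      cancel zero    e = e
      cancel (suc a) e = cancel a (inj e)

    -- Among the exponents 0 to n two give the same point by the pigeonhole principle, and
    -- injectivity cancels the smaller one.
    period : ∀ x → ∃[ m ] suc m ≤ n × (f ^ suc m) x ≡ x
    period x with i , j , i<j , e ← Fin.pigeonhole {n} {suc n} ≤-refl (λ e → (f ^ toℕ e) x) =
      m , +-cancelˡ-≤ (toℕ i) (suc m) n bound , sym (cancel (toℕ i) shifted)
      where
      m = toℕ j ∸ suc (toℕ i)
      i+m : toℕ i + suc m ≡ toℕ j
      i+m = trans (+-suc (toℕ i) m) (m+[n∸m]≡n i<j)
      bound : toℕ i + suc m ≤ toℕ i + n
      bound = subst (_≤ toℕ i + n) (sym i+m) (≤-trans (Fin.toℕ≤pred[n] j) (m≤n+m n (toℕ i)))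
      shifted : (f ^ toℕ i) x ≡ (f ^ toℕ i) ((f ^ suc m) x)
      shifted = begin
        (f ^ toℕ i) x                ≡⟨ e ⟩
        (f ^ toℕ j) x                ≡⟨ cong (λ k → (f ^ k) x) i+m ⟨
        (f ^ (toℕ i + suc m)) x      ≡⟨ cong (λ g → g x) (Endo.^-homo (Fin n) f (toℕ i) (suc m)) ⟩
        (f ^ toℕ i) ((f ^ suc m) x)  ∎
        where open ≡-Reasoning

    private
      reduce : ∀ {x m} → (f ^ suc m) x ≡ x → ∀ e → ∃[ e′ ] e′ ≤ m × (f ^ e) x ≡ (f ^ e′) x
      reduce         p zero    = 0 , z≤n , refl
      reduce {x} {m} p (suc e) with reduce p e
      ... | e′ , le , q with m≤n⇒m<n∨m≡n le
      ...   | inj₁ lt   = suc e′ , lt , cong f q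
      ...   | inj₂ refl = 0 , z≤n , trans (cong f q) p

    reach-sym : ∀ {x y} → Reach f x y → Reach f y x
    reach-sym {x} (e , refl) with m , _ , p ← period x with e′ , le , q ← reduce p e =
      suc (m ∸ e′) , (begin
        (f ^ suc (m ∸ e′)) ((f ^ e) x)   ≡⟨ cong (f ^ suc (m ∸ e′)) q ⟩
        (f ^ suc (m ∸ e′)) ((f ^ e′) x)  ≡⟨ cong (λ g → g x) (Endo.^-homo (Fin n) f (suc (m ∸ e′)) e′) ⟨
        (f ^ suc (m ∸ e′ + e′)) x        ≡⟨ cong (λ k → (f ^ suc k) x) (m∸n+n≡m le) ⟩
        (f ^ suc m) x                    ≡⟨ p ⟩
        x                                ∎)
      where open ≡-Reasoning

    -- Justifies the encoding of `cycleOf`, which tries only exponents below n.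
    reach-bounded : ∀ {x y} → Reach f x y → ∃[ e ] (f ^ toℕ {n} e) x ≡ y
    reach-bounded {x} (e , refl) with m , m<n , p ← period x with e′ , le , q ← reduce p e =
      fromℕ< e′<n , trans (cong (λ k → (f ^ k) x) (Fin.toℕ-fromℕ< e′<n)) (sym q)
      where
      e′<n = ≤-trans (s≤s le) m<n

  does⇔ : ∀ {P : Set} (p : Dec P) → does p ≡ true ⇔ P
  does⇔ (yes p) = mk⇔ (λ _ → p) (λ _ → refl)
  does⇔ (no ¬p) = mk⇔ (λ ()) (λ p → contradiction p ¬p)

  bool-ext : ∀ {b c : Bool} → (b ≡ true → c ≡ true) → (c ≡ true → b ≡ true) → b ≡ c
  bool-ext {true}  {c}     f g = sym (f refl)
  bool-ext {false} {true}  f g = g refl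
  bool-ext {false} {false} f g = refl

  vec-ext : ∀ {A : Set} {n} {u v : Vec A n} → (∀ i → lookup u i ≡ lookup v i) → u ≡ v
  vec-ext {u = u} {v} h = trans (sym (tabulate∘lookup u)) (trans (tabulate-cong h) (tabulate∘lookup v))

  inCycle? : ∀ {n} (σ : Vec (Fin n) n) i j → Dec (∃[ e ] (lookup σ ^ toℕ {n} e) i ≡ j)
  inCycle? σ i j = Fin.any? λ e → (lookup σ ^ toℕ e) i ≟ j

  lookup-cycleOf : ∀ {n} (σ : Vec (Fin n) n) i j → lookup (cycleOf σ i) j ≡ does (inCycle? σ i j)
  lookup-cycleOf σ i j = lookup∘tabulate (λ j → does (inCycle? σ i j)) j

  cycleOf⁻ : ∀ {n} (σ : Vec (Fin n) n) {i j} → lookup (cycleOf σ i) j ≡ true → Reach (lookup σ) i j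
  cycleOf⁻ σ {i} {j} h =
    let e , q = Equivalence.to (does⇔ (inCycle? σ i j)) (trans (sym (lookup-cycleOf σ i j)) h)
    in toℕ e , q

  module _ {n} (σ : Vec (Fin n) n) (perm : IsPermutation σ) where

    private
      inj : Injective _≡_ _≡_ (lookup σ)
      inj = proj₁ perm

    cycleOf⁺ : ∀ {i j} → Reach (lookup σ) i j → lookup (cycleOf σ i) j ≡ true
    cycleOf⁺ {i} {j} r = trans (lookup-cycleOf σ i j)
      (Equivalence.from (does⇔ (inCycle? σ i j)) (reach-bounded inj r))

    cycleOf-cong : ∀ {i j} → Reach (lookup σ) i j → cycleOf σ i ≡ cycleOf σ j
    cycleOf-cong r = vec-ext λ k → bool-ext
      (λ h → cycleOf⁺ (reach-trans (reach-sym inj r) (cycleOf⁻ σ h)))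
      (λ h → cycleOf⁺ (reach-trans r (cycleOf⁻ σ h)))

  ∈-cycles⁻ : ∀ {n} (σ : Vec (Fin n) n) {s} → s ∈ cycles σ → ∃[ i ] s ≡ cycleOf σ i
  ∈-cycles⁻ {n} σ m with i , _ , e ← ∈-map⁻ (cycleOf σ) (∈-deduplicate⁻ (≡-dec Bool._≟_) (List.map (cycleOf σ) (allFin n)) m) = i , e

  ∈-cycles⁺ : ∀ {n} (σ : Vec (Fin n) n) i → cycleOf σ i ∈ cycles σ
  ∈-cycles⁺ σ i = ∈-deduplicate⁺ (≡-dec Bool._≟_) (∈-map⁺ (cycleOf σ) (∈-allFin i))

  cycles-unique : ∀ {n} (σ : Vec (Fin n) n) → Unique (cycles σ)
  cycles-unique σ = deduplicate-! (≡-dec Bool._≟_) _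

  cycle-self : ∀ {n} (σ : Vec (Fin n) n) → IsPermutation σ → ∀ i → lookup (cycleOf σ i) i ≡ true
  cycle-self σ perm i = cycleOf⁺ σ perm (0 , refl)

  cycle-of-element : ∀ {n} (σ : Vec (Fin n) n) → IsPermutation σ → ∀ {s i} → s ∈ cycles σ → lookup s i ≡ true → s ≡ cycleOf σ i
  cycle-of-element σ perm m h with j , refl ← ∈-cycles⁻ σ m = cycleOf-cong σ perm (cycleOf⁻ σ h)

  module Fixed {n} (σ : Vec (Fin n) n) (perm : IsPermutation σ) where

    τ : Vec (Fin (suc n)) (suc n)
    τ = extend zero σ

    private
      perm′ : IsPermutation τ
      perm′ = extend-isPermutation zero σ perm

      step : ∀ e i → (lookup τ ^ e) (suc i) ≡ suc ((lookup σ ^ e) i)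
      step zero    i = refl
      step (suc e) i = trans (cong (lookup τ) (step e i)) (lookup-map ((lookup σ ^ e) i) suc σ)

      stay : ∀ e → (lookup τ ^ e) zero ≡ zero
      stay zero    = refl
      stay (suc e) = cong (lookup τ) (stay e)

      cycleOf-zero : cycleOf τ zero ≡ true ∷ replicate n false
      cycleOf-zero = vec-ext λ where
        zero    → cycle-self τ perm′ zero
        (suc j) → bool-ext
          (λ h → let e , q = cycleOf⁻ τ {zero} {suc j} h in contradiction (trans (sym (stay e)) q) λ ())
          (λ h → contradiction (trans (sym h) (lookup-replicate j false)) λ ())

      cycleOf-suc : ∀ i → cycleOf τ (suc i) ≡ false ∷ cycleOf σ i
      cycleOf-suc i = vec-ext λ where
        zero    → bool-ext
          (λ h → let e , q = cycleOf⁻ τ {suc i} {zero} h in contradiction (trans (sym (step e i)) q) λ ())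
          (λ ())
        (suc j) → bool-ext
          (λ h → let e , q = cycleOf⁻ τ {suc i} {suc j} h in cycleOf⁺ σ perm (e , Fin.suc-injective (trans (sym (step e i)) q)))
          (λ h → let e , q = cycleOf⁻ σ {i} {j} h in cycleOf⁺ τ perm′ (e , trans (step e i) (cong suc q)))

    cycles-fixed : cycles τ ↭ (true ∷ replicate n false) ∷ List.map (false ∷_) (cycles σ)
    cycles-fixed = unique-↭ (cycles-unique τ) (fresh ∷ map⁺ (λ { refl → refl }) (cycles-unique σ)) λ s → mk⇔ to from
      where
      fresh = ¬Any⇒All¬ _ λ m → contradiction (proj₂ (proj₂ (∈-map⁻ (false ∷_) m))) λ ()
      to : ∀ {s} → s ∈ cycles τ → s ∈ (true ∷ replicate n false) ∷ List.map (false ∷_) (cycles σ)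
      to m with ∈-cycles⁻ τ m
      ... | zero  , refl = here cycleOf-zero
      ... | suc i , refl = there (subst (_∈ List.map (false ∷_) (cycles σ)) (sym (cycleOf-suc i)) (∈-map⁺ (false ∷_) (∈-cycles⁺ σ i)))
      from : ∀ {s} → s ∈ (true ∷ replicate n false) ∷ List.map (false ∷_) (cycles σ) → s ∈ cycles τ
      from (here refl) = subst (_∈ cycles τ) cycleOf-zero (∈-cycles⁺ τ zero)
      from (there m) with u , h , refl ← ∈-map⁻ (false ∷_) m with i , refl ← ∈-cycles⁻ σ h =
        subst (_∈ cycles τ) (cycleOf-suc i) (∈-cycles⁺ τ (suc i))

  module Inserted {n} (j : Fin n) (σ : Vec (Fin n) n) (perm : IsPermutation σ) where

    τ : Vec (Fin (suc n)) (suc n)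
    τ = extend (suc j) σ

    adjoin : Subset n → Subset (suc n)
    adjoin s = lookup s j ∷ s

    private
      perm′ : IsPermutation τ
      perm′ = extend-isPermutation (suc j) σ perm

      f = lookup σ
      g = lookup τ

      -- 0 lies in the cycle of j, so it may be identified with j.
      π : Fin (suc n) → Fin n
      π zero    = j
      π (suc i) = i

      π-cut : ∀ y → π (cut (suc j) y) ≡ y
      π-cut y with y ≟ j
      ... | yes e = sym e
      ... | no _  = refl

      g-suc : ∀ i → g (suc i) ≡ cut (suc j) (f i)
      g-suc i = lookup-map i (cut (suc j)) σ

      -- Under the identification `π` a step of τ is a step of σ, or no step at all when it leaves
      -- 0.
      project : ∀ e x → Reach f (π x) (π ((g ^ e) x))
      project zero    x = 0 , refl
      project (suc e) x with (g ^ e) x | project e x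
      ... | zero  | r = r
      ... | suc i | r = reach-trans r (1 , trans (sym (π-cut (f i))) (cong π (sym (g-suc i))))

      cut-reach : ∀ y → Reach g (cut (suc j) y) (suc y)
      cut-reach y with y ≟ j
      ... | yes refl = 1 , refl
      ... | no _     = 0 , refl

      -- Conversely, a step of σ takes two steps of τ when it passes through 0.
      lift : ∀ e i → Reach g (suc i) (suc ((f ^ e) i))
      lift zero    i = 0 , refl
      lift (suc e) i = reach-trans (lift e i) (reach-trans (1 , g-suc ((f ^ e) i)) (cut-reach (f ((f ^ e) i))))

      toπ : ∀ x → Reach g x (suc (π x))
      toπ zero    = 1 , refl
      toπ (suc i) = 0 , refl

      cycleOf-τ : ∀ x → cycleOf τ x ≡ adjoin (cycleOf σ (π x))
      cycleOf-τ x = vec-ext λ y → trans (at y) (lookup-adjoin y)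
        where
        lookup-adjoin : ∀ y → lookup (cycleOf σ (π x)) (π y) ≡ lookup (adjoin (cycleOf σ (π x))) y
        lookup-adjoin zero    = refl
        lookup-adjoin (suc y) = refl
        at : ∀ y → lookup (cycleOf τ x) y ≡ lookup (cycleOf σ (π x)) (π y)
        at y = bool-ext
          (λ h → let e , q = cycleOf⁻ τ {x} {y} h in
            cycleOf⁺ σ perm (subst (λ z → Reach f (π x) (π z)) q (project e x)))
          (λ h → let e , q = cycleOf⁻ σ {π x} {π y} h in
            cycleOf⁺ τ perm′ (reach-trans (toπ x)
              (reach-trans (subst (λ z → Reach g (suc (π x)) (suc z)) q (lift e (π x)))
                (reach-sym (proj₁ perm′) (toπ y)))))

    cycles-inserted : cycles τ ↭ List.map adjoin (cycles σ)
    cycles-inserted = unique-↭ (cycles-unique τ) (map⁺ (λ { refl → refl }) (cycles-unique σ)) λ s → mk⇔ to from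
      where
      to : ∀ {s} → s ∈ cycles τ → s ∈ List.map adjoin (cycles σ)
      to m with x , refl ← ∈-cycles⁻ τ m = subst (_∈ List.map adjoin (cycles σ)) (sym (cycleOf-τ x)) (∈-map⁺ adjoin (∈-cycles⁺ σ (π x)))
      from : ∀ {s} → s ∈ List.map adjoin (cycles σ) → s ∈ cycles τ
      from m with u , h , refl ← ∈-map⁻ adjoin m with i , refl ← ∈-cycles⁻ σ h =
        subst (_∈ cycles τ) (cycleOf-τ (suc i)) (∈-cycles⁺ τ (suc i))

-- Counting the weighted permutations by a sum over σ

module Counting where

  open import Defs
  open Sums
  open Series
  open Permutations
  open Descents using (lastZero; term; worpitzky)
  open Weights
  open Cycles
  open import Data.Nat using (_<_; _≤_)
  open import Data.Integer using (ℤ; 0ℤ; _+_; _*_; _^_) renaming (+_ to pos)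
  open import Data.Integer.Properties using (*-zeroʳ; *-identityˡ; *-assoc; +-identityˡ; +-identityʳ)
  open import Data.List.Properties using (length-map; length-deduplicate; length-tabulate)
  open import Data.List.Membership.Propositional using (_∈_)
  open import Data.Vec using (lookup; toList; fromList; sum)
  open import Data.Vec.Properties using (lookup-map; toList∘fromList; toList-map)
  open ≡-Reasoning

  open IsOperator
  module Orders = Enumeration relabelling
  module Perms = Enumeration cycleInsertion

  lastZero⁺ : ∀ {r l} (p : Vec (Fin r) l) i → suc (toℕ i) ≡ l → toℕ (lookup p i) ≡ 0 → lastZero p ≡ true
  lastZero⁺ (x ∷ [])    zero    e h rewrite h = refl
  lastZero⁺ (x ∷ y ∷ p) (suc i) e h = lastZero⁺ (y ∷ p) i (ℕ.suc-injective e) h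

  lastZero⁻ : ∀ {r l} (p : Vec (Fin r) l) → lastZero p ≡ true → ∃[ i ] suc (toℕ i) ≡ l × toℕ (lookup p i) ≡ 0
  lastZero⁻ (zero ∷ []) h = zero , refl , refl
  lastZero⁻ (x ∷ y ∷ p) h = let i , e , q = lastZero⁻ (y ∷ p) h in suc i , cong suc e , q

  ∈-if⁻ : ∀ {A : Set} (b : Bool) {x} {xs : List A} → x ∈ (if b then xs else []) → b ≡ true × x ∈ xs
  ∈-if⁻ true m = refl , m

  ∈-if⁺ : ∀ {A : Set} {b : Bool} {x} {xs : List A} → b ≡ true → x ∈ xs → x ∈ (if b then xs else [])
  ∈-if⁺ refl m = m

  -- The number of ways to order and weight r cycles with total K, by Worpitzky's
  -- identity; it is 0 for r = 0 because then no ordering ends with 1.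
  power : ℕ → Series
  power zero    K = 0ℤ
  power (suc r) K = pos K ^ r

  module _ {n : ℕ} (α : Subset n → Con) where

    Admissible : ℕ → ℕ → Triple n → Set
    Admissible r k T = OfType r k T × (∀ 𝔠 → sem (α (elements 𝔠)) (weight 𝔠) ≡ true)
      where open Triple T

    private
      Data : Vec (Fin n) n → Set
      Data σ = Vec (Fin ∣C σ ∣) ∣C σ ∣ × Vec ℕ ∣C σ ∣

      constraints : ∀ σ → Vec Con ∣C σ ∣
      constraints σ = Vec.map α (fromList (cycles σ))

      weights : ∀ σ → Vec (Fin ∣C σ ∣) ∣C σ ∣ → ℕ → List (Vec ℕ ∣C σ ∣)
      weights σ p k = if lastZero p then shiftL (des p) (weightings (constraints σ)) k else []

      orderings : ∀ k σ → List (Data σ)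
      orderings k σ = bind (Orders.perms ∣C σ ∣) (λ p → weights σ p k) _,_

      choices : ∀ r k σ → List (Data σ)
      choices r k σ = if does (∣C σ ∣ ℕ.≟ r) then orderings k σ else []

      triple : ∀ σ → Data σ → Triple n
      triple σ (p , w) = ⟨ σ , p , w ⟩

      lookup-constraints : ∀ σ i → lookup (constraints σ) i ≡ α (List.lookup (cycles σ) i)
      lookup-constraints σ i = trans (lookup-map i α (fromList (cycles σ))) (cong α (lookup-fromList (cycles σ) i))
        where
        lookup-fromList : ∀ {A : Set} (xs : List A) i → lookup (fromList xs) i ≡ List.lookup xs i
        lookup-fromList (x ∷ xs) zero    = refl
        lookup-fromList (x ∷ xs) (suc i) = lookup-fromList xs i

      toList-constraints : ∀ σ → toList (constraints σ) ≡ List.map α (cycles σ)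
      toList-constraints σ = trans (toList-map α (fromList (cycles σ))) (cong (List.map α) (toList∘fromList (cycles σ)))

      weights-unique : ∀ k σ p → Unique (weights σ p k)
      weights-unique k σ p with lastZero p
      ... | true  = shiftL-unique (des p) (weightings-unique (constraints σ)) k
      ... | false = []

      choices-unique : ∀ r k σ → Unique (choices r k σ)
      choices-unique r k σ with does (∣C σ ∣ ℕ.≟ r)
      ... | true  = bind-unique _,_ (λ { refl → refl }) (Orders.perms-unique ∣C σ ∣) (weights-unique k σ)
      ... | false = []

      choices⁻ : ∀ r k σ {x} → x ∈ choices r k σ →
                 ∣C σ ∣ ≡ r × proj₁ x ∈ Orders.perms ∣C σ ∣ × lastZero (proj₁ x) ≡ true ×
                 proj₂ x ∈ shiftL (des (proj₁ x)) (weightings (constraints σ)) k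
      choices⁻ r k σ m =
        let e , m′ = ∈-if⁻ (does (∣C σ ∣ ℕ.≟ r)) m
            p , w , h , h′ , q = ∈-bind⁻ (Orders.perms ∣C σ ∣) (λ p → weights σ p k) _,_ m′
            z , h″ = ∈-if⁻ (lastZero p) h′
        in Equivalence.to (does⇔ (∣C σ ∣ ℕ.≟ r)) e , subst Good (sym q) (h , z , h″)
        where
        Good : Data σ → Set
        Good (p , w) = p ∈ Orders.perms ∣C σ ∣ × lastZero p ≡ true × w ∈ shiftL (des p) (weightings (constraints σ)) k

      choices⁺ : ∀ k σ {p w} → p ∈ Orders.perms ∣C σ ∣ → lastZero p ≡ true →
                 w ∈ shiftL (des p) (weightings (constraints σ)) k → (p , w) ∈ choices ∣C σ ∣ k σ
      choices⁺ k σ {p} h e h′ = ∈-if⁺ (Equivalence.from (does⇔ (∣C σ ∣ ℕ.≟ ∣C σ ∣)) refl) (∈-bind⁺ _,_ h (∈-if⁺ e h′))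

    triples : ℕ → ℕ → List (Triple n)
    triples r k = bind (Perms.perms n) (choices r k) triple

    count : ℕ → ℕ → ℕ
    count r k = length (triples r k)

    private
      triples⁻ : ∀ r k T → T ∈ triples r k → Admissible r k T
      triples⁻ r k T m with σ , (p , w) , h , h′ , refl ← ∈-bind⁻ (Perms.perms n) (choices r k) triple m
        with e , hp , hz , hw ← choices⁻ r k σ h′
        with s , refl , hw′ ← ∈-shiftL⁻ (des p) k hw
        with refl , g ← ∈-weightings⁻ (constraints σ) s hw′ =
        ((Perms.∈-perms⁻ h , Orders.∈-perms⁻ hp , lastZero⁻ p hz) , e , ℕ.+-comm (des p) (sum w)) ,
        (λ i → trans (cong (λ c → sem c (lookup w i)) (sym (lookup-constraints σ i))) (g i))

      triples⁺ : ∀ r k T → Admissible r k T → T ∈ triples r k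
      triples⁺ r k ⟨ σ , p , w ⟩ (((hσ , hp , i , e , z) , refl , refl) , g) =
        ∈-bind⁺ triple (Perms.∈-perms⁺ hσ) (choices⁺ (sum w ℕ.+ des p) σ (Orders.∈-perms⁺ hp) (lastZero⁺ p i e z)
          (subst (λ k → w ∈ shiftL (des p) (weightings (constraints σ)) k) (ℕ.+-comm (des p) (sum w))
            (∈-shiftL⁺ (des p) (∈-weightings⁺ (constraints σ) w
              λ i → trans (cong (λ c → sem c (lookup w i)) (lookup-constraints σ i)) (g i)))))

    admissible-cardinality : ∀ r k → Admissible r k HasCardinality count r k
    admissible-cardinality r k =
      triples r k ,
      bind-unique triple (λ { refl → refl }) (Perms.perms-unique n) (choices-unique r k) ,
      (λ T → mk⇔ (triples⁻ r k T) (triples⁺ r k T)) ,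
      refl

    private
      ∑-term : ∀ r K → ∑ (Orders.perms r) (λ p → term (Sⁿ r δ) p K) ≡ power r K
      ∑-term zero    K = refl
      ∑-term (suc r) K = worpitzky r K

    -- Descents and weights contribute independently: the constraint operators do not depend on p
    -- and can be moved in front of the sum over p, which is then evaluated by Worpitzky's identity.
    length-orderings : ∀ σ → (λ k → pos (length (orderings k σ))) ≗ ops (List.map α (cycles σ)) (power ∣C σ ∣)
    length-orderings σ k = begin
      pos (length (orderings k σ))
        ≡⟨ length-bind (Orders.perms ρ) (λ p → weights σ p k) _,_ ⟩
      ∑ (Orders.perms ρ) (λ p → pos (length (weights σ p k)))
        ≡⟨ ∑-cong (Orders.perms ρ) each ⟩
      ∑ (Orders.perms ρ) (λ p → ops L (term (Sⁿ ρ δ) p) k)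
        ≡⟨ ∑-comm (ops-isOperator L) (Orders.perms ρ) (term (Sⁿ ρ δ)) k ⟨
      ops L (λ K → ∑ (Orders.perms ρ) (λ p → term (Sⁿ ρ δ) p K)) k
        ≡⟨ cong-≗ (ops-isOperator L) (∑-term ρ) k ⟩
      ops L (power ρ) k ∎
      where
      ρ = ∣C σ ∣
      L = List.map α (cycles σ)
      each : ∀ p → pos (length (weights σ p k)) ≡ ops L (term (Sⁿ ρ δ) p) k
      each p with lastZero p
      ... | false = sym (zero-≗ (ops-isOperator L) k)
      ... | true  = begin
        pos (length (shiftL (des p) (weightings (constraints σ)) k))
          ≡⟨ length-shiftL (des p) (weightings (constraints σ)) k ⟩
        sh (des p) (λ s → pos (length (weightings (constraints σ) s))) k
          ≡⟨ sh-cong (des p) (length-weightings (constraints σ)) k ⟩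
        sh (des p) (ops (toList (constraints σ)) (Sⁿ ρ δ)) k
          ≡⟨ cong (λ L → sh (des p) (ops L (Sⁿ ρ δ)) k) (toList-constraints σ) ⟩
        sh (des p) (ops L (Sⁿ ρ δ)) k
          ≡⟨ shift (ops-isOperator L) (des p) (Sⁿ ρ δ) k ⟨
        ops L (sh (des p) (Sⁿ ρ δ)) k ∎

    count-∑ : ∀ r k → pos (count r k) ≡
              ∑ (Perms.perms n) (λ σ → if does (∣C σ ∣ ℕ.≟ r) then ops (List.map α (cycles σ)) (power ∣C σ ∣) k else 0ℤ)
    count-∑ r k = trans (length-bind (Perms.perms n) (choices r k) triple) (∑-cong (Perms.perms n) each)
      where
      each : ∀ σ → pos (length (choices r k σ)) ≡ (if does (∣C σ ∣ ℕ.≟ r) then ops (List.map α (cycles σ)) (power ∣C σ ∣) k else 0ℤ)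
      each σ with does (∣C σ ∣ ℕ.≟ r)
      ... | true  = length-orderings σ k
      ... | false = refl

  -- power, weighted by t^(r-1).
  ψ : ℤ → ℕ → Series
  ψ t zero    K = 0ℤ
  ψ t (suc r) K = (t * pos K) ^ r

  ∣C∣≤n : ∀ {n} (σ : Vec (Fin n) n) → ∣C σ ∣ ≤ n
  ∣C∣≤n {n} σ = ℕ.≤-trans (length-deduplicate _ (List.map (cycleOf σ) (List.allFin n)))
    (ℕ.≤-reflexive (trans (length-map (cycleOf σ) (List.allFin n)) (length-tabulate {n = n} (λ i → i))))

  private
    select : ∀ t B x {r} → r < B → horner t B (λ m → if does (suc r ℕ.≟ suc m) then x else 0ℤ) ≡ t ^ r * x
    select t (suc B) x {zero}  _       = trans (cong (λ y → x + t * y) (horner-zero t B))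
      (trans (cong (x +_) (*-zeroʳ t)) (trans (+-identityʳ x) (sym (*-identityˡ x))))
    select t (suc B) x {suc r} (s≤s h) = trans (+-identityˡ _) (trans (cong (t *_) (select t B x h)) (sym (*-assoc t (t ^ r) x)))

    ^-distrib-* : ∀ a b r → (a * b) ^ r ≡ a ^ r * b ^ r
    ^-distrib-* a b zero    = refl
    ^-distrib-* a b (suc r) = trans (cong (a * b *_) (^-distrib-* a b r)) (aux a b (a ^ r) (b ^ r))
      where
      aux : ∀ a b x y → a * b * (x * y) ≡ a * x * (b * y)
      aux = solve-∀

  -- Each σ contributes to a single coefficient, and its factor t^(r-1) merges with K^(r-1) into
  -- `ψ`.
  count-generating : ∀ {n} (α : Subset n → Con) t k {B} → n ≤ B →
    horner t B (λ m → pos (count α (suc m) k)) ≡ ∑ (Perms.perms n) (λ σ → ops (List.map α (cycles σ)) (ψ t ∣C σ ∣) k)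
  count-generating {n} α t k {B} n≤B = begin
    horner t B (λ m → pos (count α (suc m) k))
      ≡⟨ horner-cong t B (λ m → count-∑ α (suc m) k) ⟩
    horner t B (λ m → ∑ (Perms.perms n) (λ σ → term′ σ ∣C σ ∣ m))
      ≡⟨ horner-∑ t B (Perms.perms n) (λ σ → term′ σ ∣C σ ∣) ⟩
    ∑ (Perms.perms n) (λ σ → horner t B (term′ σ ∣C σ ∣))
      ≡⟨ ∑-cong (Perms.perms n) (λ σ → each σ ∣C σ ∣ (ℕ.≤-trans (∣C∣≤n σ) n≤B)) ⟩
    ∑ (Perms.perms n) (λ σ → ops (List.map α (cycles σ)) (ψ t ∣C σ ∣) k) ∎
    where
    L : Vec (Fin n) n → List Con
    L σ = List.map α (cycles σ)
    -- The number of cycles is a separate argument so that it can be matched on.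
    term′ : Vec (Fin n) n → ℕ → ℕ → ℤ
    term′ σ ρ m = if does (ρ ℕ.≟ suc m) then ops (L σ) (power ρ) k else 0ℤ
    each : ∀ σ ρ → ρ ≤ B → horner t B (term′ σ ρ) ≡ ops (L σ) (ψ t ρ) k
    each σ zero    _ = trans (horner-zero t B) (sym (zero-≗ (ops-isOperator (L σ)) k))
    each σ (suc r) h = begin
      horner t B (term′ σ (suc r))          ≡⟨ select t B (ops (L σ) (power (suc r)) k) h ⟩
      t ^ r * ops (L σ) (power (suc r)) k   ≡⟨ scale (ops-isOperator (L σ)) (t ^ r) (power (suc r)) k ⟨
      ops (L σ) (λ K → t ^ r * pos K ^ r) k ≡⟨ cong-≗ (ops-isOperator (L σ)) (λ K → sym (^-distrib-* t (pos K) r)) k ⟩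
      ops (L σ) (ψ t (suc r)) k             ∎

-- The recursion that deletes the smallest element

module Recursion where

  open import Defs
  open Sums
  open Series
  open Permutations
  open Cycles
  open Counting using (ψ; module Perms)
  open import Data.Integer using (ℤ; _+_) renaming (+_ to pos)
  open import Data.Integer.Properties using (+-identityʳ)
  open import Data.List.Properties using (map-∘; map-cong; length-map)
  open import Data.List.Relation.Binary.Permutation.Propositional.Properties using (map⁺; ↭-length)
  open import Data.Vec using (lookup; replicate; updateAt)
  open import Data.Vec.Properties using (lookup-replicate)
  open ≡-Reasoning

  open IsOperator

  dot : ∀ {n} → Vec ℕ n → Subset n → ℕ
  dot []       []      = 0
  dot (c ∷ cs) (b ∷ s) = (if b then c else 0) ℕ.+ dot cs s

  dot-∅ : ∀ {n} (c : Vec ℕ n) → dot c (replicate n false) ≡ 0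
  dot-∅ []      = refl
  dot-∅ (_ ∷ c) = dot-∅ c

  increase : ∀ {n} → Vec ℕ n → Fin n → ℕ → Vec ℕ n
  increase c j a = updateAt c j (a ℕ.+_)

  dot-increase : ∀ {n} a (c : Vec ℕ n) j s → dot (a ∷ c) (lookup s j ∷ s) ≡ dot (increase c j a) s
  dot-increase a (c ∷ cs) zero    (true ∷ s)  = sym (ℕ.+-assoc a c (dot cs s))
  dot-increase a (c ∷ cs) zero    (false ∷ s) = refl
  dot-increase a (c ∷ cs) (suc j) (b ∷ s)     = begin
    x ℕ.+ (y ℕ.+ dot cs s)      ≡⟨ ℕ.+-assoc x y _ ⟨
    (x ℕ.+ y) ℕ.+ dot cs s      ≡⟨ cong (ℕ._+ dot cs s) (ℕ.+-comm x y) ⟩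
    (y ℕ.+ x) ℕ.+ dot cs s      ≡⟨ ℕ.+-assoc y x _ ⟩
    y ℕ.+ (x ℕ.+ dot cs s)      ≡⟨ cong (y ℕ.+_) (dot-increase a cs j s) ⟩
    y ℕ.+ dot (increase cs j a) s ∎
    where
    x = if lookup s j then a else 0
    y = if b then c else 0

  -- The constraint on the weight of a cycle, in terms of whether it contains
  -- the penultimate and the ultimate element, and of its sum of the cᵢ.
  Rule : Set
  Rule = Bool → Bool → ℕ → Con

  constraint : ∀ {d} → Rule → Vec ℕ (d ℕ.+ 2) → Subset (d ℕ.+ 2) → Con
  constraint {d} g c s = g (lookup s (penultimate {d})) (lookup s (ultimate {d})) (dot c s)

  module _ (g : Rule) (t : ℤ) where

    -- `r` counts the fixed points already deleted: their constraints have become operators outside,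
    -- but they still count in the exponent of `ψ`.
    summand : ∀ {d} → Vec ℕ (d ℕ.+ 2) → ℕ → Vec (Fin (d ℕ.+ 2)) (d ℕ.+ 2) → Series
    summand c r σ = ops (List.map (constraint g c) (cycles σ)) (ψ t (r ℕ.+ ∣C σ ∣))

    total : ∀ {d} → Vec ℕ (d ℕ.+ 2) → ℕ → Series
    total {d} c r K = ∑ (Perms.perms (d ℕ.+ 2)) (λ σ → summand c r σ K)

    private
      module _ {d} (a : ℕ) (c : Vec ℕ (d ℕ.+ 2)) (r : ℕ) (σ : Vec (Fin (d ℕ.+ 2)) (d ℕ.+ 2)) (perm : IsPermutation σ) where

        fixed : summand {suc d} (a ∷ c) r (Perms.extend zero σ) ≗ op (g false false a) (summand c (suc r) σ)
        fixed K = begin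
          ops (List.map α′ (cycles τ)) (ψ t (r ℕ.+ ∣C τ ∣)) K
            ≡⟨ ops-↭ (map⁺ α′ cycles-fixed) _ K ⟩
          op (α′ (true ∷ replicate n false)) (ops (List.map α′ (List.map (false ∷_) (cycles σ))) (ψ t (r ℕ.+ ∣C τ ∣))) K
            ≡⟨ cong (λ L → op (α′ (true ∷ replicate n false)) (ops L (ψ t (r ℕ.+ ∣C τ ∣))) K) (sym (map-∘ {g = α′} (cycles σ))) ⟩
          op (α′ (true ∷ replicate n false)) (ops (List.map α (cycles σ)) (ψ t (r ℕ.+ ∣C τ ∣))) K
            ≡⟨ cong₂ (λ α₀ ρ → op α₀ (ops (List.map α (cycles σ)) (ψ t ρ)) K) head-eq len ⟩
          op (g false false a) (ops (List.map α (cycles σ)) (ψ t (suc r ℕ.+ ∣C σ ∣))) K ∎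
          where
          open Fixed σ perm
          n  = d ℕ.+ 2
          α  = constraint {d} g c
          α′ = constraint {suc d} g (a ∷ c)
          head-eq : α′ (true ∷ replicate n false) ≡ g false false a
          head-eq rewrite lookup-replicate (penultimate {d}) false | lookup-replicate (ultimate {d}) false
            | dot-∅ c | ℕ.+-identityʳ a = refl
          len : r ℕ.+ ∣C τ ∣ ≡ suc r ℕ.+ ∣C σ ∣
          len = trans (cong (r ℕ.+_) (trans (↭-length cycles-fixed) (cong suc (length-map (false ∷_) (cycles σ))))) (ℕ.+-suc r _)

        inserted : ∀ j → summand {suc d} (a ∷ c) r (Perms.extend (suc j) σ) ≗ summand (increase c j a) r σ
        inserted j K = begin
          ops (List.map α′ (cycles τ)) (ψ t (r ℕ.+ ∣C τ ∣)) K
            ≡⟨ ops-↭ (map⁺ α′ cycles-inserted) _ K ⟩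
          ops (List.map α′ (List.map adjoin (cycles σ))) (ψ t (r ℕ.+ ∣C τ ∣)) K
            ≡⟨ cong₂ (λ L ρ → ops L (ψ t (r ℕ.+ ρ)) K) labels (trans (↭-length cycles-inserted) (length-map adjoin (cycles σ))) ⟩
          ops (List.map α (cycles σ)) (ψ t (r ℕ.+ ∣C σ ∣)) K ∎
          where
          open Inserted j σ perm
          α  = constraint {d} g (increase c j a)
          α′ = constraint {suc d} g (a ∷ c)
          labels : List.map α′ (List.map adjoin (cycles σ)) ≡ List.map α (cycles σ)
          labels = trans (sym (map-∘ (cycles σ)))
            (map-cong (λ s → cong (g (lookup s (penultimate {d})) (lookup s (ultimate {d}))) (dot-increase a c j s)) (cycles σ))

    -- Either 0 is a fixed point, which gives an operator of its own and one more cycle in `ψ`, or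
    -- it precedes j in a cycle and adds its bound a to that of j. The rule is taken at
    -- `false false` since 0 is neither of the last two elements.
    total-suc : ∀ {d} a (c : Vec ℕ (d ℕ.+ 2)) r K →
                total {suc d} (a ∷ c) r K ≡
                op (g false false a) (total c (suc r)) K + ∑Fin (λ j → total (increase c j a) r K)
    total-suc {d} a c r K = begin
      total {suc d} (a ∷ c) r K
        ≡⟨ Perms.∑-perms (d ℕ.+ 2) (λ σ → summand {suc d} (a ∷ c) r σ K) ⟩
      ∑ ps (λ σ → summand {suc d} (a ∷ c) r (Perms.extend zero σ) K) + ∑Fin (λ j → ∑ ps (λ σ → summand {suc d} (a ∷ c) r (Perms.extend (suc j) σ) K))
        ≡⟨ cong₂ _+_ (∑-cong-∈ ps (λ σ m → fixed a c r σ (Perms.∈-perms⁻ m) K))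
                     (∑Fin-cong (λ j → ∑-cong-∈ ps (λ σ m → inserted a c r σ (Perms.∈-perms⁻ m) j K))) ⟩
      ∑ ps (λ σ → op (g false false a) (summand c (suc r) σ) K) + ∑Fin (λ j → total (increase c j a) r K)
        ≡⟨ cong (_+ ∑Fin (λ j → total (increase c j a) r K)) (sym (∑-comm (op-isOperator (g false false a)) ps (summand c (suc r)) K)) ⟩
      op (g false false a) (total c (suc r)) K + ∑Fin (λ j → total (increase c j a) r K) ∎
      where
      ps = Perms.perms (d ℕ.+ 2)

    -- The two summands belong to the identity and the transposition of the last two elements, whose
    -- lists of cycles are found by computation.
    total-zero : ∀ e₁ e₂ r K → total {0} (e₁ ∷ e₂ ∷ []) r K ≡
                 op (g true false e₁) (op (g false true e₂) (ψ t (suc (suc r)))) K + op (g true true (e₁ ℕ.+ e₂)) (ψ t (suc r)) K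
    total-zero e₁ e₂ r K
      rewrite ℕ.+-identityʳ e₁ | ℕ.+-identityʳ e₂ | ℕ.+-comm r 2 | ℕ.+-comm r 1 =
      cong (op (g true false e₁) (op (g false true e₂) (ψ t (suc (suc r)))) K +_) (+-identityʳ _)

-- Solving the recursion by a sum over subsets

module ClosedForm where

  open Sums
  open Series
  open Counting using (ψ)
  open Recursion
  open import Data.Integer using (ℤ; 0ℤ; 1ℤ; -1ℤ; _+_; _*_; _-_; -_; _^_) renaming (+_ to pos)
  open import Data.Integer.Properties using (*-zeroˡ; +-identityˡ; +-identityʳ; pos-+)
  open import Data.Fin.Subset using (∣_∣)
  open import Data.List using (_++_; map)
  open ≡-Reasoning

  open IsOperator

  -- The weight conditions of S₁ (the compatible triples), S₂, S₃ and S₄; no weight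
  -- satisfies lt 0.
  rule₁ rule₂ rule₃ rule₄ : Rule
  rule₁ false false v = lt v
  rule₁ true  false v = lt (suc v)
  rule₁ false true  v = lt (suc v)
  rule₁ true  true  v = lt (suc v)
  rule₂ false false v = lt v
  rule₂ true  false v = ge (suc v)
  rule₂ false true  v = eq v
  rule₂ true  true  v = lt 0
  rule₃ false false v = lt v
  rule₃ true  false v = ge (suc v)
  rule₃ false true  v = lt v
  rule₃ true  true  v = lt 0
  rule₄ false false v = lt v
  rule₄ true  false v = lt 0
  rule₄ false true  v = lt 0
  rule₄ true  true  v = ge (suc v)

  subsets : ∀ n → List (Subset n)
  subsets zero    = [] ∷ []
  subsets (suc n) = map (true ∷_) (subsets n) ++ map (false ∷_) (subsets n)

  ∑-subsets : ∀ n f → ∑ (subsets (suc n)) f ≡ ∑ (subsets n) (λ I → f (true ∷ I) + f (false ∷ I))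
  ∑-subsets n f = begin
    ∑ (subsets (suc n)) f
      ≡⟨ ∑-++ (map (true ∷_) (subsets n)) (map (false ∷_) (subsets n)) f ⟩
    ∑ (map (true ∷_) (subsets n)) f + ∑ (map (false ∷_) (subsets n)) f
      ≡⟨ cong₂ _+_ (∑-map (true ∷_) (subsets n) f) (∑-map (false ∷_) (subsets n) f) ⟩
    ∑ (subsets n) (f ∘ (true ∷_)) + ∑ (subsets n) (f ∘ (false ∷_))
      ≡⟨ ∑-+ (subsets n) (f ∘ (true ∷_)) (f ∘ (false ∷_)) ⟨
    ∑ (subsets n) (λ I → f (true ∷ I) + f (false ∷ I)) ∎

  -- Raising the bound of j by a changes the sum over I only for the |I| elements j of I.
  ∑-increase : ∀ {n} a (c : Vec ℕ n) (I : Subset n) (F : ℕ → ℤ) →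
               ∑Fin (λ j → F (dot (increase c j a) I)) ≡ pos ∣ I ∣ * F (a ℕ.+ dot c I) + (pos n - pos ∣ I ∣) * F (dot c I)
  ∑-increase a []      []          F = sym (trans (cong₂ _+_ (*-zeroˡ (F (a ℕ.+ 0))) (*-zeroˡ (F 0))) (+-identityˡ 0ℤ))
  ∑-increase {suc n} a (c ∷ cs) (true ∷ I)  F = begin
    F (a ℕ.+ c ℕ.+ x) + ∑Fin (λ j → F (c ℕ.+ dot (increase cs j a) I))
      ≡⟨ cong₂ _+_ (cong F (ℕ.+-assoc a c x)) (∑-increase a cs I (λ y → F (c ℕ.+ y))) ⟩
    F (a ℕ.+ (c ℕ.+ x)) + (pos ∣ I ∣ * F (c ℕ.+ (a ℕ.+ x)) + (pos n - pos ∣ I ∣) * F (c ℕ.+ x))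
      ≡⟨ cong (λ y → F (a ℕ.+ (c ℕ.+ x)) + (pos ∣ I ∣ * F y + (pos n - pos ∣ I ∣) * F (c ℕ.+ x))) swap ⟩
    F (a ℕ.+ (c ℕ.+ x)) + (pos ∣ I ∣ * F (a ℕ.+ (c ℕ.+ x)) + (pos n - pos ∣ I ∣) * F (c ℕ.+ x))
      ≡⟨ aux (F (a ℕ.+ (c ℕ.+ x))) (F (c ℕ.+ x)) (pos ∣ I ∣) (pos n) ⟩
    (1ℤ + pos ∣ I ∣) * F (a ℕ.+ (c ℕ.+ x)) + ((1ℤ + pos n) - (1ℤ + pos ∣ I ∣)) * F (c ℕ.+ x) ∎
    where
    x = dot cs I
    swap : c ℕ.+ (a ℕ.+ x) ≡ a ℕ.+ (c ℕ.+ x)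
    swap = trans (sym (ℕ.+-assoc c a x)) (trans (cong (ℕ._+ x) (ℕ.+-comm c a)) (ℕ.+-assoc a c x))
    aux : ∀ A B s n → A + (s * A + (n - s) * B) ≡ (1ℤ + s) * A + ((1ℤ + n) - (1ℤ + s)) * B
    aux = solve-∀
  ∑-increase {suc n} a (c ∷ cs) (false ∷ I) F = begin
    F x + ∑Fin (λ j → F (dot (increase cs j a) I))
      ≡⟨ cong (F x +_) (∑-increase a cs I F) ⟩
    F x + (pos ∣ I ∣ * F (a ℕ.+ x) + (pos n - pos ∣ I ∣) * F x)
      ≡⟨ aux (F (a ℕ.+ x)) (F x) (pos ∣ I ∣) (pos n) ⟩
    pos ∣ I ∣ * F (a ℕ.+ x) + ((1ℤ + pos n) - pos ∣ I ∣) * F x ∎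
    where
    x = dot cs I
    aux : ∀ A B s n → B + (s * A + (n - s) * B) ≡ s * A + ((1ℤ + n) - s) * B
    aux = solve-∀

  -- The product of u - s + j over 1 ≤ j ≤ d + 1.
  P : ℕ → ℤ → ℤ → ℤ
  P zero    s u = u - s + 1ℤ
  P (suc d) s u = (u - s + pos (suc (suc d))) * P d s u

  -- The extra factor sits at the lower end of the product, where the definition of `P` does not
  -- expose it; hence the induction.
  P-suc : ∀ d s u → P (suc d) (1ℤ + s) u ≡ (u - s) * P d s u
  P-suc zero s u = aux s u
    where
    aux : ∀ s u → (u - (1ℤ + s) + pos 2) * (u - (1ℤ + s) + 1ℤ) ≡ (u - s) * (u - s + 1ℤ)
    aux = solve-∀
  P-suc (suc d) s u = begin
    (u - (1ℤ + s) + pos (suc (suc (suc d)))) * P (suc d) (1ℤ + s) u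
      ≡⟨ cong₂ (λ x y → (u - (1ℤ + s) + x) * y) (pos-+ 1 (suc (suc d))) (P-suc d s u) ⟩
    (u - (1ℤ + s) + (1ℤ + pos (suc (suc d)))) * ((u - s) * P d s u)
      ≡⟨ aux s u (pos (suc (suc d))) (P d s u) ⟩
    (u - s) * ((u - s + pos (suc (suc d))) * P d s u) ∎
    where
    aux : ∀ s u m p → (u - (1ℤ + s) + (1ℤ + m)) * ((u - s) * p) ≡ (u - s) * ((u - s + m) * p)
    aux = solve-∀

  P-shift : ∀ d s u → P d (1ℤ + s) (1ℤ + u) ≡ P d s u
  P-shift zero s u = aux s u
    where
    aux : ∀ s u → (1ℤ + u) - (1ℤ + s) + 1ℤ ≡ u - s + 1ℤ
    aux = solve-∀
  P-shift (suc d) s u = cong₂ _*_ (aux s u (pos (suc (suc d)))) (P-shift d s u)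
    where
    aux : ∀ s u m → (1ℤ + u) - (1ℤ + s) + m ≡ u - s + m
    aux = solve-∀

  -- The share of the bound xₙ₋₁ + xₙ ≤ 1 in the exponent of the term of I.
  φ : ∀ {d} → Subset (d ℕ.+ 2) → ℕ
  φ {zero}  (false ∷ false ∷ []) = 0
  φ {zero}  (false ∷ true  ∷ []) = 1
  φ {zero}  (true  ∷ _     ∷ []) = 1
  φ {suc d} (_ ∷ I)              = φ {d} I

  -- A sign for each of the first d elements in I, times the coefficients 1, -(t + 2), t + 1 that
  -- come from the last two coordinates. S₂ and S₃ treat n - 1 and n differently, and so -(t + 2) is
  -- divided into -(t + 1) for n - 1 and -1 for n; the lattice side only sees the sum.
  coef : ℤ → ∀ {d} → Subset (d ℕ.+ 2) → ℤ
  coef t {zero}  (false ∷ false ∷ []) = 1ℤ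
  coef t {zero}  (false ∷ true  ∷ []) = -1ℤ
  coef t {zero}  (true  ∷ false ∷ []) = - (1ℤ + t)
  coef t {zero}  (true  ∷ true  ∷ []) = 1ℤ + t
  coef t {suc d} (false ∷ I)          = coef t {d} I
  coef t {suc d} (true  ∷ I)          = - coef t {d} I

  module _ (t : ℤ) where

    -- For padded c and r = 0 this is the sum of the alternating counts times t^m, before the
    -- exceptions. For the same m, the triples of S₃ and S₄ have one cycle less, which accounts for
    -- the factor t.
    combined : ∀ {d} → Vec ℕ (d ℕ.+ 2) → ℕ → Series
    combined {d} c r K =
      total rule₁ t {d} c r K + total rule₂ t {d} c r K - t * (total rule₃ t {d} c r K + total rule₄ t {d} c r K)

    private
      body : ∀ {d} → ℕ → Subset (d ℕ.+ 2) → Series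
      body {d} r I K = (t * pos K) ^ r * (coef t {d} I * P d (pos ∣ I ∣) (t * pos K))

    expansion : ∀ {d} → Vec ℕ (d ℕ.+ 2) → ℕ → Subset (d ℕ.+ 2) → Series
    expansion {d} c r I = sh (φ {d} I ℕ.+ dot c I) (body {d} r I)

    private
      -- All four rules are `lt` on cycles that avoid the last two elements, so one recursion holds
      -- for the whole combination.
      combined-suc : ∀ {d} a (c : Vec ℕ (d ℕ.+ 2)) r K → combined {suc d} (a ∷ c) r K ≡
                     op (lt a) (combined c (suc r)) K + ∑Fin (λ j → combined (increase c j a) r K)
      combined-suc {d} a c r K = begin
        combined {suc d} (a ∷ c) r K
          ≡⟨ cong₂ (λ x y → x - t * y)
               (cong₂ _+_ (total-suc rule₁ t {d} a c r K) (total-suc rule₂ t {d} a c r K))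
               (cong₂ _+_ (total-suc rule₃ t {d} a c r K) (total-suc rule₄ t {d} a c r K)) ⟩
        (T 1 + ∑Fin U₁) + (T 2 + ∑Fin U₂) - t * ((T 3 + ∑Fin U₃) + (T 4 + ∑Fin U₄))
          ≡⟨ regroup (T 1) (T 2) (T 3) (T 4) (∑Fin U₁) (∑Fin U₂) (∑Fin U₃) (∑Fin U₄) t ⟩
        (T 1 + T 2 - t * (T 3 + T 4)) + (∑Fin U₁ + ∑Fin U₂ - t * (∑Fin U₃ + ∑Fin U₄))
          ≡⟨ cong₂ _+_ (sym opSide) (sym sumSide) ⟩
        op (lt a) (combined c (suc r)) K + ∑Fin (λ j → combined (increase c j a) r K) ∎
        where
        rule : ℕ → Rule
        rule 1 = rule₁
        rule 2 = rule₂
        rule 3 = rule₃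
        rule _ = rule₄
        O = op-isOperator (lt a)
        V : ℕ → Series
        V i = total (rule i) t {d} c (suc r)
        T : ℕ → ℤ
        T i = op (lt a) (V i) K
        U₁ = λ j → total rule₁ t {d} (increase c j a) r K
        U₂ = λ j → total rule₂ t {d} (increase c j a) r K
        U₃ = λ j → total rule₃ t {d} (increase c j a) r K
        U₄ = λ j → total rule₄ t {d} (increase c j a) r K
        regroup : ∀ a b c d x y z w t →
                  (a + x) + (b + y) - t * ((c + z) + (d + w)) ≡ (a + b - t * (c + d)) + (x + y - t * (z + w))
        regroup = solve-∀
        minus-neg : ∀ t x y → x - t * y ≡ x + - t * y
        minus-neg = solve-∀
        opSide : op (lt a) (combined c (suc r)) K ≡ T 1 + T 2 - t * (T 3 + T 4)
        opSide = begin
          op (lt a) (combined c (suc r)) K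
            ≡⟨ minus O (λ K → V 1 K + V 2 K) (λ K → t * (V 3 K + V 4 K)) K ⟩
          op (lt a) (λ K → V 1 K + V 2 K) K - op (lt a) (λ K → t * (V 3 K + V 4 K)) K
            ≡⟨ cong₂ _-_ (plus O (V 1) (V 2) K) (trans (scale O t (λ K → V 3 K + V 4 K) K) (cong (t *_) (plus O (V 3) (V 4) K))) ⟩
          T 1 + T 2 - t * (T 3 + T 4) ∎
        sumSide : ∑Fin (λ j → combined (increase c j a) r K) ≡ ∑Fin U₁ + ∑Fin U₂ - t * (∑Fin U₃ + ∑Fin U₄)
        sumSide = begin
          ∑Fin (λ j → combined (increase c j a) r K)
            ≡⟨ ∑Fin-cong (λ j → minus-neg t (U₁ j + U₂ j) (U₃ j + U₄ j)) ⟩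
          ∑Fin (λ j → (U₁ j + U₂ j) + - t * (U₃ j + U₄ j))
            ≡⟨ ∑Fin-+ (λ j → U₁ j + U₂ j) (λ j → - t * (U₃ j + U₄ j)) ⟩
          ∑Fin (λ j → U₁ j + U₂ j) + ∑Fin (λ j → - t * (U₃ j + U₄ j))
            ≡⟨ cong₂ _+_ (∑Fin-+ U₁ U₂) (trans (∑Fin-* (- t) (λ j → U₃ j + U₄ j)) (cong (- t *_) (∑Fin-+ U₃ U₄))) ⟩
          (∑Fin U₁ + ∑Fin U₂) + - t * (∑Fin U₃ + ∑Fin U₄)
            ≡⟨ minus-neg t (∑Fin U₁ + ∑Fin U₂) (∑Fin U₃ + ∑Fin U₄) ⟨
          ∑Fin U₁ + ∑Fin U₂ - t * (∑Fin U₃ + ∑Fin U₄) ∎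

      -- The sign changes and P gains the factor u - |I| with u = t K; the part with u raises r by
      -- one, the part with |I| does not.
      expansion-in : ∀ {d} a (c : Vec ℕ (d ℕ.+ 2)) r I K → expansion {suc d} (a ∷ c) r (true ∷ I) K ≡
                     pos ∣ I ∣ * sh a (expansion {d} c r I) K - sh a (expansion {d} c (suc r) I) K
      expansion-in {d} a c r I K = begin
        sh (φ {d} I ℕ.+ (a ℕ.+ dot c I)) B K
          ≡⟨ cong (λ e → sh e B K) (trans (sym (ℕ.+-assoc (φ {d} I) a _)) (trans (cong (ℕ._+ dot c I) (ℕ.+-comm (φ {d} I) a)) (ℕ.+-assoc a _ _))) ⟩
        sh (a ℕ.+ e) B K
          ≡⟨ sh-sh a e B K ⟨
        sh a (sh e B) K
          ≡⟨ sh-cong a (sh-cong e (λ K → trans (cong (λ p → (t * pos K) ^ r * (- coef t {d} I * p)) (P-suc d (pos ∣ I ∣) (t * pos K)))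
               (aux ((t * pos K) ^ r) (t * pos K) (coef t {d} I) (P d (pos ∣ I ∣) (t * pos K)) (pos ∣ I ∣)))) K ⟩
        sh a (sh e (λ K → pos ∣ I ∣ * body {d} r I K - body {d} (suc r) I K)) K
          ≡⟨ sh-cong a (λ K → trans (minus (sh-isOperator e) (λ K → pos ∣ I ∣ * body {d} r I K) (body {d} (suc r) I) K)
               (cong (_- E (suc r) K) (sh-scale e (pos ∣ I ∣) (body {d} r I) K))) K ⟩
        sh a (λ K → pos ∣ I ∣ * E r K - E (suc r) K) K
          ≡⟨ minus (sh-isOperator a) (λ K → pos ∣ I ∣ * E r K) (E (suc r)) K ⟩
        sh a (λ K → pos ∣ I ∣ * E r K) K - sh a (E (suc r)) K
          ≡⟨ cong (_- sh a (E (suc r)) K) (sh-scale a (pos ∣ I ∣) (E r) K) ⟩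
        pos ∣ I ∣ * sh a (E r) K - sh a (E (suc r)) K ∎
        where
        B = body {suc d} r (true ∷ I)
        E : ℕ → Series
        E r = expansion {d} c r I
        e = φ {d} I ℕ.+ dot c I
        aux : ∀ x u c p s → x * (- c * ((u - s) * p)) ≡ s * (x * (c * p)) - (u * x) * (c * p)
        aux = solve-∀

      -- Here P gains the factor u - |I| + d + 2, and again the part with u raises r.
      expansion-out : ∀ {d} a (c : Vec ℕ (d ℕ.+ 2)) r I K → expansion {suc d} (a ∷ c) r (false ∷ I) K ≡
                      expansion {d} c (suc r) I K + (pos (d ℕ.+ 2) - pos ∣ I ∣) * expansion {d} c r I K
      expansion-out {d} a c r I K = begin
        sh e (body {suc d} r (false ∷ I)) K
          ≡⟨ sh-cong e (λ K → trans (cong (λ m → (t * pos K) ^ r * (coef t {d} I * ((t * pos K - pos ∣ I ∣ + pos m) * P d (pos ∣ I ∣) (t * pos K)))) (ℕ.+-comm 2 d))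
               (aux ((t * pos K) ^ r) (t * pos K) (coef t {d} I) (P d (pos ∣ I ∣) (t * pos K)) (pos ∣ I ∣) (pos (d ℕ.+ 2)))) K ⟩
        sh e (λ K → body {d} (suc r) I K + (pos (d ℕ.+ 2) - pos ∣ I ∣) * body {d} r I K) K
          ≡⟨ sh-plus e (body {d} (suc r) I) (λ K → (pos (d ℕ.+ 2) - pos ∣ I ∣) * body {d} r I K) K ⟩
        expansion {d} c (suc r) I K + sh e (λ K → (pos (d ℕ.+ 2) - pos ∣ I ∣) * body {d} r I K) K
          ≡⟨ cong (expansion {d} c (suc r) I K +_) (sh-scale e (pos (d ℕ.+ 2) - pos ∣ I ∣) (body {d} r I) K) ⟩
        expansion {d} c (suc r) I K + (pos (d ℕ.+ 2) - pos ∣ I ∣) * expansion {d} c r I K ∎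
        where
        e = φ {d} I ℕ.+ dot c I
        aux : ∀ x u c p s n → x * (c * ((u - s + n) * p)) ≡ (u * x) * (c * p) + (n - s) * (x * (c * p))
        aux = solve-∀

      ∑-expansion-increase : ∀ {d} a (c : Vec ℕ (d ℕ.+ 2)) r I K →
        ∑Fin (λ j → expansion {d} (increase c j a) r I K) ≡
        pos ∣ I ∣ * sh a (expansion {d} c r I) K + (pos (d ℕ.+ 2) - pos ∣ I ∣) * expansion {d} c r I K
      ∑-expansion-increase {d} a c r I K = trans
        (∑-increase a c I (λ x → sh (φ {d} I ℕ.+ x) (body {d} r I) K))
        (cong (λ x → pos ∣ I ∣ * x + (pos (d ℕ.+ 2) - pos ∣ I ∣) * expansion {d} c r I K) (begin
          sh (φ {d} I ℕ.+ (a ℕ.+ dot c I)) (body {d} r I) K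
            ≡⟨ cong (λ e → sh e (body {d} r I) K) (trans (sym (ℕ.+-assoc (φ {d} I) a _)) (trans (cong (ℕ._+ dot c I) (ℕ.+-comm (φ {d} I) a)) (ℕ.+-assoc a _ _))) ⟩
          sh (a ℕ.+ (φ {d} I ℕ.+ dot c I)) (body {d} r I) K
            ≡⟨ sh-sh a (φ {d} I ℕ.+ dot c I) (body {d} r I) K ⟨
          sh a (expansion {d} c r I) K ∎))

      -- The product term W stems from the two separate bounds in S₁ and is cancelled by S₂. The
      -- exponents that remain are e₁ + 1, e₂ + 1 and e₁ + e₂ + 1: the last two elements share a
      -- single 1, as in `φ`.
      combined-zero : ∀ c r K → combined {0} c r K ≡ ∑ (subsets 2) (λ I → expansion {0} c r I K)
      combined-zero (e₁ ∷ e₂ ∷ []) r K = begin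
        combined {0} (e₁ ∷ e₂ ∷ []) r K
          ≡⟨ cong₂ (λ x y → x - t * y) (cong₂ _+_ total₁ total₂) (cong₂ _+_ total₃ total₄) ⟩
        ((A′ K - x₂ - (x₁ - W)) + (A K - y)) + ((y′ - W) + (A K - A K))
          - t * (((x₁ - y′) + (A K - A K)) + (((A′ K - A′ K) - (A′ K - A′ K)) + y))
          ≡⟨ collect (A′ K) x₂ x₁ W (A K) y y′ t ⟩
        (1ℤ + t) * (y′ - y) + (- (1ℤ + t) * x₁ + (-1ℤ * x₂ + ((A′ K + A K) + 0ℤ)))
          ≡⟨ cong₂ _+_ both (cong₂ _+_ first (cong₂ _+_ second (cong (_+ 0ℤ) neither))) ⟨
        ∑ (subsets 2) (λ I → expansion {0} (e₁ ∷ e₂ ∷ []) r I K) ∎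
        where
        A A′ : Series
        A  = ψ t (suc r)
        A′ = ψ t (suc (suc r))
        x₁ x₂ y y′ W : ℤ
        x₁ = sh (suc e₁) A′ K
        x₂ = sh (suc e₂) A′ K
        y  = sh (suc (e₁ ℕ.+ e₂)) A K
        y′ = sh (suc (e₁ ℕ.+ e₂)) A′ K
        W  = sh (suc e₁) (sh (suc e₂) A′) K
        O₁ = sh-isOperator (suc e₁)
        total₁ : total rule₁ t {0} (e₁ ∷ e₂ ∷ []) r K ≡ (A′ K - x₂ - (x₁ - W)) + (A K - y)
        total₁ = trans (total-zero rule₁ t e₁ e₂ r K) (cong (λ z → (A′ K - x₂ - z) + (A K - y)) (minus O₁ A′ (sh (suc e₂) A′) K))
        total₂ : total rule₂ t {0} (e₁ ∷ e₂ ∷ []) r K ≡ (y′ - W) + (A K - A K)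
        total₂ = trans (total-zero rule₂ t e₁ e₂ r K) (cong (_+ (A K - A K))
          (trans (minus O₁ (sh e₂ A′) (sh (suc e₂) A′) K) (cong (_- W) (sh-sh (suc e₁) e₂ A′ K))))
        total₃ : total rule₃ t {0} (e₁ ∷ e₂ ∷ []) r K ≡ (x₁ - y′) + (A K - A K)
        total₃ = trans (total-zero rule₃ t e₁ e₂ r K) (cong (_+ (A K - A K))
          (trans (minus O₁ A′ (sh e₂ A′) K) (cong (λ z → x₁ - z) (sh-sh (suc e₁) e₂ A′ K))))
        total₄ : total rule₄ t {0} (e₁ ∷ e₂ ∷ []) r K ≡ ((A′ K - A′ K) - (A′ K - A′ K)) + y
        total₄ = total-zero rule₄ t e₁ e₂ r K
        collect : ∀ a′ x₂ x₁ w a y y′ t →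
          ((a′ - x₂ - (x₁ - w)) + (a - y)) + ((y′ - w) + (a - a)) - t * (((x₁ - y′) + (a - a)) + (((a′ - a′) - (a′ - a′)) + y))
          ≡ (1ℤ + t) * (y′ - y) + (- (1ℤ + t) * x₁ + (-1ℤ * x₂ + ((a′ + a) + 0ℤ)))
        collect = solve-∀
        monomial : ∀ {b b′} (I : Subset 2) a (f : Series) → b ≡ b′ → (∀ K → body {0} r I K ≡ a * f K) →
                   sh b (body {0} r I) K ≡ a * sh b′ f K
        monomial {b} I a f refl h = trans (sh-cong b h K) (sh-scale b a f K)
        both : expansion {0} (e₁ ∷ e₂ ∷ []) r (true ∷ true ∷ []) K ≡ (1ℤ + t) * (y′ - y)
        both = trans
          (monomial (true ∷ true ∷ []) (1ℤ + t) (λ K → A′ K - A K) (cong (λ e → suc (e₁ ℕ.+ e)) (ℕ.+-identityʳ e₂)) λ K → aux ((t * pos K) ^ r) (t * pos K) t)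
          (cong ((1ℤ + t) *_) (minus (sh-isOperator (suc (e₁ ℕ.+ e₂))) A′ A K))
          where
          aux : ∀ x u t → x * ((1ℤ + t) * (u - pos 2 + 1ℤ)) ≡ (1ℤ + t) * (u * x - x)
          aux = solve-∀
        first : expansion {0} (e₁ ∷ e₂ ∷ []) r (true ∷ false ∷ []) K ≡ - (1ℤ + t) * x₁
        first = monomial (true ∷ false ∷ []) (- (1ℤ + t)) A′ (cong suc (ℕ.+-identityʳ e₁)) λ K → aux ((t * pos K) ^ r) (t * pos K) t
          where
          aux : ∀ x u t → x * (- (1ℤ + t) * (u - pos 1 + 1ℤ)) ≡ - (1ℤ + t) * (u * x)
          aux = solve-∀
        second : expansion {0} (e₁ ∷ e₂ ∷ []) r (false ∷ true ∷ []) K ≡ -1ℤ * x₂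
        second = monomial (false ∷ true ∷ []) -1ℤ A′ (cong suc (ℕ.+-identityʳ e₂)) λ K → aux ((t * pos K) ^ r) (t * pos K)
          where
          aux : ∀ x u → x * (-1ℤ * (u - pos 1 + 1ℤ)) ≡ -1ℤ * (u * x)
          aux = solve-∀
        neither : expansion {0} (e₁ ∷ e₂ ∷ []) r (false ∷ false ∷ []) K ≡ A′ K + A K
        neither = aux ((t * pos K) ^ r) (t * pos K)
          where
          aux : ∀ x u → x * (1ℤ * (u - pos 0 + 1ℤ)) ≡ u * x + x
          aux = solve-∀

    -- Applied to the term of I, the recursion of `combined` yields the terms of I and of I with 0
    -- adjoined, in the form given by `expansion-out` and `expansion-in`.
    combined-expansion : ∀ {d} (c : Vec ℕ (d ℕ.+ 2)) r K →
                         combined c r K ≡ ∑ (subsets (d ℕ.+ 2)) (λ I → expansion {d} c r I K)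
    combined-expansion {zero}  c       r K = combined-zero c r K
    combined-expansion {suc d} (a ∷ c) r K = begin
      combined {suc d} (a ∷ c) r K
        ≡⟨ combined-suc {d} a c r K ⟩
      op (lt a) (combined c (suc r)) K + ∑Fin (λ j → combined (increase c j a) r K)
        ≡⟨ cong₂ _+_ (cong-≗ O (combined-expansion c (suc r)) K) (∑Fin-cong (λ j → combined-expansion (increase c j a) r K)) ⟩
      op (lt a) (λ K → ∑ Is (λ I → expansion {d} c (suc r) I K)) K + ∑Fin (λ j → ∑ Is (λ I → expansion {d} (increase c j a) r I K))
        ≡⟨ cong₂ _+_ (∑-comm O Is (expansion {d} c (suc r)) K) (∑Fin-∑ Is (λ j I → expansion {d} (increase c j a) r I K)) ⟩
      ∑ Is (λ I → op (lt a) (expansion {d} c (suc r) I) K) + ∑ Is (λ I → ∑Fin (λ j → expansion {d} (increase c j a) r I K))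
        ≡⟨ ∑-+ Is (λ I → op (lt a) (expansion {d} c (suc r) I) K) (λ I → ∑Fin (λ j → expansion {d} (increase c j a) r I K)) ⟨
      ∑ Is (λ I → op (lt a) (expansion {d} c (suc r) I) K + ∑Fin (λ j → expansion {d} (increase c j a) r I K))
        ≡⟨ ∑-cong Is each ⟩
      ∑ Is (λ I → expansion {suc d} (a ∷ c) r (true ∷ I) K + expansion {suc d} (a ∷ c) r (false ∷ I) K)
        ≡⟨ ∑-subsets (d ℕ.+ 2) (λ I → expansion {suc d} (a ∷ c) r I K) ⟨
      ∑ (subsets (suc d ℕ.+ 2)) (λ I → expansion {suc d} (a ∷ c) r I K) ∎
      where
      O  = op-isOperator (lt a)
      Is = subsets (d ℕ.+ 2)
      aux : ∀ f f′ s g′ m g → (f - f′) + (s * g′ + m * g) ≡ (s * g′ - f′) + (f + m * g)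
      aux = solve-∀
      each : ∀ I → op (lt a) (expansion {d} c (suc r) I) K + ∑Fin (λ j → expansion {d} (increase c j a) r I K)
                 ≡ expansion {suc d} (a ∷ c) r (true ∷ I) K + expansion {suc d} (a ∷ c) r (false ∷ I) K
      each I = begin
        op (lt a) F K + ∑Fin (λ j → expansion {d} (increase c j a) r I K)
          ≡⟨ cong (op (lt a) F K +_) (∑-expansion-increase {d} a c r I K) ⟩
        (F K - sh a F K) + (pos ∣ I ∣ * sh a G K + (pos (d ℕ.+ 2) - pos ∣ I ∣) * G K)
          ≡⟨ aux (F K) (sh a F K) (pos ∣ I ∣) (sh a G K) (pos (d ℕ.+ 2) - pos ∣ I ∣) (G K) ⟩
        (pos ∣ I ∣ * sh a G K - sh a F K) + (F K + (pos (d ℕ.+ 2) - pos ∣ I ∣) * G K)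
          ≡⟨ cong₂ _+_ (sym (expansion-in {d} a c r I K)) (sym (expansion-out {d} a c r I K)) ⟩
        expansion {suc d} (a ∷ c) r (true ∷ I) K + expansion {suc d} (a ∷ c) r (false ∷ I) K ∎
        where
        F = expansion {d} c (suc r) I
        G = expansion {d} c r I

-- Improperly weighted n-cycles, and inclusion-exclusion for lattice points

module LatticeSeries where

  open Sums
  open Series
  open Weights
  open Counting using (ψ)
  open Recursion
  open ClosedForm
  import Data.Bool as Bool
  open import Data.Nat using (_!; _≤_; _<_; _<ᵇ_)
  open import Data.Integer using (ℤ; 0ℤ; 1ℤ; -1ℤ; _+_; _*_; _-_; -_) renaming (+_ to pos)
  open import Data.Integer.Properties using (*-zeroˡ; *-zeroʳ; *-identityˡ; +-identityˡ; +-identityʳ; pos-+; pos-*; *-assoc)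
  open import Data.Fin.Subset using (∣_∣)
  open import Data.List.Properties using (length-map)
  open import Data.Vec using (_++_; sum)
  open ≡-Reasoning

  open IsOperator

  private
    sum-increase : ∀ {n} a (c : Vec ℕ n) j → sum (increase c j a) ≡ a ℕ.+ sum c
    sum-increase a (c ∷ cs) zero    = ℕ.+-assoc a c (sum cs)
    sum-increase a (c ∷ cs) (suc j) = begin
      c ℕ.+ sum (increase cs j a)  ≡⟨ cong (c ℕ.+_) (sum-increase a cs j) ⟩
      c ℕ.+ (a ℕ.+ sum cs)         ≡⟨ ℕ.+-assoc c a _ ⟨
      (c ℕ.+ a) ℕ.+ sum cs         ≡⟨ cong (ℕ._+ sum cs) (ℕ.+-comm c a) ⟩
      (a ℕ.+ c) ℕ.+ sum cs         ≡⟨ ℕ.+-assoc a c _ ⟩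
      a ℕ.+ (c ℕ.+ sum cs)         ∎

    ∑Fin-const : ∀ n x → ∑Fin {n} (λ _ → x) ≡ pos n * x
    ∑Fin-const zero    x = sym (*-zeroˡ x)
    ∑Fin-const (suc n) x = trans (cong (x +_) (∑Fin-const n x)) (aux x (pos n))
      where
      aux : ∀ x n → x + n * x ≡ (1ℤ + n) * x
      aux = solve-∀

  -- At t = 0 only the permutations with a single cycle contribute.
  total-rule₄ : ∀ {d} (c : Vec ℕ (d ℕ.+ 2)) K →
                total rule₄ 0ℤ {d} c 0 K ≡ sh (suc (sum c)) (λ _ → pos (suc d !)) K
  total-rule₄-suc : ∀ {d} (c : Vec ℕ (d ℕ.+ 2)) r K → total rule₄ 0ℤ {d} c (suc r) K ≡ 0ℤ

  total-rule₄ {zero} (e₁ ∷ e₂ ∷ []) K = begin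
    total rule₄ 0ℤ {0} (e₁ ∷ e₂ ∷ []) 0 K
      ≡⟨ total-zero rule₄ 0ℤ e₁ e₂ 0 K ⟩
    ((X - X) - (X - X)) + sh (suc (e₁ ℕ.+ e₂)) (ψ 0ℤ 1) K
      ≡⟨ cancel X _ ⟩
    sh (suc (e₁ ℕ.+ e₂)) (ψ 0ℤ 1) K
      ≡⟨ cong (λ e → sh (suc (e₁ ℕ.+ e)) (λ _ → 1ℤ) K) (ℕ.+-identityʳ e₂) ⟨
    sh (suc (e₁ ℕ.+ (e₂ ℕ.+ 0))) (λ _ → 1ℤ) K ∎
    where
    X = ψ 0ℤ 2 K
    cancel : ∀ x y → ((x - x) - (x - x)) + y ≡ y
    cancel = solve-∀
  total-rule₄ {suc d} (a ∷ c) K = begin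
    total rule₄ 0ℤ {suc d} (a ∷ c) 0 K
      ≡⟨ total-suc rule₄ 0ℤ {d} a c 0 K ⟩
    op (lt a) (total rule₄ 0ℤ c 1) K + ∑Fin (λ j → total rule₄ 0ℤ (increase c j a) 0 K)
      ≡⟨ cong₂ _+_ (trans (cong-≗ (op-isOperator (lt a)) (total-rule₄-suc {d} c 0) K) (zero-≗ (op-isOperator (lt a)) K))
           (∑Fin-cong (λ j → trans (total-rule₄ {d} (increase c j a) K) (cong (λ e → sh (suc e) F K) (sum-increase a c j)))) ⟩
    0ℤ + ∑Fin {d ℕ.+ 2} (λ _ → sh e F K)
      ≡⟨ +-identityˡ _ ⟩
    ∑Fin {d ℕ.+ 2} (λ _ → sh e F K)
      ≡⟨ ∑Fin-const (d ℕ.+ 2) _ ⟩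
    pos (d ℕ.+ 2) * sh e F K
      ≡⟨ cong (λ n → pos n * sh e F K) (ℕ.+-comm d 2) ⟩
    pos (2 ℕ.+ d) * sh e F K
      ≡⟨ sh-scale e (pos (2 ℕ.+ d)) F K ⟨
    sh e (λ K → pos (2 ℕ.+ d) * F K) K
      ≡⟨ sh-cong e (λ _ → sym (pos-* (2 ℕ.+ d) (suc d !))) K ⟩
    sh e (λ _ → pos (suc (suc d) !)) K ∎
    where
    F : Series
    F _ = pos (suc d !)
    e = suc (a ℕ.+ sum c)

  total-rule₄-suc {zero} (e₁ ∷ e₂ ∷ []) r K = begin
    total rule₄ 0ℤ {0} (e₁ ∷ e₂ ∷ []) (suc r) K
      ≡⟨ total-zero rule₄ 0ℤ e₁ e₂ (suc r) K ⟩
    ((X - X) - (X - X)) + sh (suc (e₁ ℕ.+ e₂)) (ψ 0ℤ (suc (suc r))) K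
      ≡⟨ cancel X _ ⟩
    sh (suc (e₁ ℕ.+ e₂)) (ψ 0ℤ (suc (suc r))) K
      ≡⟨ sh-cong (suc (e₁ ℕ.+ e₂)) (λ K → trans (cong (_* ψ 0ℤ (suc r) K) (*-zeroˡ (pos K))) (*-zeroˡ (ψ 0ℤ (suc r) K))) K ⟩
    sh (suc (e₁ ℕ.+ e₂)) (λ _ → 0ℤ) K
      ≡⟨ zero-≗ (sh-isOperator (suc (e₁ ℕ.+ e₂))) K ⟩
    0ℤ ∎
    where
    X = ψ 0ℤ (suc (suc (suc r))) K
    cancel : ∀ x y → ((x - x) - (x - x)) + y ≡ y
    cancel = solve-∀
  total-rule₄-suc {suc d} (a ∷ c) r K = begin
    total rule₄ 0ℤ {suc d} (a ∷ c) (suc r) K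
      ≡⟨ total-suc rule₄ 0ℤ {d} a c (suc r) K ⟩
    op (lt a) (total rule₄ 0ℤ c (suc (suc r))) K + ∑Fin (λ j → total rule₄ 0ℤ (increase c j a) (suc r) K)
      ≡⟨ cong₂ _+_ (trans (cong-≗ (op-isOperator (lt a)) (total-rule₄-suc {d} c (suc r)) K) (zero-≗ (op-isOperator (lt a)) K))
           (trans (∑Fin-cong (λ j → total-rule₄-suc {d} (increase c j a) r K)) (∑Fin-zero (d ℕ.+ 2))) ⟩
    0ℤ ∎

  -- In the base case the last two coordinates make up the whole remaining sum N, so their bound x +
  -- y ≤ t is a test on N.
  points : ℕ → ∀ {d} → Vec ℕ d → ℕ → List (Vec ℕ (d ℕ.+ 2))
  points t []       N = if N <ᵇ suc t then weightings (ge 0 ∷ ge 0 ∷ []) N else []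
  points t (c ∷ cs) N = List.map (uncurry _∷_) (pairs (sem (lt (suc (t ℕ.* c)))) (points t cs) N)

  private
    -- The coefficients of (d + 1)! / (1 - x)^(d+2).
    Q : ℕ → Series
    Q d N = P d 0ℤ (pos N)

    -- The hockey-stick identity for binomial coefficients, multiplied by factorials to stay in ℤ.
    S-Q : ∀ d N → pos (2 ℕ.+ d) * S (Q d) N ≡ Q (suc d) N
    S-Q d zero    = cong (_* Q d 0) (sym (+-identityˡ (pos (2 ℕ.+ d))))
    S-Q d (suc N) = begin
      m * (Q d (suc N) + S (Q d) N)          ≡⟨ distrib m (Q d (suc N)) (S (Q d) N) ⟩
      m * Q d (suc N) + m * S (Q d) N        ≡⟨ cong (m * Q d (suc N) +_) (S-Q d N) ⟩
      m * Q d (suc N) + Q (suc d) N          ≡⟨ cong (m * Q d (suc N) +_) prev ⟩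
      m * Q d (suc N) + (u - 0ℤ) * Q d (suc N) ≡⟨ collect m u (Q d (suc N)) ⟩
      (u - 0ℤ + m) * Q d (suc N)             ∎
      where
      m = pos (2 ℕ.+ d)
      u = pos (suc N)
      prev : Q (suc d) N ≡ (u - 0ℤ) * Q d (suc N)
      prev = trans (sym (P-shift (suc d) 0ℤ (pos N))) (trans (cong (P (suc d) 1ℤ) (sym (pos-+ 1 N))) (P-suc d 0ℤ u))
      distrib : ∀ m a b → m * (a + b) ≡ m * a + m * b
      distrib = solve-∀
      collect : ∀ m u q → m * q + (u - 0ℤ) * q ≡ (u - 0ℤ + m) * q
      collect = solve-∀

  -- The entries of n - 1 and n are 0, for these elements do not enter the sums of the cᵢ; their
  -- bound 1 is accounted for by `φ`.
  padded : ∀ {d} → Vec ℕ d → Vec ℕ (d ℕ.+ 2)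
  padded c = c ++ 0 ∷ 0 ∷ []

  -- The bound of coordinate i is exceeded from t cᵢ + 1 on: in the exponent the parts t cᵢ add up
  -- to a multiple of t, the ones to |I|.
  latticeTerm : ℕ → ∀ {d} → Vec ℕ d → Subset (d ℕ.+ 2) → Series
  latticeTerm t {d} c I N = coef (pos t) {d} I * sh (t ℕ.* (φ {d} I ℕ.+ dot (padded c) I) ℕ.+ ∣ I ∣) (Q d) N

  private
    Q₀-ones : ∀ N → pos (length (weightings (ge 0 ∷ ge 0 ∷ []) N)) ≡ Q 0 N
    Q₀-ones N = trans (length-weightings (ge 0 ∷ ge 0 ∷ []) N) (trans (S-cong ones N) (S-ones N))
      where
      ones : ∀ K → S δ K ≡ 1ℤ
      ones zero    = refl
      ones (suc K) = trans (+-identityˡ _) (ones K)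
      aux : ∀ n → 1ℤ + (n - 0ℤ + 1ℤ) ≡ (1ℤ + n) - 0ℤ + 1ℤ
      aux = solve-∀
      S-ones : ∀ N → S (λ _ → 1ℤ) N ≡ Q 0 N
      S-ones zero    = refl
      S-ones (suc N) = trans (cong (1ℤ +_) (S-ones N)) (trans (aux (pos N)) (cong (λ n → n - 0ℤ + 1ℤ) (sym (pos-+ 1 N))))

    points-zero : ∀ t N → pos (length (points t [] N)) ≡ ∑ (subsets 2) (λ I → latticeTerm t {0} [] I N)
    points-zero t N with N <ᵇ suc t in eq
    -- For N ≤ t only the empty set contributes; the other exponents are at least t + 1.
    ... | true = trans (Q₀-ones N) (sym (begin
      expanded (sh (t ℕ.* 1 ℕ.+ 2) (Q 0) N) (sh (t ℕ.* 1 ℕ.+ 1) (Q 0) N) (sh (t ℕ.* 0 ℕ.+ 0) (Q 0) N)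
        ≡⟨ cong₂ (λ x y → expanded x y (sh (t ℕ.* 0 ℕ.+ 0) (Q 0) N)) (sh-< (Q 0) (below 1)) (sh-< (Q 0) (below 0)) ⟩
      expanded 0ℤ 0ℤ (sh (t ℕ.* 0 ℕ.+ 0) (Q 0) N)
        ≡⟨ aux T (sh (t ℕ.* 0 ℕ.+ 0) (Q 0) N) ⟩
      sh (t ℕ.* 0 ℕ.+ 0) (Q 0) N
        ≡⟨ cong (λ e → sh e (Q 0) N) (trans (ℕ.+-identityʳ _) (ℕ.*-zeroʳ t)) ⟩
      Q 0 N ∎))
      where
      T = pos t
      expanded : ℤ → ℤ → ℤ → ℤ
      expanded x y z = (1ℤ + T) * x + (- (1ℤ + T) * y + (-1ℤ * y + (1ℤ * z + 0ℤ)))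
      N≤t : N ≤ t
      N≤t = ℕ.<⇒≤pred (ℕ.<ᵇ⇒< N (suc t) (subst Bool.T (sym eq) _))
      below : ∀ e → N < t ℕ.* 1 ℕ.+ suc e
      below e rewrite ℕ.*-identityʳ t | ℕ.+-suc t e = s≤s (ℕ.≤-trans N≤t (ℕ.m≤m+n t e))
      aux : ∀ t x → (1ℤ + t) * 0ℤ + (- (1ℤ + t) * 0ℤ + (-1ℤ * 0ℤ + (1ℤ * x + 0ℤ))) ≡ x
      aux = solve-∀
    -- For N = t + 1 + M the terms cancel: (N + 1) - (t + 2)(M + 1) + (t + 1) M = 0.
    ... | false with M , refl ← ℕ.m≤n⇒∃[o]m+o≡n (ℕ.≮⇒≥ {N} {suc t} λ h → subst Bool.T eq (ℕ.<⇒<ᵇ {N} h)) = sym (begin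
      expanded (sh (t ℕ.* 1 ℕ.+ 2) (Q 0) N) (sh (t ℕ.* 1 ℕ.+ 1) (Q 0) N) (sh (t ℕ.* 0 ℕ.+ 0) (Q 0) N)
        ≡⟨ cong₂ (λ x y → expanded x y (sh (t ℕ.* 0 ℕ.+ 0) (Q 0) N)) two one ⟩
      expanded (pos M) (Q 0 M) (sh (t ℕ.* 0 ℕ.+ 0) (Q 0) N)
        ≡⟨ cong (λ e → expanded (pos M) (Q 0 M) (sh e (Q 0) N)) (trans (ℕ.+-identityʳ _) (ℕ.*-zeroʳ t)) ⟩
      expanded (pos M) (Q 0 M) (Q 0 N)
        ≡⟨ cong (λ n → expanded (pos M) (Q 0 M) (n - 0ℤ + 1ℤ)) (trans (pos-+ (suc t) M) (cong (_+ pos M) (pos-+ 1 t))) ⟩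
      expanded (pos M) (pos M - 0ℤ + 1ℤ) ((1ℤ + T + pos M) - 0ℤ + 1ℤ)
        ≡⟨ aux T (pos M) ⟩
      0ℤ ∎)
      where
      T = pos t
      expanded : ℤ → ℤ → ℤ → ℤ
      expanded x y z = (1ℤ + T) * x + (- (1ℤ + T) * y + (-1ℤ * y + (1ℤ * z + 0ℤ)))
      one : sh (t ℕ.* 1 ℕ.+ 1) (Q 0) N ≡ Q 0 M
      one rewrite ℕ.*-identityʳ t | ℕ.+-comm t 1 = sh-+ (suc t) (Q 0) M
      sh1 : ∀ M → sh 1 (Q 0) M ≡ pos M
      sh1 zero    = refl
      sh1 (suc M) = trans (aux₁ (pos M)) (sym (pos-+ 1 M))
        where
        aux₁ : ∀ m → m - 0ℤ + 1ℤ ≡ 1ℤ + m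
        aux₁ = solve-∀
      two : sh (t ℕ.* 1 ℕ.+ 2) (Q 0) N ≡ pos M
      two rewrite ℕ.*-identityʳ t | ℕ.+-suc t 1 = trans (sym (sh-sh (suc t) 1 (Q 0) N)) (trans (sh-+ (suc t) (sh 1 (Q 0)) M) (sh1 M))
      aux : ∀ t m → (1ℤ + t) * m + (- (1ℤ + t) * (m - 0ℤ + 1ℤ) + (-1ℤ * (m - 0ℤ + 1ℤ) + (1ℤ * ((1ℤ + t + m) - 0ℤ + 1ℤ) + 0ℤ))) ≡ 0ℤ
      aux = solve-∀

  -- Each coordinate brings a factor 1/(1 - x), which `S-Q` absorbs with the help of the factorial,
  -- and a factor 1 - x^(t c + 1), which splits the term of I in two.
  points-expansion : ∀ t {d} (c : Vec ℕ d) N →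
                     pos (suc d !) * pos (length (points t c N)) ≡ ∑ (subsets (d ℕ.+ 2)) (λ I → latticeTerm t c I N)
  points-expansion t {zero}  []       N = trans (*-identityˡ _) (points-zero t N)
  points-expansion t {suc d} (c ∷ cs) N = begin
    pos (suc (suc d) !) * pos (length (points t (c ∷ cs) N))
      ≡⟨ cong₂ _*_ (pos-* (2 ℕ.+ d) (suc d !)) lengths ⟩
    m * f * op a (S L) N
      ≡⟨ *-assoc m f _ ⟩
    m * (f * op a (S L) N)
      ≡⟨ cong (m *_) (sym (scale (op-isOperator a) f (S L) N)) ⟩
    m * op a (λ K → f * S L K) N
      ≡⟨ scale (op-isOperator a) m (λ K → f * S L K) N ⟨
    op a (λ K → m * (f * S L K)) N
      ≡⟨ cong-≗ (op-isOperator a) summed N ⟩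
    op a (λ K → ∑ Is (λ I → m * S (latticeTerm t cs I) K)) N
      ≡⟨ ∑-comm (op-isOperator a) Is (λ I K → m * S (latticeTerm t cs I) K) N ⟩
    ∑ Is (λ I → op a (λ K → m * S (latticeTerm t cs I) K) N)
      ≡⟨ ∑-cong Is each ⟩
    ∑ Is (λ I → latticeTerm t (c ∷ cs) (true ∷ I) N + latticeTerm t (c ∷ cs) (false ∷ I) N)
      ≡⟨ ∑-subsets (d ℕ.+ 2) (λ I → latticeTerm t (c ∷ cs) I N) ⟨
    ∑ (subsets (suc d ℕ.+ 2)) (λ I → latticeTerm t (c ∷ cs) I N) ∎
    where
    m = pos (2 ℕ.+ d)
    f = pos (suc d !)
    a = lt (suc (t ℕ.* c))
    Is = subsets (d ℕ.+ 2)
    L : Series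
    L N = pos (length (points t cs N))
    lengths : pos (length (points t (c ∷ cs) N)) ≡ op a (S L) N
    lengths = begin
      pos (length (List.map (uncurry _∷_) (pairs (sem a) (points t cs) N)))
        ≡⟨ cong pos (length-map (uncurry _∷_) (pairs (sem a) (points t cs) N)) ⟩
      pos (length (pairs (sem a) (points t cs) N))
        ≡⟨ length-pairs (sem a) (points t cs) N ⟩
      conv (sem a) L N
        ≡⟨ conv-sem a L N ⟩
      op a (S L) N ∎
    summed : ∀ K → m * (f * S L K) ≡ ∑ Is (λ I → m * S (latticeTerm t cs I) K)
    summed K = begin
      m * (f * S L K)                                       ≡⟨ cong (m *_) (sym (S-scale f L K)) ⟩
      m * S (λ K → f * L K) K                               ≡⟨ cong (m *_) (S-cong (points-expansion t cs) K) ⟩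
      m * S (λ K → ∑ Is (λ I → latticeTerm t cs I K)) K     ≡⟨ cong (m *_) (∑-comm S-isOperator Is (latticeTerm t cs) K) ⟩
      m * ∑ Is (λ I → S (latticeTerm t cs I) K)             ≡⟨ ∑-* m Is (λ I → S (latticeTerm t cs I) K) ⟨
      ∑ Is (λ I → m * S (latticeTerm t cs I) K)             ∎
    each : ∀ I → op a (λ K → m * S (latticeTerm t cs I) K) N ≡ latticeTerm t (c ∷ cs) (true ∷ I) N + latticeTerm t (c ∷ cs) (false ∷ I) N
    each I = begin
      op a (λ K → m * S (latticeTerm t cs I) K) N
        ≡⟨ cong-≗ (op-isOperator a) raise N ⟩
      op a (λ K → κ * sh e (Q (suc d)) K) N
        ≡⟨ scale (op-isOperator a) κ (sh e (Q (suc d))) N ⟩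
      κ * (sh e (Q (suc d)) N - sh (suc (t ℕ.* c)) (sh e (Q (suc d))) N)
        ≡⟨ cong (λ x → κ * (sh e (Q (suc d)) N - x)) (trans (sh-sh (suc (t ℕ.* c)) e (Q (suc d)) N) (cong (λ e → sh e (Q (suc d)) N) exponent)) ⟩
      κ * (sh e (Q (suc d)) N - sh e′ (Q (suc d)) N)
        ≡⟨ aux κ (sh e (Q (suc d)) N) (sh e′ (Q (suc d)) N) ⟩
      - κ * sh e′ (Q (suc d)) N + κ * sh e (Q (suc d)) N ∎
      where
      κ = coef (pos t) {d} I
      e = t ℕ.* (φ {d} I ℕ.+ dot (padded cs) I) ℕ.+ ∣ I ∣
      e′ = t ℕ.* (φ {d} I ℕ.+ (c ℕ.+ dot (padded cs) I)) ℕ.+ suc ∣ I ∣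
      exponent : suc (t ℕ.* c) ℕ.+ e ≡ e′
      exponent = solve t c (φ {d} I) (dot (padded cs) I) ∣ I ∣
        where
        import Data.Nat.Tactic.RingSolver as ℕSolver
        solve : ∀ t c p x i → suc (t ℕ.* c) ℕ.+ (t ℕ.* (p ℕ.+ x) ℕ.+ i) ≡ t ℕ.* (p ℕ.+ (c ℕ.+ x)) ℕ.+ suc i
        solve = ℕSolver.solve-∀
      aux : ∀ k x y → k * (x - y) ≡ - k * y + k * x
      aux = solve-∀
      raise : ∀ K → m * S (latticeTerm t cs I) K ≡ κ * sh e (Q (suc d)) K
      raise K = begin
        m * S (λ K → κ * sh e (Q d) K) K       ≡⟨ cong (m *_) (S-scale κ (sh e (Q d)) K) ⟩
        m * (κ * S (sh e (Q d)) K)             ≡⟨ cong (λ x → m * (κ * x)) (S-shift e (Q d) K) ⟩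
        m * (κ * sh e (S (Q d)) K)             ≡⟨ swap m κ _ ⟩
        κ * (m * sh e (S (Q d)) K)             ≡⟨ cong (κ *_) (sym (sh-scale e m (S (Q d)) K)) ⟩
        κ * sh e (λ K → m * S (Q d) K) K       ≡⟨ cong (κ *_) (sh-cong e (S-Q d) K) ⟩
        κ * sh e (Q (suc d)) K                 ∎
        where
        swap : ∀ a b c → a * (b * c) ≡ b * (a * c)
        swap = solve-∀

-- Comparing the two sums over subsets term by term

module Comparison where

  open Sums
  open Series
  open Counting using (count; triples; Admissible; admissible-cardinality; count-generating; module Perms)
  open Recursion
  open ClosedForm
  open LatticeSeries
  open import Data.Bool using (_∧_)
  open import Data.Nat using (_!; _≤_; _<_)
  open import Data.Integer as ℤ using (ℤ; 0ℤ; 1ℤ; _+_; _*_; _-_; -_) renaming (+_ to pos)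
  import Data.Integer.Properties as ℤ
  open import Data.Integer.Properties using (*-zeroˡ; *-zeroʳ; *-identityˡ; +-identityˡ; +-identityʳ; pos-+; pos-*)
  open import Data.Fin.Subset using (∣_∣)
  open import Data.Fin.Subset.Properties using (∣p∣≤n)
  open import Data.Vec using (sum)
  open import Data.Empty using (⊥)
  open import Data.List.Membership.Propositional using (_∈_)
  open ≡-Reasoning

  private
    -- The factor with j = e + 1 is 0, and it occurs because e ≤ d.
    P-vanish : ∀ d e → e ≤ d → P d (pos (suc e)) 0ℤ ≡ 0ℤ
    P-vanish zero    zero z≤n = refl
    P-vanish (suc d) e e≤ with e ℕ.≟ suc d
    ... | yes refl = trans (cong (_* P d (pos (suc (suc d))) 0ℤ) (cancel (pos (suc (suc d))))) (*-zeroˡ (P d (pos (suc (suc d))) 0ℤ))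
      where
      cancel : ∀ x → 0ℤ - x + x ≡ 0ℤ
      cancel = solve-∀
    ... | no ne = trans (cong ((0ℤ - pos (suc e) + pos (suc (suc d))) *_) (P-vanish d e (ℕ.≤-pred (ℕ.≤∧≢⇒< e≤ ne))))
                        (*-zeroʳ (0ℤ - pos (suc e) + pos (suc (suc d))))

    -- A shifted series is 0 below the shift, while a polynomial need not be. Here the product
    -- vanishes there as long as s ≤ d + 1; for s = d + 2, that is I = [n], it fails to do so at M =
    -- 0 alone.
    sh-P : ∀ d s M → s ≤ suc d → sh s (λ N → P d 0ℤ (pos N)) M ≡ P d (pos s) (pos M)
    sh-P d zero    M       _       = refl
    sh-P d (suc s) zero    (s≤s h) = sym (P-vanish d s h)
    sh-P d (suc s) (suc M) h       = begin
      sh s (λ N → P d 0ℤ (pos N)) M      ≡⟨ sh-P d s M (ℕ.≤-trans (ℕ.n≤1+n s) h) ⟩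
      P d (pos s) (pos M)                ≡⟨ P-shift d (pos s) (pos M) ⟨
      P d (1ℤ + pos s) (1ℤ + pos M)      ≡⟨ cong₂ (P d) (sym (pos-+ 1 s)) (sym (pos-+ 1 M)) ⟩
      P d (pos (suc s)) (pos (suc M))    ∎

    full : ∀ {n} → Subset n → Bool
    full []      = true
    full (b ∷ I) = b ∧ full I

    ∑-full : ∀ n x → ∑ (subsets n) (λ I → if full I then x else 0ℤ) ≡ x
    ∑-full zero    x = +-identityʳ x
    ∑-full (suc n) x = trans (∑-subsets n (λ I → if full I then x else 0ℤ))
      (trans (∑-cong (subsets n) (λ I → +-identityʳ _)) (∑-full n x))

    full-∣∣ : ∀ {n} (I : Subset n) → full I ≡ true → ∣ I ∣ ≡ n
    full-∣∣ []         h = refl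
    full-∣∣ (true ∷ I) h = cong suc (full-∣∣ I h)

    full-dot : ∀ {n} (c : Vec ℕ n) I → full I ≡ true → dot c I ≡ sum c
    full-dot []      []         h = refl
    full-dot (c ∷ cs) (true ∷ I) h = cong (c ℕ.+_) (full-dot cs I h)

    full-φ : ∀ {d} (I : Subset (d ℕ.+ 2)) → full I ≡ true → φ {d} I ≡ 1
    full-φ {zero}  (true ∷ true ∷ []) h = refl
    full-φ {suc d} (true ∷ I)         h = full-φ {d} I h

    not-full : ∀ {n} (I : Subset n) → full I ≡ false → ∣ I ∣ < n
    not-full (true ∷ I)  h = s≤s (not-full I h)
    not-full (false ∷ I) h = s≤s (∣p∣≤n I)

    -- The product of j - (d + 2) over 1 ≤ j ≤ d + 1 is (d + 1)! with the sign (-1)^(d+1), and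
    -- `coef` has the sign (-1)^d.
    full-coef : ∀ t {d} (I : Subset (d ℕ.+ 2)) → full I ≡ true →
                coef t {d} I * P d (pos (2 ℕ.+ d)) 0ℤ ≡ - ((1ℤ + t) * pos (suc d !))
    full-coef t {zero} (true ∷ true ∷ []) h = aux t
      where
      aux : ∀ t → (1ℤ + t) * (0ℤ - pos 2 + 1ℤ) ≡ - ((1ℤ + t) * 1ℤ)
      aux = solve-∀
    full-coef t {suc d} (true ∷ I) h = begin
      - κ * P (suc d) (pos (suc m)) 0ℤ         ≡⟨ cong (λ x → - κ * P (suc d) x 0ℤ) (pos-+ 1 m) ⟩
      - κ * P (suc d) (1ℤ + pos m) 0ℤ          ≡⟨ cong (- κ *_) (P-suc d (pos m) 0ℤ) ⟩
      - κ * ((0ℤ - pos m) * P d (pos m) 0ℤ)    ≡⟨ aux κ (pos m) (P d (pos m) 0ℤ) ⟩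
      pos m * (κ * P d (pos m) 0ℤ)             ≡⟨ cong (pos m *_) (full-coef t {d} I h) ⟩
      pos m * - ((1ℤ + t) * pos (suc d !))     ≡⟨ aux′ (pos m) (1ℤ + t) (pos (suc d !)) ⟩
      - ((1ℤ + t) * (pos m * pos (suc d !)))   ≡⟨ cong (λ x → - ((1ℤ + t) * x)) (pos-* m (suc d !)) ⟨
      - ((1ℤ + t) * pos (suc (suc d) !))       ∎
      where
      κ = coef t {d} I
      m = suc (suc d)
      aux : ∀ k m p → - k * ((0ℤ - m) * p) ≡ m * (k * p)
      aux = solve-∀
      aux′ : ∀ m a b → m * - (a * b) ≡ - (a * (m * b))
      aux′ = solve-∀

    sum-padded : ∀ {d} (c : Vec ℕ d) → sum (padded c) ≡ sum c
    sum-padded []      = refl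
    sum-padded (c ∷ cs) = cong (c ℕ.+_) (sum-padded cs)

  module _ (t : ℕ) (1≤t : 1 ≤ t) {d} (c : Vec ℕ d) (k : ℕ) (k≤ : k ≤ suc (sum c)) where

    private
      correction : Series
      correction = sh (suc (sum (padded c))) (λ _ → pos (suc d !))

      -- For t b ≤ t k < t b + |I| the product P d |I| (t k - t b) contains the factor 0.
      ordinary : ∀ I → ∣ I ∣ ≤ suc d → latticeTerm t c I (t ℕ.* k) ≡ expansion (pos t) {d} (padded c) 0 I k
      ordinary I s≤ with φ {d} I ℕ.+ dot (padded c) I ℕ.≤? k
      ... | yes b≤k with K , refl ← ℕ.m≤n⇒∃[o]m+o≡n b≤k = begin
        κ * sh (t ℕ.* b ℕ.+ s) Q (t ℕ.* (b ℕ.+ K))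
          ≡⟨ cong (κ *_) (trans (sym (sh-sh (t ℕ.* b) s Q (t ℕ.* (b ℕ.+ K)))) (cong (sh (t ℕ.* b) (sh s Q)) (ℕ.*-distribˡ-+ t b K))) ⟩
        κ * sh (t ℕ.* b) (sh s Q) (t ℕ.* b ℕ.+ t ℕ.* K)
          ≡⟨ cong (κ *_) (trans (sh-+ (t ℕ.* b) (sh s Q) (t ℕ.* K)) (sh-P d s (t ℕ.* K) s≤)) ⟩
        κ * P d (pos s) (pos (t ℕ.* K))
          ≡⟨ cong (λ u → κ * P d (pos s) u) (pos-* t K) ⟩
        κ * P d (pos s) (pos t * pos K)
          ≡⟨ *-identityˡ _ ⟨
        1ℤ * (κ * P d (pos s) (pos t * pos K))
          ≡⟨ sh-+ b (λ K → 1ℤ * (κ * P d (pos s) (pos t * pos K))) K ⟨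
        expansion (pos t) {d} (padded c) 0 I (b ℕ.+ K) ∎
        where
        b = φ {d} I ℕ.+ dot (padded c) I
        s = ∣ I ∣
        κ = coef (pos t) {d} I
        Q : Series
        Q N = P d 0ℤ (pos N)
      ... | no b≰k = trans (cong (coef (pos t) {d} I *_) (sh-< _ beyond))
                       (trans (*-zeroʳ (coef (pos t) {d} I)) (sym (sh-< _ (ℕ.≰⇒> b≰k))))
        where
        beyond : t ℕ.* k < t ℕ.* (φ {d} I ℕ.+ dot (padded c) I) ℕ.+ ∣ I ∣
        beyond = ℕ.<-≤-trans (ℕ.*-monoʳ-< t {{ℕ.>-nonZero 1≤t}} (ℕ.≰⇒> b≰k)) (ℕ.m≤m+n _ _)

      -- The lattice term always vanishes, its exponent exceeding t k by at least n. The other term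
      -- vanishes as well for k < 1 + Σ cᵢ; at k = 1 + Σ cᵢ it is -(1 + t)(d + 1)!, which the
      -- correction cancels.
      exceptional : ∀ I → full I ≡ true →
                    latticeTerm t c I (t ℕ.* k) ≡ expansion (pos t) {d} (padded c) 0 I k + (1ℤ + pos t) * correction k
      exceptional I h = trans lhs (sym rhs)
        where
        b-eq : φ {d} I ℕ.+ dot (padded c) I ≡ suc (sum (padded c))
        b-eq = cong₂ ℕ._+_ (full-φ {d} I h) (full-dot (padded c) I h)
        k≤b : k ≤ φ {d} I ℕ.+ dot (padded c) I
        k≤b = ℕ.≤-trans k≤ (ℕ.≤-reflexive (trans (cong suc (sym (sum-padded c))) (sym b-eq)))
        beyond : t ℕ.* k < t ℕ.* (φ {d} I ℕ.+ dot (padded c) I) ℕ.+ ∣ I ∣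
        beyond rewrite trans (full-∣∣ I h) (ℕ.+-comm d 2) = ℕ.≤-<-trans (ℕ.*-monoʳ-≤ t k≤b) (ℕ.m<m+n _ (s≤s z≤n))
        lhs : latticeTerm t c I (t ℕ.* k) ≡ 0ℤ
        lhs = trans (cong (coef (pos t) {d} I *_) (sh-< _ beyond)) (*-zeroʳ (coef (pos t) {d} I))
        κ = coef (pos t) {d} I
        f = pos (suc d !)
        T = 1ℤ + pos t
        F : Series
        F K = 1ℤ * (κ * P d (pos ∣ I ∣) (pos t * pos K))
        rhs : expansion (pos t) {d} (padded c) 0 I k + T * correction k ≡ 0ℤ
        rhs rewrite b-eq with k ℕ.≟ suc (sum (padded c))
        ... | no ne = trans (cong₂ (λ x y → x + T * y) (sh-< F lt′) (sh-< (λ _ → f) lt′)) (trans (+-identityˡ _) (*-zeroʳ T))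
          where
          lt′ : k < suc (sum (padded c))
          lt′ = ℕ.≤∧≢⇒< (subst (k ≤_) b-eq k≤b) ne
        ... | yes refl = trans (cong₂ (λ x y → x + T * y) (at F) (at (λ _ → f))) (begin
          1ℤ * (κ * P d (pos ∣ I ∣) (pos t * pos 0)) + T * f
            ≡⟨ cong₂ (λ i u → 1ℤ * (κ * P d (pos i) u) + T * f) (trans (full-∣∣ I h) (ℕ.+-comm d 2)) (*-zeroʳ (pos t)) ⟩
          1ℤ * (κ * P d (pos (2 ℕ.+ d)) 0ℤ) + T * f
            ≡⟨ cong (λ x → 1ℤ * x + T * f) (full-coef (pos t) {d} I h) ⟩
          1ℤ * - (T * f) + T * f
            ≡⟨ aux (T * f) ⟩
          0ℤ ∎)
          where
          at : ∀ F → sh (suc (sum (padded c))) F (suc (sum (padded c))) ≡ F 0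
          at F = trans (cong (sh (suc (sum (padded c))) F) (sym (ℕ.+-identityʳ (suc (sum (padded c)))))) (sh-+ (suc (sum (padded c))) F 0)
          aux : ∀ x → 1ℤ * - x + x ≡ 0ℤ
          aux = solve-∀

    points-combined : pos (suc d !) * pos (length (points t c (t ℕ.* k))) ≡
                      combined (pos t) {d} (padded c) 0 k + (1ℤ + pos t) * total rule₄ 0ℤ {d} (padded c) 0 k
    points-combined = begin
      pos (suc d !) * pos (length (points t c (t ℕ.* k)))
        ≡⟨ points-expansion t c (t ℕ.* k) ⟩
      ∑ Is (λ I → latticeTerm t c I (t ℕ.* k))
        ≡⟨ ∑-cong Is each ⟩
      ∑ Is (λ I → E I + (if full I then X else 0ℤ))
        ≡⟨ ∑-+ Is E (λ I → if full I then X else 0ℤ) ⟩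
      ∑ Is E + ∑ Is (λ I → if full I then X else 0ℤ)
        ≡⟨ cong₂ _+_ (sym (combined-expansion (pos t) {d} (padded c) 0 k)) (∑-full (d ℕ.+ 2) X) ⟩
      combined (pos t) {d} (padded c) 0 k + X
        ≡⟨ cong (λ x → combined (pos t) {d} (padded c) 0 k + (1ℤ + pos t) * x) (total-rule₄ {d} (padded c) k) ⟨
      combined (pos t) {d} (padded c) 0 k + (1ℤ + pos t) * total rule₄ 0ℤ {d} (padded c) 0 k ∎
      where
      Is = subsets (d ℕ.+ 2)
      X  = (1ℤ + pos t) * correction k
      E : Subset (d ℕ.+ 2) → ℤ
      E I = expansion (pos t) {d} (padded c) 0 I k
      each : ∀ I → latticeTerm t c I (t ℕ.* k) ≡ E I + (if full I then X else 0ℤ)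
      each I with full I in eq
      ... | true  = exceptional I eq
      ... | false = trans (ordinary I (ℕ.≤-pred (subst (∣ I ∣ <_) (ℕ.+-comm d 2) (not-full I eq)))) (sym (+-identityʳ _))

  count-zero : ∀ {n} (α : Subset n → Con) k → count α 0 k ≡ 0
  count-zero α k = empty (triples α 0 k) λ T m → none T (Equivalence.to (proj₁ (proj₂ (proj₂ (admissible-cardinality α 0 k))) T) m)
    where
    empty : ∀ {A : Set} (xs : List A) → (∀ x → x ∈ xs → ⊥) → length xs ≡ 0
    empty []       h = refl
    empty (x ∷ xs) h = contradiction (here refl) (h x)
    none : ∀ T → Admissible α 0 k T → ⊥
    none T ((((_ , _ , i , p , _) , q , _)) , _) with () ← trans p q

  module _ {d} (c : Vec ℕ d) (k : ℕ) where

    number : Rule → ℕ → ℕ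
    number g r = count (constraint {d} g (padded c)) r k

    -- The improperly weighted n-cycles, which S₁ gains at m = 0 and S₄ loses at
    -- m = 1.
    exception : ℕ → ℕ
    exception 0 = number rule₄ 1
    exception 1 = number rule₄ 1
    exception _ = 0

    coefficient : ℕ → ℤ
    coefficient m =
      pos (number rule₁ (suc m)) + pos (number rule₂ (suc m)) - pos (number rule₃ m) - pos (number rule₄ m) + pos (exception m)

    private
      generating : ∀ g t B → d ℕ.+ 2 ≤ B → horner t B (λ m → pos (number g (suc m))) ≡ total g t {d} (padded c) 0 k
      generating g t B h = count-generating (constraint {d} g (padded c)) t k h

      -- At t = 0 the polynomial reduces to its constant coefficient, the count for one cycle. The
      -- length is taken above n so that `horner` unfolds.
      number-rule₄ : pos (number rule₄ 1) ≡ total rule₄ 0ℤ {d} (padded c) 0 k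
      number-rule₄ = begin
        pos (number rule₄ 1)
          ≡⟨ trans (cong (pos (number rule₄ 1) +_) (*-zeroˡ (horner 0ℤ (d ℕ.+ 2) (λ m → pos (number rule₄ (suc (suc m))))))) (+-identityʳ _) ⟨
        horner 0ℤ (suc (d ℕ.+ 2)) (λ m → pos (number rule₄ (suc m)))
          ≡⟨ generating rule₄ 0ℤ (suc (d ℕ.+ 2)) (ℕ.n≤1+n _) ⟩
        total rule₄ 0ℤ {d} (padded c) 0 k ∎

      split : ∀ t B (f₁ f₂ f₃ f₄ e : ℕ → ℤ) →
              horner t B (λ m → f₁ m + f₂ m - f₃ m - f₄ m + e m) ≡
              (horner t B f₁ + horner t B f₂ - (horner t B f₃ + horner t B f₄)) + horner t B e
      split t zero    f₁ f₂ f₃ f₄ e = refl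
      split t (suc B) f₁ f₂ f₃ f₄ e = trans
        (cong (λ x → (f₁ 0 + f₂ 0 - f₃ 0 - f₄ 0 + e 0) + t * x) (split t B (f₁ ∘ suc) (f₂ ∘ suc) (f₃ ∘ suc) (f₄ ∘ suc) (e ∘ suc)))
        (aux (f₁ 0) (f₂ 0) (f₃ 0) (f₄ 0) (e 0) t (H f₁) (H f₂) (H f₃) (H f₄) (H e))
        where
        H : (ℕ → ℤ) → ℤ
        H f = horner t B (f ∘ suc)
        aux : ∀ a b c d e t x y z w v → (a + b - c - d + e) + t * ((x + y - (z + w)) + v) ≡
              ((a + t * x) + (b + t * y) - ((c + t * z) + (d + t * w))) + (e + t * v)
        aux = solve-∀

      -- Coefficient m counts triples with m cycles instead of m + 1; there are none for m = 0, so a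
      -- factor t comes out.
      below : ∀ g t B → d ℕ.+ 2 ≤ B → horner t (suc B) (λ m → pos (number g m)) ≡ t * total g t {d} (padded c) 0 k
      below g t B h = trans
        (cong₂ (λ x y → pos x + t * y) (count-zero (constraint {d} g (padded c)) k) (generating g t B h))
        (+-identityˡ _)

      -- The exceptions at m = 0 and m = 1 together make up the factor 1 + t of the correction.
      exceptions : ∀ t B → horner t (suc (suc B)) (λ m → pos (exception m)) ≡ (1ℤ + t) * pos (number rule₄ 1)
      exceptions t B = trans (cong (λ y → x + t * (x + t * y)) (horner-zero t B)) (aux t x)
        where
        x = pos (number rule₄ 1)
        aux : ∀ t x → x + t * (x + t * 0ℤ) ≡ (1ℤ + t) * x
        aux = solve-∀

    -- An n-cycle of weight k ≤ Σ cᵢ is properly weighted.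
    exception-vanishes : k < suc (sum c) → number rule₄ 1 ≡ 0
    exception-vanishes h = ℤ.+-injective (begin
      pos (number rule₄ 1)                                     ≡⟨ number-rule₄ ⟩
      total rule₄ 0ℤ {d} (padded c) 0 k                        ≡⟨ total-rule₄ {d} (padded c) k ⟩
      sh (suc (sum (padded c))) (λ _ → pos (suc d !)) k        ≡⟨ sh-< _ (subst (λ s → k < suc s) (sym (sum-padded c)) h) ⟩
      0ℤ                                                       ∎)

    points-coefficients : ∀ t → 1 ≤ t → k ≤ suc (sum c) → ∀ B → d ℕ.+ 2 ≤ B →
      pos (suc d !) * pos (length (points t c (t ℕ.* k))) ≡ horner (pos t) (suc (suc B)) coefficient
    points-coefficients t 1≤t k≤ B n≤B = begin
      pos (suc d !) * pos (length (points t c (t ℕ.* k)))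
        ≡⟨ points-combined t 1≤t c k k≤ ⟩
      (R rule₁ + R rule₂ - T * (R rule₃ + R rule₄)) + (1ℤ + T) * total rule₄ 0ℤ {d} (padded c) 0 k
        ≡⟨ cong₂ (λ x y → (R rule₁ + R rule₂ - x) + (1ℤ + T) * y) (distrib T (R rule₃) (R rule₄)) (sym number-rule₄) ⟩
      (R rule₁ + R rule₂ - (T * R rule₃ + T * R rule₄)) + (1ℤ + T) * pos (number rule₄ 1)
        ≡⟨ cong₂ _+_
             (cong₂ _-_ (cong₂ _+_ (generating rule₁ T L n≤L) (generating rule₂ T L n≤L))
                        (cong₂ _+_ (below rule₃ T (suc B) (ℕ.m≤n⇒m≤1+n n≤B)) (below rule₄ T (suc B) (ℕ.m≤n⇒m≤1+n n≤B))))
             (exceptions T B) ⟨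
      (horner T L (λ m → pos (number rule₁ (suc m))) + horner T L (λ m → pos (number rule₂ (suc m)))
        - (horner T L (λ m → pos (number rule₃ m)) + horner T L (λ m → pos (number rule₄ m)))) + horner T L (λ m → pos (exception m))
        ≡⟨ split T L (λ m → pos (number rule₁ (suc m))) (λ m → pos (number rule₂ (suc m))) (λ m → pos (number rule₃ m)) (λ m → pos (number rule₄ m)) (λ m → pos (exception m)) ⟨
      horner T L coefficient ∎
      where
      T = pos t
      L = suc (suc B)
      n≤L = ℕ.m≤n⇒m≤1+n (ℕ.m≤n⇒m≤1+n n≤B)
      R : Rule → ℤ
      R g = total g T {d} (padded c) 0 k
      distrib : ∀ a b c → a * (b + c) ≡ a * b + a * c
      distrib = solve-∀

-- Integers inside the rationals

module Rationals where

  open import Defs using (fromℤ; fromℕ)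
  open import Data.Integer as ℤ using (ℤ)
  import Data.Integer.Properties as ℤ
  open import Data.Rational
  open import Data.Rational.Properties
  open import Data.Rational.Unnormalised as ℚᵘ using (mkℚᵘ; *≡*; *≤*)
  import Data.Rational.Unnormalised.Properties as ℚᵘ
  open import Data.Rational.Solver using (module +-*-Solver)

  private
    integer : ℤ → ℚᵘ.ℚᵘ
    integer z = mkℚᵘ z 0

    -- `fromℤ` normalises its fraction and does not reduce on variables, so its laws are carried
    -- over from the unnormalised rationals, where the denominator is 1.
    toℚᵘ-fromℤ : ∀ z → toℚᵘ (fromℤ z) ℚᵘ.≃ integer z
    toℚᵘ-fromℤ z = toℚᵘ-fromℚᵘ (integer z)

    unit : ∀ z → z ℤ.* ℤ.1ℤ ≡ z
    unit = ℤ.*-identityʳ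

  fromℤ-injective : ∀ {a b} → fromℤ a ≡ fromℤ b → a ≡ b
  fromℤ-injective {a} {b} e with ℚᵘ.≃-trans (ℚᵘ.≃-sym (toℚᵘ-fromℤ a)) (ℚᵘ.≃-trans (ℚᵘ.≃-reflexive (cong toℚᵘ e)) (toℚᵘ-fromℤ b))
  ... | *≡* h = trans (sym (unit a)) (trans h (unit b))

  fromℤ-+ : ∀ a b → fromℤ (a ℤ.+ b) ≡ fromℤ a + fromℤ b
  fromℤ-+ a b = toℚᵘ-injective (begin
    toℚᵘ (fromℤ (a ℤ.+ b))                ≈⟨ toℚᵘ-fromℤ (a ℤ.+ b) ⟩
    integer (a ℤ.+ b)                     ≈⟨ *≡* (cong (ℤ._* ℤ.1ℤ) (cong₂ ℤ._+_ (sym (unit a)) (sym (unit b)))) ⟩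
    integer a ℚᵘ.+ integer b              ≈⟨ ℚᵘ.+-cong (toℚᵘ-fromℤ a) (toℚᵘ-fromℤ b) ⟨
    toℚᵘ (fromℤ a) ℚᵘ.+ toℚᵘ (fromℤ b)    ≈⟨ toℚᵘ-homo-+ (fromℤ a) (fromℤ b) ⟨
    toℚᵘ (fromℤ a + fromℤ b)              ∎)
    where open import Relation.Binary.Reasoning.Setoid ℚᵘ.≃-setoid

  fromℤ-* : ∀ a b → fromℤ (a ℤ.* b) ≡ fromℤ a * fromℤ b
  fromℤ-* a b = toℚᵘ-injective (begin
    toℚᵘ (fromℤ (a ℤ.* b))                ≈⟨ toℚᵘ-fromℤ (a ℤ.* b) ⟩
    integer (a ℤ.* b)                     ≈⟨ *≡* refl ⟩
    integer a ℚᵘ.* integer b              ≈⟨ ℚᵘ.*-cong (toℚᵘ-fromℤ a) (toℚᵘ-fromℤ b) ⟨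
    toℚᵘ (fromℤ a) ℚᵘ.* toℚᵘ (fromℤ b)    ≈⟨ toℚᵘ-homo-* (fromℤ a) (fromℤ b) ⟨
    toℚᵘ (fromℤ a * fromℤ b)              ∎)
    where open import Relation.Binary.Reasoning.Setoid ℚᵘ.≃-setoid

  fromℤ-mono-≤ : ∀ {a b} → a ℤ.≤ b → fromℤ a ≤ fromℤ b
  fromℤ-mono-≤ {a} {b} h = toℚᵘ-cancel-≤ (ℚᵘ.≤-respˡ-≃ (ℚᵘ.≃-sym (toℚᵘ-fromℤ a))
    (ℚᵘ.≤-respʳ-≃ (ℚᵘ.≃-sym (toℚᵘ-fromℤ b)) (*≤* (subst₂ ℤ._≤_ (sym (unit a)) (sym (unit b)) h))))

  fromℤ-cancel-≤ : ∀ {a b} → fromℤ a ≤ fromℤ b → a ℤ.≤ b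
  fromℤ-cancel-≤ {a} {b} h with ℚᵘ.≤-respˡ-≃ (toℚᵘ-fromℤ a) (ℚᵘ.≤-respʳ-≃ (toℚᵘ-fromℤ b) (toℚᵘ-mono-≤ h))
  ... | *≤* le = subst₂ ℤ._≤_ (unit a) (unit b) le

  fromℕ-+ : ∀ a b → fromℕ (a ℕ.+ b) ≡ fromℕ a + fromℕ b
  fromℕ-+ a b = trans (cong fromℤ (ℤ.pos-+ a b)) (fromℤ-+ (ℤ.+ a) (ℤ.+ b))

  fromℕ-* : ∀ a b → fromℕ (a ℕ.* b) ≡ fromℕ a * fromℕ b
  fromℕ-* a b = trans (cong fromℤ (ℤ.pos-* a b)) (fromℤ-* (ℤ.+ a) (ℤ.+ b))

  fromℕ-mono-≤ : ∀ {a b} → a ℕ.≤ b → fromℕ a ≤ fromℕ b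
  fromℕ-mono-≤ h = fromℤ-mono-≤ (ℤ.+≤+ h)

  fromℕ-cancel-≤ : ∀ {a b} → fromℕ a ≤ fromℕ b → a ℕ.≤ b
  fromℕ-cancel-≤ = ℤ.drop‿+≤+ ∘ fromℤ-cancel-≤

  fromℕ-injective : ∀ {a b} → fromℕ a ≡ fromℕ b → a ≡ b
  fromℕ-injective = ℤ.+-injective ∘ fromℤ-injective

  module _ (t : ℕ) (1≤t : 1 ℕ.≤ t) where

    private
      instance
        t-positive : Positive (fromℕ t)
        t-positive = positive (<-≤-trans (*<* (ℤ.+<+ (ℕ.s≤s ℕ.z≤n))) (fromℕ-mono-≤ 1≤t))
        t-nonNegative : NonNegative (fromℕ t)
        t-nonNegative = pos⇒nonNeg (fromℕ t)
        t-nonZero : NonZero (fromℕ t)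
        t-nonZero = pos⇒nonZero (fromℕ t)

    inverse : ℚ
    inverse = 1/ fromℕ t

    *-inverse : ∀ x → fromℕ t * (inverse * x) ≡ x
    *-inverse x = trans (sym (*-assoc (fromℕ t) inverse x)) (trans (cong (_* x) (*-inverseʳ (fromℕ t))) (*-identityˡ x))

    fromℕ-*-mono : ∀ {x y} → x ≤ y → fromℕ t * x ≤ fromℕ t * y
    fromℕ-*-mono = *-monoˡ-≤-nonNeg (fromℕ t)

    fromℕ-*-cancel-≤ : ∀ {x y} → fromℕ t * x ≤ fromℕ t * y → x ≤ y
    fromℕ-*-cancel-≤ = *-cancelˡ-≤-pos (fromℕ t)

    fromℕ-*-cancel : ∀ {x y} → fromℕ t * x ≡ fromℕ t * y → x ≡ y
    fromℕ-*-cancel e = ≤-antisym (fromℕ-*-cancel-≤ (≤-reflexive e)) (fromℕ-*-cancel-≤ (≤-reflexive (sym e)))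

-- A polynomial with infinitely many roots is zero

module Polynomials where

  open import Defs
  open Rationals
  open Sums
  open import Data.Integer as ℤ using (ℤ)
  import Data.Integer.Properties as ℤ
  open import Data.Rational using (ℚ; 0ℚ; _+_; _*_; _-_; -_)
  open import Data.Rational.Properties using (+-identityˡ; +-identityʳ; *-zeroʳ; +-inverseʳ)
  open import Data.Rational.Solver using (module +-*-Solver)
  open import Data.List using (applyUpTo)
  open import Data.List.Relation.Unary.All using (All; []; _∷_)
  open ≡-Reasoning
  open +-*-Solver using (solve; _:+_; _:*_; _:-_; :-_; _:=_; con)

  private
    -- Synthetic division by t - a: the coefficients are the values at a of the tails of the list.
    quotient : ℚ → Polynomial → Polynomial
    quotient a []            = []
    quotient a (c ∷ [])      = []
    quotient a (c ∷ f@(_ ∷ _)) = ⟦ f ⟧ a ∷ quotient a f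

    division : ∀ a f t → ⟦ f ⟧ t ≡ (t - a) * ⟦ quotient a f ⟧ t + ⟦ f ⟧ a
    division a []       t = solve 2 (λ a t → con 0ℚ := (t :- a) :* con 0ℚ :+ con 0ℚ) refl a t
    division a (c ∷ []) t = solve 3 (λ a c t → c :+ t :* con 0ℚ := (t :- a) :* con 0ℚ :+ (c :+ a :* con 0ℚ)) refl a c t
    division a (c ∷ f@(_ ∷ _)) t = begin
      c + t * ⟦ f ⟧ t
        ≡⟨ cong (λ x → c + t * x) (division a f t) ⟩
      c + t * ((t - a) * q + ⟦ f ⟧ a)
        ≡⟨ solve 5 (λ a c t q r → c :+ t :* ((t :- a) :* q :+ r) := (t :- a) :* (r :+ t :* q) :+ (c :+ a :* r)) refl a c t q (⟦ f ⟧ a) ⟩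
      (t - a) * (⟦ f ⟧ a + t * q) + (c + a * ⟦ f ⟧ a) ∎
      where
      q = ⟦ quotient a f ⟧ t

    length-quotient : ∀ a f n → length f ℕ.≤ suc n → length (quotient a f) ℕ.≤ n
    length-quotient a []       n _ = z≤n
    length-quotient a (c ∷ []) n _ = z≤n
    length-quotient a (c ∷ f@(_ ∷ _)) (suc n) (s≤s h) = s≤s (length-quotient a f n h)

    Zero : Polynomial → Set
    Zero = All (_≡ 0ℚ)

    constant : ∀ c a x → x ≡ 0ℚ → c + a * x ≡ 0ℚ → c ≡ 0ℚ
    constant c a x refl h = trans (sym (trans (cong (c +_) (*-zeroʳ a)) (+-identityʳ c))) h

    zero-quotient : ∀ a f → Zero (quotient a f) → ⟦ f ⟧ a ≡ 0ℚ → Zero f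
    zero-quotient a []       z h = []
    zero-quotient a (c ∷ []) z h = constant c a 0ℚ refl h ∷ []
    zero-quotient a (c ∷ f@(_ ∷ _)) (e ∷ z) h = constant c a (⟦ f ⟧ a) e h ∷ zero-quotient a f z e

    -- Division by t - (N + 1) shortens f, and the quotient still vanishes at every integer t > N +
    -- 1, where t - (N + 1) is positive and can be cancelled.
    vanishing : ∀ n f N → length f ℕ.≤ n → (∀ t → N ℕ.< t → ⟦ f ⟧ (fromℕ t) ≡ 0ℚ) → Zero f
    vanishing zero    []      N _ h = []
    vanishing (suc n) f       N l h = zero-quotient a f (vanishing n (quotient a f) (suc N) (length-quotient a f n l) root) (h (suc N) ℕ.≤-refl)
      where
      a = fromℕ (suc N)
      root : ∀ t → suc N ℕ.< t → ⟦ quotient a f ⟧ (fromℕ t) ≡ 0ℚ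
      root t lt with s , refl ← ℕ.m≤n⇒∃[o]m+o≡n lt = fromℕ-*-cancel (suc s) (s≤s z≤n) (begin
        fromℕ (suc s) * q
          ≡⟨ cong (_* q) difference ⟨
        (fromℕ t - a) * q
          ≡⟨ +-identityʳ _ ⟨
        (fromℕ t - a) * q + 0ℚ
          ≡⟨ cong ((fromℕ t - a) * q +_) (h (suc N) ℕ.≤-refl) ⟨
        (fromℕ t - a) * q + ⟦ f ⟧ a
          ≡⟨ division a f (fromℕ t) ⟨
        ⟦ f ⟧ (fromℕ t)
          ≡⟨ h t (ℕ.≤-trans (ℕ.n≤1+n (suc N)) lt) ⟩
        0ℚ
          ≡⟨ *-zeroʳ (fromℕ (suc s)) ⟨
        fromℕ (suc s) * 0ℚ ∎)
        where
        q = ⟦ quotient a f ⟧ (fromℕ t)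
        difference : fromℕ t - a ≡ fromℕ (suc s)
        difference = begin
          fromℕ (suc (suc N) ℕ.+ s) - a     ≡⟨ cong (λ m → fromℕ m - a) (sym (ℕ.+-suc (suc N) s)) ⟩
          fromℕ (suc N ℕ.+ suc s) - a       ≡⟨ cong (_- a) (fromℕ-+ (suc N) (suc s)) ⟩
          a + fromℕ (suc s) - a             ≡⟨ solve 2 (λ a b → a :+ b :- a := b) refl a (fromℕ (suc s)) ⟩
          fromℕ (suc s)                     ∎

    infixl 6 _⊖_
    _⊖_ : Polynomial → Polynomial → Polynomial
    []      ⊖ []      = []
    []      ⊖ (b ∷ g) = (0ℚ - b) ∷ ([] ⊖ g)
    (a ∷ f) ⊖ []      = (a - 0ℚ) ∷ (f ⊖ [])
    (a ∷ f) ⊖ (b ∷ g) = (a - b) ∷ (f ⊖ g)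

    ⊖-step : ∀ a b t x y → (a - b) + t * (x - y) ≡ (a + t * x) - (b + t * y)
    ⊖-step = solve 5 (λ a b t x y → (a :- b) :+ t :* (x :- y) := (a :+ t :* x) :- (b :+ t :* y)) refl

    ⊖-pad : ∀ t → 0ℚ ≡ 0ℚ + t * 0ℚ
    ⊖-pad = solve 1 (λ t → con 0ℚ := con 0ℚ :+ t :* con 0ℚ) refl

    ⟦⊖⟧ : ∀ f g t → ⟦ f ⊖ g ⟧ t ≡ ⟦ f ⟧ t - ⟦ g ⟧ t
    ⟦⊖⟧ []      []      t = refl
    ⟦⊖⟧ []      (b ∷ g) t = trans (cong (λ x → (0ℚ - b) + t * x) (⟦⊖⟧ [] g t))
      (trans (⊖-step 0ℚ b t 0ℚ (⟦ g ⟧ t)) (cong (λ x → x - (b + t * ⟦ g ⟧ t)) (sym (⊖-pad t))))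
    ⟦⊖⟧ (a ∷ f) []      t = trans (cong (λ x → (a - 0ℚ) + t * x) (⟦⊖⟧ f [] t))
      (trans (⊖-step a 0ℚ t (⟦ f ⟧ t) 0ℚ) (cong (λ x → (a + t * ⟦ f ⟧ t) - x) (sym (⊖-pad t))))
    ⟦⊖⟧ (a ∷ f) (b ∷ g) t = trans (cong (λ x → (a - b) + t * x) (⟦⊖⟧ f g t)) (⊖-step a b t (⟦ f ⟧ t) (⟦ g ⟧ t))

    cancel : ∀ a b → a - b ≡ 0ℚ → a ≡ b
    cancel a b h = trans (solve 2 (λ a b → a := (a :- b) :+ b) refl a b) (trans (cong (_+ b) h) (+-identityˡ b))

    zero-⊖ : ∀ f g → Zero (f ⊖ g) → ∀ m → [t^ m ] f ≡ [t^ m ] g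
    zero-⊖ []      []      z       m       = refl
    zero-⊖ []      (b ∷ g) (e ∷ z) zero    = cancel 0ℚ b e
    zero-⊖ []      (b ∷ g) (e ∷ z) (suc m) = zero-⊖ [] g z m
    zero-⊖ (a ∷ f) []      (e ∷ z) zero    = cancel a 0ℚ e
    zero-⊖ (a ∷ f) []      (e ∷ z) (suc m) = zero-⊖ f [] z m
    zero-⊖ (a ∷ f) (b ∷ g) (e ∷ z) zero    = cancel a b e
    zero-⊖ (a ∷ f) (b ∷ g) (e ∷ z) (suc m) = zero-⊖ f g z m

  polynomial-identity : ∀ f g → (∀ t → 0 ℕ.< t → ⟦ f ⟧ (fromℕ t) ≡ ⟦ g ⟧ (fromℕ t)) → ∀ m → [t^ m ] f ≡ [t^ m ] g
  polynomial-identity f g h = zero-⊖ f g (vanishing (length (f ⊖ g)) (f ⊖ g) 0 ℕ.≤-refl λ t lt →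
    trans (⟦⊖⟧ f g (fromℕ t)) (trans (cong (_- ⟦ g ⟧ (fromℕ t)) (h t lt)) (+-inverseʳ (⟦ g ⟧ (fromℕ t)))))

  ⟦·⟧ : ∀ a f t → ⟦ a · f ⟧ t ≡ fromℕ a * ⟦ f ⟧ t
  ⟦·⟧ a []      t = sym (*-zeroʳ (fromℕ a))
  ⟦·⟧ a (c ∷ f) t = trans (cong (λ x → fromℕ a * c + t * x) (⟦·⟧ a f t))
    (solve 4 (λ a c t x → a :* c :+ t :* (a :* x) := a :* (c :+ t :* x)) refl (fromℕ a) c t (⟦ f ⟧ t))

  [t^]-applyUpTo : ∀ (h : ℕ → ℚ) {B m} → m ℕ.< B → [t^ m ] (applyUpTo h B) ≡ h m
  [t^]-applyUpTo h {suc B} {zero}  _       = refl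
  [t^]-applyUpTo h {suc B} {suc m} (s≤s l) = [t^]-applyUpTo (h ∘ suc) l

  ⟦applyUpTo⟧ : ∀ (h : ℕ → ℤ) t B → ⟦ applyUpTo (fromℤ ∘ h) B ⟧ (fromℕ t) ≡ fromℤ (horner (ℤ.+ t) B h)
  ⟦applyUpTo⟧ h t zero    = refl
  ⟦applyUpTo⟧ h t (suc B) = begin
    fromℤ (h 0) + fromℕ t * ⟦ applyUpTo (fromℤ ∘ h ∘ suc) B ⟧ (fromℕ t)
      ≡⟨ cong (λ x → fromℤ (h 0) + fromℕ t * x) (⟦applyUpTo⟧ (h ∘ suc) t B) ⟩
    fromℤ (h 0) + fromℕ t * fromℤ (horner (ℤ.+ t) B (h ∘ suc))
      ≡⟨ cong (fromℤ (h 0) +_) (fromℤ-* (ℤ.+ t) (horner (ℤ.+ t) B (h ∘ suc))) ⟨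
    fromℤ (h 0) + fromℤ ((ℤ.+ t) ℤ.* horner (ℤ.+ t) B (h ∘ suc))
      ≡⟨ fromℤ-+ (h 0) ((ℤ.+ t) ℤ.* horner (ℤ.+ t) B (h ∘ suc)) ⟨
    fromℤ (horner (ℤ.+ t) (suc B) h) ∎

-- Lattice points of the dilated polytope

module LatticePoints where

  open import Defs
  open Sums
  open Series
  open Weights
  open Rationals
  open LatticeSeries
  open Counting using (∈-if⁻; ∈-if⁺)
  import Data.Bool as Bool
  open import Data.Nat using (_+_; _*_; _≤_; _<_; _<ᵇ_)
  open import Data.Integer as ℤ using (ℤ; ∣_∣) renaming (+_ to pos)
  import Data.Integer.Properties as ℤ
  open import Data.Rational as ℚ using (ℚ; 0ℚ; 1ℚ)
  import Data.Rational.Properties as ℚ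
  open import Data.List.Properties using (length-map)
  open import Data.List.Membership.Propositional using (_∈_)
  open import Data.List.Membership.Propositional.Properties using (∈-map⁺; ∈-map⁻)
  open import Data.List.Relation.Unary.Unique.Propositional.Properties using (map⁺)
  open import Data.Vec using (lookup; sum; map)
  open import Data.Vec.Properties using (lookup-map)
  open Cycles using (vec-ext)
  open import Relation.Unary using (Satisfiable)

  true⇒T : ∀ {b} → b ≡ true → Bool.T b
  true⇒T refl = _

  T⇒true : ∀ {b} → Bool.T b → b ≡ true
  T⇒true {true} _ = refl

  <ᵇ⁻ : ∀ {m n} → (m <ᵇ n) ≡ true → m < n
  <ᵇ⁻ {m} {n} h = ℕ.<ᵇ⇒< m n (true⇒T h)

  <ᵇ⁺ : ∀ {m n} → m < n → (m <ᵇ n) ≡ true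
  <ᵇ⁺ = T⇒true ∘ ℕ.<⇒<ᵇ

  InDilate : ℕ → ∀ {d} → Vec ℕ d → Vec ℕ (d + 2) → Set
  InDilate t {d} c y =
    (∀ (i : Fin d) → lookup y (old i) ≤ t * lookup c i) × lookup y (penultimate {d}) + lookup y (ultimate {d}) ≤ t

  ∈-points⁻ : ∀ t {d} (c : Vec ℕ d) N {y} → y ∈ points t c N → N ≡ sum y × InDilate t c y
  ∈-points⁻ t [] N {a ∷ b ∷ []} m with e , m′ ← ∈-if⁻ (N <ᵇ suc t) m with refl , _ ← ∈-weightings⁻ (ge 0 ∷ ge 0 ∷ []) N m′ =
    refl , (λ ()) , ℕ.≤-trans (ℕ.≤-reflexive (cong (a +_) (sym (ℕ.+-identityʳ b)))) (ℕ.<⇒≤pred (<ᵇ⁻ {N} {suc t} e))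
  ∈-points⁻ t (c ∷ cs) N m with (w , v) , h , refl ← ∈-map⁻ (uncurry _∷_) m
    with s , refl , e , h′ ← ∈-pairs⁻ (sem (lt (suc (t * c)))) (points t cs) N h
    with refl , g , l ← ∈-points⁻ t cs s h′ =
    refl , (λ { zero → ℕ.<⇒≤pred (<ᵇ⁻ {w} {suc (t * c)} e) ; (suc i) → g i }) , l

  ∈-points⁺ : ∀ t {d} (c : Vec ℕ d) y → InDilate t c y → y ∈ points t c (sum y)
  ∈-points⁺ t [] (a ∷ b ∷ []) (_ , l) = ∈-if⁺
    (<ᵇ⁺ (s≤s (ℕ.≤-trans (ℕ.≤-reflexive (cong (a +_) (ℕ.+-identityʳ b))) l)))
    (∈-weightings⁺ (ge 0 ∷ ge 0 ∷ []) (a ∷ b ∷ []) (λ { zero → refl ; (suc zero) → refl }))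
  ∈-points⁺ t (c ∷ cs) (w ∷ v) (g , l) =
    ∈-map⁺ (uncurry _∷_) (∈-pairs⁺ (sem (lt (suc (t * c)))) (points t cs) w (<ᵇ⁺ (s≤s (g zero))) (∈-points⁺ t cs v (g ∘ suc , l)))

  points-unique : ∀ t {d} (c : Vec ℕ d) N → Unique (points t c N)
  points-unique t [] N with N <ᵇ suc t
  ... | true  = weightings-unique (ge 0 ∷ ge 0 ∷ []) N
  ... | false = []
  points-unique t {suc d} (c ∷ cs) N = map⁺ inj (pairs-unique (sem (lt (suc (t * c)))) (points-unique t cs) N)
    where
    inj : ∀ {x y : ℕ × Vec ℕ (d + 2)} → uncurry _∷_ x ≡ uncurry _∷_ y → x ≡ y
    inj {_ , _} {_ , _} refl = refl

  ∑ℚ : ∀ {n} → Vec ℚ n → ℚ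
  ∑ℚ = Vec.foldr′ ℚ._+_ 0ℚ

  module _ (t : ℕ) (1≤t : 1 ≤ t) where

    private
      infix 4 _~_
      -- Wrapped in a record so that x and y are inferred from the type of a proof.
      record _~_ (x : ℚ) (y : ℕ) : Set where
        constructor scaling
        field t*x≡y : fromℕ t ℚ.* x ≡ fromℕ y

      ~-+ : ∀ {x x′ y y′} → x ~ y → x′ ~ y′ → x ℚ.+ x′ ~ y + y′
      ~-+ {x} {x′} {y} {y′} (scaling e) (scaling e′) = scaling (trans (ℚ.*-distribˡ-+ (fromℕ t) x x′) (trans (cong₂ ℚ._+_ e e′) (sym (fromℕ-+ y y′))))

      ~-∑ : ∀ {n} (x : Vec ℚ n) y → (∀ i → lookup x i ~ lookup y i) → ∑ℚ x ~ sum y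
      ~-∑ []      []      h = scaling (ℚ.*-zeroʳ (fromℕ t))
      ~-∑ (x ∷ xs) (y ∷ ys) h = ~-+ (h zero) (~-∑ xs ys (h ∘ suc))

      ~-≤⁺ : ∀ {x y} b → x ~ y → y ≤ t * b → x ℚ.≤ fromℕ b
      ~-≤⁺ b (scaling e) h = fromℕ-*-cancel-≤ t 1≤t (subst₂ ℚ._≤_ (sym e) (fromℕ-* t b) (fromℕ-mono-≤ h))

      ~-≤⁻ : ∀ {x y} b → x ~ y → x ℚ.≤ fromℕ b → y ≤ t * b
      ~-≤⁻ {y = y} b (scaling e) h = fromℕ-cancel-≤ {y} {t * b} (subst₂ ℚ._≤_ e (sym (fromℕ-* t b)) (fromℕ-*-mono t 1≤t h))

      ~-≡⁺ : ∀ {x y} b → x ~ y → y ≡ t * b → x ≡ fromℕ b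
      ~-≡⁺ b (scaling e) h = fromℕ-*-cancel t 1≤t (trans e (trans (cong fromℕ h) (fromℕ-* t b)))

      ~-≡⁻ : ∀ {x y} b → x ~ y → x ≡ fromℕ b → y ≡ t * b
      ~-≡⁻ {y = y} b (scaling e) h = fromℕ-injective {y} {t * b} (trans (sym e) (trans (cong (fromℕ t ℚ.*_) h) (sym (fromℕ-* t b))))

      ~-nonNegative : ∀ {x y} → x ~ y → 0ℚ ℚ.≤ x
      ~-nonNegative {y = y} (scaling e) = fromℕ-*-cancel-≤ t 1≤t (subst₂ ℚ._≤_ (sym (ℚ.*-zeroʳ (fromℕ t))) (sym e) (fromℕ-mono-≤ {0} {y} z≤n))

    module _ {d} (c : Vec ℕ d) (k : ℕ) where

      private
        Δ⁺ : ∀ x y → (∀ i → lookup x i ~ lookup y i) → y ∈ points t c (t * k) → Δ c k x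
        Δ⁺ x y e m =
          let s , g , l = ∈-points⁻ t c (t * k) m in
          (λ i → ~-nonNegative (e i)) ,
          ~-≡⁺ k (~-∑ x y e) (sym s) ,
          (λ i → ~-≤⁺ (lookup c i) (e (old i)) (g i)) ,
          ~-≤⁺ 1 (~-+ (e penultimate) (e ultimate))
            (subst (lookup y (penultimate {d}) + lookup y (ultimate {d}) ≤_) (sym (ℕ.*-identityʳ t)) l)

        Δ⁻ : ∀ x y → (∀ i → lookup x i ~ lookup y i) → Δ c k x → y ∈ points t c (t * k)
        Δ⁻ x y e (_ , s , g , l) = subst (λ N → y ∈ points t c N) (~-≡⁻ k (~-∑ x y e) s)
          (∈-points⁺ t c y
            ((λ i → ~-≤⁻ (lookup c i) (e (old i)) (g i)) ,
             subst (lookup y (penultimate {d}) + lookup y (ultimate {d}) ≤_) (ℕ.*-identityʳ t)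
               (~-≤⁻ 1 (~-+ (e penultimate) (e ultimate)) l)))

        scaled : Vec ℕ (d + 2) → Vec ℚ (d + 2)
        scaled = map (λ a → inverse t 1≤t ℚ.* fromℕ a)

        to : ∀ z → z ∈ List.map (map pos) (points t c (t * k)) → latticePoints (dilate t (Δ c k)) z
        to z m with y , h , refl ← ∈-map⁻ (map pos) m = scaled y , Δ⁺ (scaled y) y e h , vec-ext λ i → begin
          lookup (map fromℤ (map pos y)) i       ≡⟨ trans (lookup-map i fromℤ (map pos y)) (cong fromℤ (lookup-map i pos y)) ⟩
          fromℕ (lookup y i)                     ≡⟨ _~_.t*x≡y (e i) ⟨
          fromℕ t ℚ.* lookup (scaled y) i        ≡⟨ lookup-map i (fromℕ t ℚ.*_) (scaled y) ⟨
          lookup (map (fromℕ t ℚ.*_) (scaled y)) i ∎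
          where
          open ≡-Reasoning
          e : ∀ i → lookup (scaled y) i ~ lookup y i
          e i = scaling (trans (cong (fromℕ t ℚ.*_) (lookup-map i (λ a → inverse t 1≤t ℚ.* fromℕ a) y)) (*-inverse t 1≤t (fromℕ (lookup y i))))

        -- A lattice point of the dilate is t x with x ≥ 0, so its entries equal their absolute
        -- values.
        from : ∀ z → latticePoints (dilate t (Δ c k)) z → z ∈ List.map (map pos) (points t c (t * k))
        from z (x , p , q) = subst (_∈ List.map (map pos) (points t c (t * k))) y-eq (∈-map⁺ (map pos) (Δ⁻ x y e p))
          where
          open ≡-Reasoning
          y : Vec ℕ (d + 2)
          y = map ∣_∣ z
          pointwise : ∀ i → fromℤ (lookup z i) ≡ fromℕ t ℚ.* lookup x i
          pointwise i = trans (sym (lookup-map i fromℤ z)) (trans (cong (λ v → lookup v i) q) (lookup-map i (fromℕ t ℚ.*_) x))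
          nonNegative : ∀ i → ℤ.0ℤ ℤ.≤ lookup z i
          nonNegative i = fromℤ-cancel-≤ {ℤ.0ℤ} {lookup z i} (subst₂ ℚ._≤_ (ℚ.*-zeroʳ (fromℕ t)) (sym (pointwise i)) (fromℕ-*-mono t 1≤t (proj₁ p i)))
          same : ∀ i → pos (lookup y i) ≡ lookup z i
          same i = trans (cong pos (lookup-map i ∣_∣ z)) (ℤ.0≤i⇒+∣i∣≡i (nonNegative i))
          y-eq : map pos y ≡ z
          y-eq = vec-ext λ i → trans (lookup-map i pos y) (same i)
          e : ∀ i → lookup x i ~ lookup y i
          e i = scaling (trans (sym (pointwise i)) (cong fromℤ (sym (same i))))

        map-pos-injective : ∀ {n} {u v : Vec ℕ n} → map pos u ≡ map pos v → u ≡ v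
        map-pos-injective {u = u} {v} h = vec-ext λ i → ℤ.+-injective
          (trans (sym (lookup-map i pos u)) (trans (cong (λ w → lookup w i) h) (lookup-map i pos v)))

      points-cardinality : latticePoints (dilate t (Δ c k)) HasCardinality length (points t c (t * k))
      points-cardinality =
        List.map (map pos) (points t c (t * k)) ,
        map⁺ map-pos-injective (points-unique t c (t * k)) ,
        (λ z → mk⇔ (to z) (from z)) ,
        length-map (map pos) (points t c (t * k))

  -- The coordinates of a point add up to at most the sum of their upper bounds. Here nonemptiness
  -- of the polytope excludes k > 1 + Σ cᵢ.
  satisfiable-bound : ∀ {d} (c : Vec ℕ d) k → Satisfiable (Δ c k) → k ≤ suc (sum c)
  satisfiable-bound c k (x , _ , s , g , l) = fromℕ-cancel-≤ {k} {suc (sum c)} (subst (ℚ._≤ fromℕ (suc (sum c))) s (bound c x g l))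
    where
    bound : ∀ {d} (c : Vec ℕ d) (x : Vec ℚ (d + 2)) → (∀ (i : Fin d) → lookup x (old i) ℚ.≤ fromℕ (lookup c i)) →
            lookup x (penultimate {d}) ℚ.+ lookup x (ultimate {d}) ℚ.≤ 1ℚ → ∑ℚ x ℚ.≤ fromℕ (suc (sum c))
    bound [] (a ∷ b ∷ []) g l = subst (ℚ._≤ 1ℚ) (cong (a ℚ.+_) (sym (ℚ.+-identityʳ b))) l
    bound (c ∷ cs) (x ∷ xs) g l = subst (∑ℚ (x ∷ xs) ℚ.≤_)
      (trans (sym (fromℕ-+ c (suc (sum cs)))) (cong fromℕ (ℕ.+-suc c (sum cs))))
      (ℚ.+-mono-≤ (g zero) (bound cs xs (g ∘ suc) l))

-- Translating the definitions of S₁ to S₄ into rules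

module Sets where

  open import Defs
  open Series
  open Cycles
  open Recursion
  open ClosedForm
  open LatticeSeries using (padded)
  open LatticePoints using (<ᵇ⁻; <ᵇ⁺; true⇒T; T⇒true)
  open import Data.Nat using (_+_; _<_)
  import Data.Fin as Fin
  open import Data.Fin.Subset using (_∈_; _∉_)
  import Data.List.Membership.Propositional as List
  open import Data.List.Membership.Propositional.Properties using (∈-lookup)
  open import Data.List.Relation.Unary.All using () renaming (lookup to lookupAll)
  open import Data.List.Relation.Unary.Any using (index)
  open import Data.List.Relation.Unary.Any.Properties using (lookup-index)
  open import Data.Vec using (lookup)
  open import Data.Vec.Properties using ([]=⇒lookup; lookup⇒[]=)

  open Equivalence using (to; from)

  sumOver-dot : ∀ {d} (c : Vec ℕ d) s → sumOver c s ≡ dot (padded c) s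
  sumOver-dot []       (true  ∷ true  ∷ []) = refl
  sumOver-dot []       (true  ∷ false ∷ []) = refl
  sumOver-dot []       (false ∷ true  ∷ []) = refl
  sumOver-dot []       (false ∷ false ∷ []) = refl
  sumOver-dot (c ∷ cs) (b ∷ s)              = cong ((if b then c else 0) +_) (sumOver-dot cs s)

  private
    not⁺ : ∀ {b} → ¬ b ≡ true → not b ≡ true
    not⁺ {false} _ = refl
    not⁺ {true}  h = contradiction refl h

    not⁻ : ∀ {b} → not b ≡ true → ¬ b ≡ true
    not⁻ {false} _ ()

  -- The conditions on a single cycle of weight w and sum v; A and B say that it
  -- contains the penultimate and the ultimate element.
  module Conditions (A B : Set) (w v : ℕ) where

    IsProper : Set
    IsProper = (¬ A × ¬ B → w < v) × (A ⊎ B → w < 1 + v)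

    module _ (a b : Bool) (A⇔ : A ⇔ a ≡ true) (B⇔ : B ⇔ b ≡ true) where

      noA : a ≡ false → ¬ A
      noA refl x with () ← to A⇔ x
      noB : b ≡ false → ¬ B
      noB refl x with () ← to B⇔ x

      neither⁺ : a ≡ false → b ≡ false → w < v → IsProper
      neither⁺ p q h = (λ _ → h) , λ { (inj₁ x) → contradiction x (noA p) ; (inj₂ y) → contradiction y (noB q) }

      some⁺ : A ⊎ B → w < suc v → IsProper
      some⁺ (inj₁ x) h = (λ n → contradiction x (proj₁ n)) , λ _ → h
      some⁺ (inj₂ y) h = (λ n → contradiction y (proj₂ n)) , λ _ → h

      someOf : a ≡ true ⊎ b ≡ true → A ⊎ B
      someOf (inj₁ p) = inj₁ (from A⇔ p)
      someOf (inj₂ q) = inj₂ (from B⇔ q)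

      improper⁺ : a ≡ true ⊎ b ≡ true → ¬ IsProper → sem (ge (suc v)) w ≡ true
      improper⁺ p h = not⁺ λ e → h (some⁺ (someOf p) (<ᵇ⁻ {w} {suc v} e))

      improper⁻ : a ≡ true ⊎ b ≡ true → sem (ge (suc v)) w ≡ true → ¬ IsProper
      improper⁻ p h (_ , g) = not⁻ h (<ᵇ⁺ (g (someOf p)))

    rule₁⁺ : ∀ a b → A ⇔ a ≡ true → B ⇔ b ≡ true → IsProper → sem (rule₁ a b v) w ≡ true
    rule₁⁺ false false p q (f , g) = <ᵇ⁺ (f ((λ x → contradiction (to p x) λ ()) , (λ y → contradiction (to q y) λ ())))
    rule₁⁺ true  false p q (f , g) = <ᵇ⁺ (g (inj₁ (from p refl)))
    rule₁⁺ false true  p q (f , g) = <ᵇ⁺ (g (inj₂ (from q refl)))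
    rule₁⁺ true  true  p q (f , g) = <ᵇ⁺ (g (inj₁ (from p refl)))

    rule₁⁻ : ∀ a b → A ⇔ a ≡ true → B ⇔ b ≡ true → sem (rule₁ a b v) w ≡ true → IsProper
    rule₁⁻ false false p q h = neither⁺ false false p q refl refl (<ᵇ⁻ {w} {v} h)
    rule₁⁻ true  false p q h = some⁺ true false p q (inj₁ (from p refl)) (<ᵇ⁻ {w} {suc v} h)
    rule₁⁻ false true  p q h = some⁺ false true p q (inj₂ (from q refl)) (<ᵇ⁻ {w} {suc v} h)
    rule₁⁻ true  true  p q h = some⁺ true true p q (inj₁ (from p refl)) (<ᵇ⁻ {w} {suc v} h)

    rule₂⁺ : ∀ a b → A ⇔ a ≡ true → B ⇔ b ≡ true →
             (¬ A → IsProper) → ¬ (A × B) → (A → ¬ IsProper) → (B → w ≡ v) → sem (rule₂ a b v) w ≡ true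
    rule₂⁺ false false p q f g h e = rule₁⁺ false false p q (f λ x → contradiction (to p x) λ ())
    rule₂⁺ true  false p q f g h e = improper⁺ true false p q (inj₁ refl) (h (from p refl))
    rule₂⁺ false true  p q f g h e = T⇒true (ℕ.≡⇒≡ᵇ w v (e (from q refl)))
    rule₂⁺ true  true  p q f g h e = contradiction (from p refl , from q refl) g

    rule₂⁻ : ∀ a b → A ⇔ a ≡ true → B ⇔ b ≡ true → sem (rule₂ a b v) w ≡ true →
             (¬ A → IsProper) × ¬ (A × B) × (A → ¬ IsProper) × (B → w ≡ v)
    rule₂⁻ false false p q h =
      (λ _ → rule₁⁻ false false p q h) , noA false false p q refl ∘ proj₁ ,
      (λ x → contradiction x (noA false false p q refl)) , λ y → contradiction y (noB false false p q refl)
    rule₂⁻ true  false p q h =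
      (λ n → contradiction (from p refl) n) , noB true false p q refl ∘ proj₂ ,
      (λ _ → improper⁻ true false p q (inj₁ refl) h) , λ y → contradiction y (noB true false p q refl)
    rule₂⁻ false true  p q h =
      -- The equality w = v makes the cycle of n properly weighted, as S₂ requires of every cycle
      -- without n - 1.
      (λ _ → some⁺ false true p q (inj₂ (from q refl)) (s≤s (ℕ.≤-reflexive e))) , noA false true p q refl ∘ proj₁ ,
      (λ x → contradiction x (noA false true p q refl)) , λ _ → e
      where
      e : w ≡ v
      e = ℕ.≡ᵇ⇒≡ w v (true⇒T h)

    rule₃⁺ : ∀ a b → A ⇔ a ≡ true → B ⇔ b ≡ true →
             (¬ A → ¬ B → IsProper) → ¬ (A × B) → (A → ¬ IsProper) → (B → w < v) → sem (rule₃ a b v) w ≡ true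
    rule₃⁺ false false p q f g h e = rule₁⁺ false false p q (f (noA false false p q refl) (noB false false p q refl))
    rule₃⁺ true  false p q f g h e = improper⁺ true false p q (inj₁ refl) (h (from p refl))
    rule₃⁺ false true  p q f g h e = <ᵇ⁺ (e (from q refl))
    rule₃⁺ true  true  p q f g h e = contradiction (from p refl , from q refl) g

    rule₃⁻ : ∀ a b → A ⇔ a ≡ true → B ⇔ b ≡ true → sem (rule₃ a b v) w ≡ true →
             (¬ A → ¬ B → IsProper) × ¬ (A × B) × (A → ¬ IsProper) × (B → w < v)
    rule₃⁻ false false p q h =
      (λ _ _ → rule₁⁻ false false p q h) , noA false false p q refl ∘ proj₁ ,
      (λ x → contradiction x (noA false false p q refl)) , λ y → contradiction y (noB false false p q refl)
    rule₃⁻ true  false p q h =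
      (λ n → contradiction (from p refl) n) , noB true false p q refl ∘ proj₂ ,
      (λ _ → improper⁻ true false p q (inj₁ refl) h) , λ y → contradiction y (noB true false p q refl)
    rule₃⁻ false true  p q h =
      (λ _ n → contradiction (from q refl) n) , noA false true p q refl ∘ proj₁ ,
      (λ x → contradiction x (noA false true p q refl)) , λ _ → <ᵇ⁻ {w} {v} h

    rule₄-both⁺ : ∀ a b → A ⇔ a ≡ true → B ⇔ b ≡ true → A → B → ¬ IsProper → sem (rule₄ a b v) w ≡ true
    rule₄-both⁺ a b p q x y h with refl ← to p x | refl ← to q y = improper⁺ true true p q (inj₁ refl) h

    rule₄-neither⁺ : ∀ a b → A ⇔ a ≡ true → B ⇔ b ≡ true → ¬ A → ¬ B → IsProper → sem (rule₄ a b v) w ≡ true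
    rule₄-neither⁺ false false p q m n h       = rule₁⁺ false false p q h
    rule₄-neither⁺ true  b     p q m n h       = contradiction (from p refl) m
    rule₄-neither⁺ false true  p q m n h       = contradiction (from q refl) n

    rule₄-both⁻ : ∀ a b → A ⇔ a ≡ true → B ⇔ b ≡ true → A → sem (rule₄ a b v) w ≡ true → B × ¬ IsProper
    rule₄-both⁻ a b p q x h with refl ← to p x with b
    ... | true = from q refl , improper⁻ true true p q (inj₁ refl) h

    rule₄-neither⁻ : ∀ a b → A ⇔ a ≡ true → B ⇔ b ≡ true → ¬ A → sem (rule₄ a b v) w ≡ true → IsProper
    rule₄-neither⁻ false false p q n h = rule₁⁻ false false p q h
    rule₄-neither⁻ true  b     p q n h = contradiction (from p refl) n

  module _ {d} (c : Vec ℕ d) (T : Triple (d + 2)) where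
    open Triple T

    Obeys : Rule → Cycle → Set
    Obeys g 𝔠 = sem (constraint {d} g (padded c) (elements 𝔠)) (weight 𝔠) ≡ true

    private
      pen ult : Fin (d + 2)
      pen = penultimate {d}
      ult = ultimate {d}

      reflects : ∀ (s : Subset (d + 2)) i → i ∈ s ⇔ lookup s i ≡ true
      reflects s i = mk⇔ []=⇒lookup (lookup⇒[]= i s)

      module At (𝔠 : Cycle) where
        s = elements 𝔠
        a = lookup s pen
        b = lookup s ult
        A⇔ = reflects s pen
        B⇔ = reflects s ult
        open Conditions (pen ∈ s) (ult ∈ s) (weight 𝔠) (sumOver c s) public

        obeys⁺ : ∀ g → sem (g a b (sumOver c s)) (weight 𝔠) ≡ true → Obeys g 𝔠
        obeys⁺ g = subst (λ v → sem (g a b v) (weight 𝔠) ≡ true) (sumOver-dot c s)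

        obeys⁻ : ∀ g → Obeys g 𝔠 → sem (g a b (sumOver c s)) (weight 𝔠) ≡ true
        obeys⁻ g = subst (λ v → sem (g a b v) (weight 𝔠) ≡ true) (sym (sumOver-dot c s))

      unique-lookup : ∀ {A : Set} {xs : List A} → Unique xs → ∀ i j → List.lookup xs i ≡ List.lookup xs j → i ≡ j
      unique-lookup (n ∷ u) zero    zero    e = refl
      unique-lookup {xs = x ∷ xs} (n ∷ u) zero    (suc j) e = contradiction e (lookupAll n (∈-lookup {xs = xs} j))
      unique-lookup {xs = x ∷ xs} (n ∷ u) (suc i) zero    e = contradiction (sym e) (lookupAll n (∈-lookup {xs = xs} i))
      unique-lookup (n ∷ u) (suc i) (suc j) e = cong suc (unique-lookup u i j e)

    cycle-of : IsPermutation σ → ∀ i → ∃[ 𝔠 ] i ∈ elements 𝔠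
    cycle-of perm i = index m , from (reflects (elements (index m)) i)
      (trans (cong (λ s → lookup s i) (sym (lookup-index m))) (cycle-self σ perm i))
      where
      m = ∈-cycles⁺ σ i

    same-cycle : IsPermutation σ → ∀ {i} 𝔠 𝔡 → i ∈ elements 𝔠 → i ∈ elements 𝔡 → 𝔠 ≡ 𝔡
    same-cycle perm {i} 𝔠 𝔡 m n = unique-lookup (cycles-unique σ) 𝔠 𝔡 (trans (through 𝔠 m) (sym (through 𝔡 n)))
      where
      through : ∀ 𝔠 → i ∈ elements 𝔠 → elements 𝔠 ≡ cycleOf σ i
      through 𝔠 m = cycle-of-element σ perm (∈-lookup {xs = cycles σ} 𝔠) (to (reflects (elements 𝔠) i) m)

    compatible⇔ : Compatible c T ⇔ (∀ 𝔠 → Obeys rule₁ 𝔠)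
    compatible⇔ = mk⇔
      (λ h 𝔠 → let open At 𝔠 in obeys⁺ rule₁ (rule₁⁺ a b A⇔ B⇔ (h 𝔠)))
      (λ h 𝔠 → let open At 𝔠 in rule₁⁻ a b A⇔ B⇔ (obeys⁻ rule₁ (h 𝔠)))

    rule₂⇔ : ((∀ 𝔠 → pen ∉ elements 𝔠 → Proper c T 𝔠) × InDifferentCycles c T ×
              (∀ 𝔠 → pen ∈ elements 𝔠 → Improper c T 𝔠) × (∀ 𝔠 → ult ∈ elements 𝔠 → weight 𝔠 ≡ sumOver c (elements 𝔠)))
             ⇔ (∀ 𝔠 → Obeys rule₂ 𝔠)
    rule₂⇔ = mk⇔
      (λ (f , g , h , e) 𝔠 → let open At 𝔠 in obeys⁺ rule₂ (rule₂⁺ a b A⇔ B⇔ (f 𝔠) (g 𝔠) (h 𝔠) (e 𝔠)))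
      (λ h → let r = λ 𝔠 → let open At 𝔠 in rule₂⁻ a b A⇔ B⇔ (obeys⁻ rule₂ (h 𝔠)) in
        proj₁ ∘ r , proj₁ ∘ proj₂ ∘ r , proj₁ ∘ proj₂ ∘ proj₂ ∘ r , proj₂ ∘ proj₂ ∘ proj₂ ∘ r)

    rule₃⇔ : ((∀ 𝔠 → pen ∉ elements 𝔠 → ult ∉ elements 𝔠 → Proper c T 𝔠) × InDifferentCycles c T ×
              (∀ 𝔠 → pen ∈ elements 𝔠 → Improper c T 𝔠) × (∀ 𝔠 → ult ∈ elements 𝔠 → weight 𝔠 < sumOver c (elements 𝔠)))
             ⇔ (∀ 𝔠 → Obeys rule₃ 𝔠)
    rule₃⇔ = mk⇔
      (λ (f , g , h , e) 𝔠 → let open At 𝔠 in obeys⁺ rule₃ (rule₃⁺ a b A⇔ B⇔ (f 𝔠) (g 𝔠) (h 𝔠) (e 𝔠)))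
      (λ h → let r = λ 𝔠 → let open At 𝔠 in rule₃⁻ a b A⇔ B⇔ (obeys⁻ rule₃ (h 𝔠)) in
        proj₁ ∘ r , proj₁ ∘ proj₂ ∘ r , proj₁ ∘ proj₂ ∘ proj₂ ∘ r , proj₂ ∘ proj₂ ∘ proj₂ ∘ r)

    -- S₄ singles out one cycle, whereas a rule judges every cycle separately; the two agree because
    -- each element lies in exactly one cycle.
    rule₄⇔ : IsPermutation σ →
             (∃[ 𝔠 ] pen ∈ elements 𝔠 × ult ∈ elements 𝔠 × Improper c T 𝔠 × (∀ 𝔡 → 𝔡 ≢ 𝔠 → Proper c T 𝔡))
             ⇔ (∀ 𝔠 → Obeys rule₄ 𝔠)
    rule₄⇔ perm = mk⇔ forth back
      where
      Together : Set
      Together = ∃[ 𝔠 ] pen ∈ elements 𝔠 × ult ∈ elements 𝔠 × Improper c T 𝔠 × (∀ 𝔡 → 𝔡 ≢ 𝔠 → Proper c T 𝔡)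
      forth : Together → ∀ 𝔠 → Obeys rule₄ 𝔠
      forth (𝔠 , x , y , h , f) 𝔡 with 𝔡 Fin.≟ 𝔠
      ... | yes refl = let open At 𝔠 in obeys⁺ rule₄ (rule₄-both⁺ a b A⇔ B⇔ x y h)
      ... | no ne    = let open At 𝔡 in obeys⁺ rule₄ (rule₄-neither⁺ a b A⇔ B⇔
        (λ x′ → ne (same-cycle perm 𝔡 𝔠 x′ x)) (λ y′ → ne (same-cycle perm 𝔡 𝔠 y′ y)) (f 𝔡 ne))
      back : (∀ 𝔠 → Obeys rule₄ 𝔠) → Together
      back h =
        let 𝔠 , x = cycle-of perm pen
            y , i = let open At 𝔠 in rule₄-both⁻ a b A⇔ B⇔ x (obeys⁻ rule₄ (h 𝔠))
        in 𝔠 , x , y , i , λ 𝔡 ne → let open At 𝔡 in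
          rule₄-neither⁻ a b A⇔ B⇔ (λ x′ → ne (same-cycle perm 𝔡 𝔠 x′ x)) (obeys⁻ rule₄ (h 𝔡))

    -- The only cycle contains both n - 1 and n, and there `rule₁` and `rule₄` are complementary.
    single-cycle : IsPermutation σ → ∣C σ ∣ ≡ 1 → (∀ 𝔠 → Obeys rule₁ 𝔠) ⊎ (∀ 𝔠 → Obeys rule₄ 𝔠)
    single-cycle perm e = either (sem (lt (suc v)) (weight 𝔠)) refl
      where
      𝔠 = proj₁ (cycle-of perm pen)
      v = sumOver c (elements 𝔠)
      fin1 : ∀ {r} → r ≡ 1 → (i j : Fin r) → i ≡ j
      fin1 refl zero zero = refl
      open At 𝔠
      a≡ : a ≡ true
      a≡ = to A⇔ (proj₂ (cycle-of perm pen))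
      b≡ : b ≡ true
      b≡ = to B⇔ (subst (λ 𝔡 → ult ∈ elements 𝔡) (fin1 e _ 𝔠) (proj₂ (cycle-of perm ult)))
      everywhere : ∀ g → sem (g true true v) (weight 𝔠) ≡ true → ∀ 𝔡 → Obeys g 𝔡
      everywhere g h 𝔡 = subst (Obeys g) (fin1 e 𝔠 𝔡)
        (obeys⁺ g (subst₂ (λ x y → sem (g x y v) (weight 𝔠) ≡ true) (sym a≡) (sym b≡) h))
      either : ∀ x → sem (lt (suc v)) (weight 𝔠) ≡ x → (∀ 𝔠 → Obeys rule₁ 𝔠) ⊎ (∀ 𝔠 → Obeys rule₄ 𝔠)
      either true  h = inj₁ (everywhere rule₁ h)
      either false h = inj₂ (everywhere rule₄ (cong not h))

    rule₁-rule₄-disjoint : IsPermutation σ → (∀ 𝔠 → Obeys rule₁ 𝔠) → ¬ (∀ 𝔠 → Obeys rule₄ 𝔠)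
    rule₁-rule₄-disjoint perm f g =
      let 𝔠 , _ , _ , improper , _ = from (rule₄⇔ perm) g in improper (from compatible⇔ f 𝔠)

-- The sizes of the sets and the Ehrhart coefficients

open import Defs
open Sums
open Series
open Counting using (Admissible; admissible-cardinality)
open Recursion
open ClosedForm
open LatticeSeries
open Comparison
open Rationals
open Polynomials
open LatticePoints
open Sets
open import Data.Nat using (_+_; _<_; _≤_; _>_; _!)
open import Data.Integer as ℤ using (+_)
import Data.Integer.Properties as ℤ
import Data.Rational as ℚ
open import Data.List using (applyUpTo)
open import Data.List.Properties using (length-++)
open import Data.List.Membership.Propositional.Properties using (∈-++⁺ˡ; ∈-++⁺ʳ; ∈-++⁻)
import Data.List.Relation.Unary.Unique.Propositional.Properties as Unique
open import Data.Vec using (lookup; sum)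
open import Relation.Unary using (Pred; Satisfiable; _∪_)
open import Level using (0ℓ)

open Equivalence using (to; from)

cardinality-∪ : ∀ {A : Set} {P Q : Pred A 0ℓ} {M N} → (∀ x → P x → ¬ Q x) →
                P HasCardinality M → Q HasCardinality N → (P ∪ Q) HasCardinality (M + N)
cardinality-∪ disjoint (xs , u , e , refl) (ys , v , f , refl) =
  xs List.++ ys ,
  Unique.++⁺ u v (λ (p , q) → disjoint _ (to (e _) p) (to (f _) q)) ,
  (λ x → mk⇔
    (λ m → Data.Sum.map (to (e x)) (to (f x)) (∈-++⁻ xs m))
    λ { (inj₁ p) → ∈-++⁺ˡ (from (e x) p) ; (inj₂ q) → ∈-++⁺ʳ xs (from (f x) q) }) ,
  length-++ xs

cardinality-∅ : ∀ {A : Set} {P : Pred A 0ℓ} → (∀ x → ¬ P x) → P HasCardinality 0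
cardinality-∅ h = [] , [] , (λ x → mk⇔ (λ ()) λ p → contradiction p (h x)) , refl

module _ {d} (c : Vec ℕ d) (k : ℕ) where

  Obeying : Rule → ℕ → Pred (Triple (d + 2)) 0ℓ
  Obeying g r = Admissible (constraint {d} g (padded c)) r k

  obeying-cardinality : ∀ g r → Obeying g r HasCardinality number c k g r
  obeying-cardinality g r = admissible-cardinality (constraint {d} g (padded c)) r k

  S₁-regular : ∀ m → Regular d k m → ∀ T → Obeying rule₁ (suc m) T ⇔ S₁ c k m T
  S₁-regular m R T = mk⇔
    (λ (ty , h) → inj₁ (R , subst (λ r → OfType r k T) (ℕ.+-comm 1 m) ty , from (compatible⇔ c T) h))
    λ { (inj₁ (_ , ty , h)) → subst (λ r → OfType r k T) (ℕ.+-comm m 1) ty , to (compatible⇔ c T) h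
      ; (inj₂ ((k≡ , m≡) , _)) → contradiction R (irregular k≡ m≡) }
    where
    irregular : k ≡ d + 1 → m + 1 ≡ 1 → ¬ Regular d k m
    irregular refl e (inj₁ h) = ℕ.<-irrefl refl h
    irregular k≡   e (inj₂ h) = ℕ.<-irrefl (sym e) h

  -- Here S₁ puts no condition on the weight, and a single cycle is either properly or improperly
  -- weighted. The improper ones are the exception at m = 0.
  S₁-special : Special d k 0 → ∀ T → (Obeying rule₁ 1 ∪ Obeying rule₄ 1) T ⇔ S₁ c k 0 T
  S₁-special (k≡ , _) T = mk⇔ forth back
    where
    forth : (Obeying rule₁ 1 ∪ Obeying rule₄ 1) T → S₁ c k 0 T
    forth (inj₁ (ty , _)) = inj₂ ((k≡ , refl) , subst (λ k → OfType 1 k T) k≡ ty)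
    forth (inj₂ (ty , _)) = inj₂ ((k≡ , refl) , subst (λ k → OfType 1 k T) k≡ ty)
    back : S₁ c k 0 T → (Obeying rule₁ 1 ∪ Obeying rule₄ 1) T
    back (inj₁ (_ , ty , h)) = inj₁ (ty , to (compatible⇔ c T) h)
    back (inj₂ (_ , ty)) = Data.Sum.map (ty′ ,_) (ty′ ,_) (single-cycle c T (proj₁ (proj₁ ty)) (proj₁ (proj₂ ty)))
      where
      ty′ : OfType 1 k T
      ty′ = subst (λ k → OfType 1 k T) (sym k≡) ty

  S₂-obeying : ∀ m T → Obeying rule₂ (suc m) T ⇔ S₂ c k m T
  S₂-obeying m T = mk⇔
    (λ (ty , h) → subst (λ r → OfType r k T) (ℕ.+-comm 1 m) ty , from (rule₂⇔ c T) h)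
    (λ (ty , h) → subst (λ r → OfType r k T) (ℕ.+-comm m 1) ty , to (rule₂⇔ c T) h)

  S₃-obeying : ∀ m T → Obeying rule₃ m T ⇔ S₃ c k m T
  S₃-obeying m T = mk⇔
    (λ (ty , h) → ty , from (rule₃⇔ c T) h)
    (λ (ty , h) → ty , to (rule₃⇔ c T) h)

  S₄-obeying : ∀ m → m > 1 → ∀ T → Obeying rule₄ m T ⇔ S₄ c k m T
  S₄-obeying m m>1 T = mk⇔
    (λ (ty , h) → m>1 , ty , from (rule₄⇔ c T (proj₁ (proj₁ ty))) h)
    (λ (_ , ty , h) → ty , to (rule₄⇔ c T (proj₁ (proj₁ ty))) h)

  -- The cycle of n - 1 is proper in one set and improper in the other; in the special case a single
  -- cycle cannot separate n - 1 from n.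
  S₁-S₂-disjoint : ∀ m T → S₁ c k m T → ¬ S₂ c k m T
  S₁-S₂-disjoint m T (inj₁ (_ , _ , compatible)) (ty , _ , _ , improper , _) =
    let 𝔠 , h = cycle-of c T (proj₁ (proj₁ ty)) penultimate in improper 𝔠 h (compatible 𝔠)
  S₁-S₂-disjoint m T (inj₂ (_ , ty)) (_ , _ , different , _) =
    let perm  = proj₁ (proj₁ ty)
        𝔠 , h = cycle-of c T perm penultimate
        𝔡 , g = cycle-of c T perm ultimate
    in different 𝔠 (h , subst (λ 𝔠 → ultimate ∈ Triple.elements T 𝔠) (fin1 (proj₁ (proj₂ ty)) 𝔡 𝔠) g)
    where
    open import Data.Fin.Subset using (_∈_)
    fin1 : ∀ {r} → r ≡ 1 → (i j : Fin r) → i ≡ j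
    fin1 refl zero zero = refl

  S₃-S₄-disjoint : ∀ m T → S₃ c k m T → ¬ S₄ c k m T
  S₃-S₄-disjoint m T (_ , _ , different , _) (_ , _ , 𝔠 , h , g , _) = different 𝔠 (h , g)

  record Sizes (m s₁ s₂ s₃ s₄ : ℕ) : Set where
    field
      size₁ : S₁ c k m HasCardinality s₁
      size₂ : S₂ c k m HasCardinality s₂
      size₃ : S₃ c k m HasCardinality s₃
      size₄ : S₄ c k m HasCardinality s₄
      value : coefficient c k m ≡ + s₁ ℤ.+ + s₂ ℤ.- + s₃ ℤ.- + s₄

  private
    S₂-size : ∀ m → S₂ c k m HasCardinality number c k rule₂ (suc m)
    S₂-size m = cardinality-cong (S₂-obeying m) (obeying-cardinality rule₂ (suc m))

    S₃-size : ∀ m → S₃ c k m HasCardinality number c k rule₃ m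
    S₃-size m = cardinality-cong (S₃-obeying m) (obeying-cardinality rule₃ m)

    S₁-size : ∀ m → Regular d k m → S₁ c k m HasCardinality number c k rule₁ (suc m)
    S₁-size m R = cardinality-cong (S₁-regular m R) (obeying-cardinality rule₁ (suc m))

    S₄-empty : ∀ m → ¬ m > 1 → S₄ c k m HasCardinality 0
    S₄-empty m h = cardinality-∅ λ T (m>1 , _) → h m>1

    vanish : ∀ a b x y → a ℤ.+ b ℤ.- x ℤ.- y ℤ.+ ℤ.0ℤ ≡ a ℤ.+ b ℤ.- x ℤ.- y
    vanish = solve-∀

    cancel : ∀ a b x y → a ℤ.+ b ℤ.- x ℤ.- y ℤ.+ y ≡ a ℤ.+ b ℤ.- x ℤ.- ℤ.0ℤ
    cancel = solve-∀

    absorb : ∀ a b x y → a ℤ.+ b ℤ.- x ℤ.- ℤ.0ℤ ℤ.+ y ≡ (a ℤ.+ y) ℤ.+ b ℤ.- x ℤ.- ℤ.0ℤ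
    absorb = solve-∀

    number-zero : ∀ g → number c k g 0 ≡ 0
    number-zero g = count-zero (constraint {d} g (padded c)) k

  sizes : (∀ i → 0 < lookup c i) → ∀ m → Regular d k m ⊎ Special d k m →
          ∃[ s₁ ] ∃[ s₂ ] ∃[ s₃ ] ∃[ s₄ ] Sizes m s₁ s₂ s₃ s₄
  -- All cᵢ are at least 1, so k < n - 1 implies k ≤ Σ cᵢ, and the exception at m = 0 is 0.
  sizes c>0 0 (inj₁ R@(inj₁ k<)) = _ , _ , _ , _ , record
    { size₁ = S₁-size 0 R
    ; size₂ = S₂-size 0
    ; size₃ = S₃-size 0
    ; size₄ = S₄-empty 0 λ ()
    ; value = trans
        (cong₂ (λ x y → n₁ ℤ.+ n₂ ℤ.- n₃ ℤ.- + x ℤ.+ + y) (number-zero rule₄) (exception-vanishes c k small))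
        (vanish n₁ n₂ n₃ ℤ.0ℤ)
    }
    where
    n₁ = + number c k rule₁ 1
    n₂ = + number c k rule₂ 1
    n₃ = + number c k rule₃ 0
    d≤sum : ∀ {d} (c : Vec ℕ d) → (∀ i → 0 < lookup c i) → d ≤ sum c
    d≤sum []       h = z≤n
    d≤sum (c ∷ cs) h = ℕ.+-mono-≤ (h zero) (d≤sum cs (h ∘ suc))
    small : k < suc (sum c)
    small = ℕ.<-≤-trans k< (ℕ.≤-trans (ℕ.≤-reflexive (ℕ.+-comm d 1)) (s≤s (d≤sum c c>0)))
  sizes c>0 0 (inj₁ (inj₂ (s≤s ())))
  -- The exception is now part of the size of S₁.
  sizes c>0 0 (inj₂ R) = _ , _ , _ , _ , record
    { size₁ = cardinality-cong (S₁-special R)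
        (cardinality-∪ (λ T (ty , f) (_ , g) → rule₁-rule₄-disjoint c T (proj₁ (proj₁ ty)) f g)
          (obeying-cardinality rule₁ 1) (obeying-cardinality rule₄ 1))
    ; size₂ = S₂-size 0
    ; size₃ = S₃-size 0
    ; size₄ = S₄-empty 0 λ ()
    ; value = trans
        (cong (λ x → n₁ ℤ.+ n₂ ℤ.- n₃ ℤ.- + x ℤ.+ n₄) (number-zero rule₄))
        (trans (absorb n₁ n₂ n₃ n₄) (cong (λ x → x ℤ.+ n₂ ℤ.- n₃ ℤ.- ℤ.0ℤ) (sym (ℤ.pos-+ (number c k rule₁ 1) (number c k rule₄ 1)))))
    }
    where
    n₁ = + number c k rule₁ 1
    n₂ = + number c k rule₂ 1
    n₃ = + number c k rule₃ 0
    n₄ = + number c k rule₄ 1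
  -- S₄ is empty by definition; in `coefficient` the exception cancels the count for `rule₄`.
  sizes c>0 1 _ = _ , _ , _ , _ , record
    { size₁ = S₁-size 1 (inj₂ (s≤s (s≤s z≤n)))
    ; size₂ = S₂-size 1
    ; size₃ = S₃-size 1
    ; size₄ = S₄-empty 1 λ { (s≤s ()) }
    ; value = cancel (+ number c k rule₁ 2) (+ number c k rule₂ 2) (+ number c k rule₃ 1) (+ number c k rule₄ 1)
    }
  sizes c>0 m@(suc (suc _)) _ = _ , _ , _ , _ , record
    { size₁ = S₁-size m (inj₂ (s≤s (s≤s z≤n)))
    ; size₂ = S₂-size m
    ; size₃ = S₃-size m
    ; size₄ = cardinality-cong (S₄-obeying m (s≤s (s≤s z≤n))) (obeying-cardinality rule₄ m)
    ; value = vanish (+ number c k rule₁ (suc m)) (+ number c k rule₂ (suc m)) (+ number c k rule₃ m) (+ number c k rule₄ m)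
    }

  ehrhart-coefficient : k ≤ suc (sum c) → ∀ ehr → IsEhrhartPolynomial (Δ c k) ehr →
                        ∀ m → [t^ m ] (((d + 1) !) · ehr) ≡ fromℤ (coefficient c k m)
  ehrhart-coefficient k≤ ehr h m = trans
    (polynomial-identity (((d + 1) !) · ehr) (applyUpTo (fromℤ ∘ coefficient c k) L) same m)
    ([t^]-applyUpTo (fromℤ ∘ coefficient c k) (s≤s (ℕ.m≤n⇒m≤1+n (ℕ.m≤n+m m (d + 2)))))
    where
    -- Long enough for permutations with up to n cycles, for the two exceptions, and to contain
    -- coefficient m.
    L = suc (suc (d + 2 + m))
    same : ∀ t → 0 < t → ⟦ ((d + 1) !) · ehr ⟧ (fromℕ t) ≡ ⟦ applyUpTo (fromℤ ∘ coefficient c k) L ⟧ (fromℕ t)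
    same t t>0 with N , size , value ← h t t>0 = begin
      ⟦ ((d + 1) !) · ehr ⟧ (fromℕ t)
        ≡⟨ ⟦·⟧ ((d + 1) !) ehr (fromℕ t) ⟩
      fromℕ ((d + 1) !) ℚ.* ⟦ ehr ⟧ (fromℕ t)
        ≡⟨ cong (fromℕ ((d + 1) !) ℚ.*_) value ⟩
      fromℕ ((d + 1) !) ℚ.* fromℕ N
        ≡⟨ cong₂ (λ e N → fromℕ (e !) ℚ.* fromℕ N) (ℕ.+-comm d 1) (cardinality-unique size (points-cardinality t t>0 c k)) ⟩
      fromℕ (suc d !) ℚ.* fromℕ (length (points t c (t Data.Nat.* k)))
        ≡⟨ fromℤ-* (+ (suc d !)) (+ length (points t c (t Data.Nat.* k))) ⟨
      fromℤ (+ (suc d !) ℤ.* + length (points t c (t Data.Nat.* k)))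
        ≡⟨ cong fromℤ (points-coefficients c k t t>0 k≤ (d + 2 + m) (ℕ.m≤m+n (d + 2) m)) ⟩
      fromℤ (horner (+ t) L (coefficient c k))
        ≡⟨ ⟦applyUpTo⟧ (coefficient c k) t L ⟨
      ⟦ applyUpTo (fromℤ ∘ coefficient c k) L ⟧ (fromℕ t) ∎
      where open ≡-Reasoning

theorem4p2 : ∀ {d : ℕ} (c : Vec ℕ d) (k : ℕ) →
    (∀ i → 0 < lookup c i) → 0 < k →
    Satisfiable (Δ c k) →
    (ehr : Polynomial) → IsEhrhartPolynomial (Δ c k) ehr →
    (m : ℕ) → Regular d k m ⊎ Special d k m →
    ∃[ s₁ ] ∃[ s₂ ] ∃[ s₃ ] ∃[ s₄ ] ∃[ s₁₂ ] ∃[ s₃₄ ]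
    (S₁ c k m HasCardinality s₁) ×
    (S₂ c k m HasCardinality s₂) ×
    (S₃ c k m HasCardinality s₃) ×
    (S₄ c k m HasCardinality s₄) ×
    ((S₁ c k m ∪ S₂ c k m) HasCardinality s₁₂) ×
    ((S₃ c k m ∪ S₄ c k m) HasCardinality s₃₄) ×
    ([t^ m ] (((d + 1) !) · ehr) ≡ fromℤ (+ s₁ ℤ.+ + s₂ ℤ.- + s₃ ℤ.- + s₄)) ×
    (+ s₁ ℤ.+ + s₂ ℤ.- + s₃ ℤ.- + s₄ ≡ + s₁₂ ℤ.- + s₃₄)
theorem4p2 {d} c k c>0 k>0 nonempty ehr isEhrhart m case
  with s₁ , s₂ , s₃ , s₄ , z ← sizes c k c>0 m case =
  s₁ , s₂ , s₃ , s₄ , s₁ + s₂ , s₃ + s₄ , size₁ , size₂ , size₃ , size₄ ,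
  cardinality-∪ (S₁-S₂-disjoint c k m) size₁ size₂ ,
  cardinality-∪ (S₃-S₄-disjoint c k m) size₃ size₄ ,
  trans (ehrhart-coefficient c k (satisfiable-bound c k nonempty) ehr isEhrhart m) (cong fromℤ value) ,
  trans (regroup (+ s₁) (+ s₂) (+ s₃) (+ s₄)) (cong₂ ℤ._-_ (sym (ℤ.pos-+ s₁ s₂)) (sym (ℤ.pos-+ s₃ s₄)))
  where
  open Sizes z
  regroup : ∀ a b x y → a ℤ.+ b ℤ.- x ℤ.- y ≡ (a ℤ.+ b) ℤ.- (x ℤ.+ y)
  regroup = solve-∀
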